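{- Let $P$ and $H$ be packaged arrow presentations, let $e$ be a fixed edge of $H$, and for each edge $f$ of $P$ let $\varphi_f$ be a coupling of $f$ and $e$, with $\boldsymbol\varphi=\{\varphi_f\}_{f\in E(P)}$. Let $\phi_{(=,2)},\phi_{(\parallel,2)},\phi_{\times},\phi_{(=,1)},\phi_{(\parallel,1)}$ be the unique solution of \[\alpha\beta\gamma\begin{bmatrix}\alpha\beta&1&1&\alpha&1\\1&\alpha\gamma&1&1&\alpha\\1&1&\alpha&1&1\\\alpha&1&1&\alpha&1\\1&\alpha&1&1&\alpha\end{bmatrix}\begin{bmatrix}\phi_{(=,2)}\\\phi_{(\parallel,2)}\\\phi_{\times}\\\phi_{(=,1)}\\\phi_{(\parallel,1)}\end{bmatrix}=\begin{bmatrix}Q(H\setminus e;a,b,c,x,y,\alpha,\beta,\gamma)\\Q(H/e;a,b,c,x,y,\alpha,\beta,\gamma)\\Q(H\dagger e;a,b,c,x,y,\alpha,\beta,\gamma)\\Q(H\setminus_m e;a,b,c,x,y,\alpha,\beta,\gamma)\\Q(H/_m e;a,b,c,x,y,\alpha,\beta,\gamma)\end{bmatrix}.\] Then \[Q(P\otimes_{\boldsymbol\varphi}H;a,b,c,x,y,\alpha,\beta,\gamma)=Q(P;\phi_{(=,2)},\phi_{(\parallel,2)},\phi_{\times},\phi_{(=,1)},\phi_{(\parallel,1)},\alpha,\beta,\gamma).\]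
   Context: An arrow presentation $A$ consists of a finite set $V(A)$ of disjoint circles (the vertices), a finite set of pairwise disjoint arrows (directed arcs) on the circles, and a finite set $E(A)$ of labels (the edges) such that every arrow carries one label and every label is carried by exactly two arrows (constituting that edge). An arrow along a circle from $p$ to $q$ is written $\overrightarrow{pq}$. Arrow presentations are considered up to equivalence (diffeomorphism of circles sending arrows to arrows, reversing both arrows of some edges, relabelling edges bijectively). Boundary components: for every edge $e$ with arrows $\overrightarrow{p_1p_2},\overrightarrow{q_1q_2}$, remove the arrows with the interiors of their arcs and add a curve joining $q_2$ to $p_1$ and one joining $p_2$ to $q_1$; the resulting closed curves form $B(A)$. For an edge $e$ with arrows $\overrightarrow{p_1p_2},\overrightarrow{q_1q_2}$: $A\setminus e$ removes the two arrows (not their arcs) and $e$; $A/e$ removes the arrows with the interiors of their arcs, identifies $p_1$ with $q_2$ and $p_2$ with $q_1$, and removes $e$; $A\dagger e$ (Penrose-contraction) does the same but identifies $p_1$ with $q_1$ and $p_2$ with $q_2$. A packaged arrow presentation is $P=(A,\mathcal V,\mathcal B)$ with $\mathcal V$ a partition of $V(A)$, $\mathcal B$ a partition of $B(A)$; $[v]$ is the block containing $v$. For an edge $e$ with incident vertices $u,v$ and incident boundary components $a,b$ (possibly equal): vertices of $A$ and $A\setminus e$ are identified; vertices of $A$ other than $u,v$ are identified with vertices of $A/e$ (resp. $A\dagger e$) and the rest form the set $T$ of created vertices; boundary components of $A$ and $A/e$ are identified; boundary components of $A$ other than $a,b$ are identified with those of $A\setminus e$ (resp. $A\dagger e$) and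 the rest form the set $S$ of created boundary components. Put $\mathcal V'=(\mathcal V-\{[u],[v]\})\cup\{[u]\cup[v]\}$, $\mathcal B'=(\mathcal B-\{[a],[b]\})\cup\{[a]\cup[b]\cup S-\{a,b\}\}$ ($S$ from deletion), $\mathcal V''=(\mathcal V-\{[u],[v]\})\cup\{[u]\cup[v]\cup T-\{u,v\}\}$ ($T$ from contraction), $\mathcal B''=(\mathcal B-\{[a],[b]\})\cup\{[a]\cup[b]\}$, and $\mathcal V''',\mathcal B'''$ defined like $\mathcal V'',\mathcal B'$ with $T,S$ created by the Penrose-contraction. Then $P\setminus e=(A\setminus e,\mathcal V,\mathcal B')$, $P\setminus_m e=(A\setminus e,\mathcal V',\mathcal B')$ (merge-deletion), $P/e=(A/e,\mathcal V'',\mathcal B)$, $P/_m e=(A/e,\mathcal V'',\mathcal B'')$ (merge-contraction), $P\dagger e=(A\dagger e,\mathcal V''',\mathcal B''')$. A coupling of edge $f$ of $P$ and edge $e$ of $H$ is a bijection from the two arrows of $f$ to the two arrows of $e$. 2-sum: with $P=(A,\mathcal V,\mathcal B)$, $H=(A',\mathcal V',\mathcal B')$ and $\varphi$ sending $\overrightarrow{p_1p_2}\mapsto\overrightarrow{q_1q_2}$, $\overrightarrow{p_3p_4}\mapsto\overrightarrow{q_3q_4}$, $A\oplus_\varphi A'$ deletes these four arrows with the interiors of their arcs and identifies $p_i$ with $q_i$ ($i=1,\dots,4$). Let $u$ (resp. $v$) be the vertex of $A$ containing $\overrightarrow{p_1p_2}$ (resp. $\overrightarrow{p_3p_4}$),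 $a$ (resp. $b$) the boundary component of $A$ containing $p_1,p_4$ (resp. $p_2,p_3$), and $u',v',a',b'$ likewise in $A'$. In $A\oplus_\varphi A'$ let $\alpha_0,\beta_0,\gamma_0,\delta_0$ be the vertices and $h,i,j,k$ the boundary components containing $p_1,p_2,p_3,p_4$ respectively. Then $P\oplus_\varphi H=(A\oplus_\varphi A',\mathcal V^*,\mathcal B^*)$ with $\mathcal V^*=(\mathcal V\cup\mathcal V'-\{[u],[v],[u'],[v']\})\cup\{[u]\cup[u']\cup\{\alpha_0,\beta_0\}-\{u,u'\}\}\cup\{[v]\cup[v']\cup\{\gamma_0,\delta_0\}-\{v,v'\}\}$ and $\mathcal B^*=(\mathcal B\cup\mathcal B'-\{[a],[b],[a'],[b']\})\cup\{[a]\cup[a']\cup\{h,k\}-\{a,a'\}\}\cup\{[b]\cup[b']\cup\{i,j\}-\{b,b'\}\}$. The tensor product $P\otimes_{\boldsymbol\varphi}H$ is obtained from $P$ by taking, for each edge $f$ of $P$, the 2-sum with a distinct copy $H^{(f)}$ of $H$ along the coupling of $f$ with the copy of $e$ induced by $\varphi_f$ (independent of order). Polynomial $Q$: $Q(P;a,b,c,x,y,\alpha,\beta,\gamma)$ is the unique map with $Q(P)=aQ(P\setminus e)+bQ(P/e)+cQ(P\dagger e)+xQ(P\setminus_m e)+yQ(P/_m e)$ for any edge $e$, and $Q(P)=\alpha^{|V(A)|}\beta^{|\mathcal V|}\gamma^{|\mathcal B|}$ when $A$ has no edges. -}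

module Defs where

open import Level using (Level)
open import Function using (_∘_; id)
open import Data.Nat using (ℕ; zero; suc; _≡ᵇ_)
import Data.Nat as ℕ
open import Data.Nat.Properties using (+-assoc; +-identityʳ)
open import Data.Fin using (Fin; zero; suc; punchIn; splitAt)
open import Data.Fin.Properties using () renaming (_≟_ to _≟F_)
open import Data.Bool using (Bool; true; false; if_then_else_; _∧_; _∨_; not)
open import Data.List using (List; []; _∷_; _++_; map; length; concatMap; allFin; deduplicate; filterᵇ)
open import Data.Bool.ListAction using (any; all)
open import Data.Product using (_×_; _,_; proj₁; proj₂)
open import Data.Sum using (_⊎_; inj₁; inj₂)
import Data.Product.Properties as ×P
import Data.Sum.Properties as ⊎P
open import Relation.Binary.PropositionalEquality using (_≡_; _≢_; subst; sym)
open import Relation.Binary.Definitions using (DecidableEquality)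
open import Relation.Nullary.Decidable using (⌊_⌋)
open import Function.Bundles using (_⤖_; Bijection)
open import Algebra.Bundles using (CommutativeRing)

-- Arrow endpoints.  The arrow presentation has edges Fin m; edge e
-- carries two arrows (i : Fin 2); arrow i of e goes from its tail
-- (e , i , 0) to its head (e , i , 1).

End : ℕ → Set
End m = Fin m × Fin 2 × Fin 2

flip2 : Fin 2 → Fin 2
flip2 zero = suc zero
flip2 (suc _) = zero

edgeOf : ∀ {m} → End m → Fin m
edgeOf (e , _ , _) = e

arc : ∀ {m} → End m → End m
arc (e , i , t) = (e , i , flip2 t)

-- boundary connectors of an edge with arrows p1p2, q1q2: q2--p1, p2--q1
conn : ∀ {m} → End m → End m
conn (e , i , t) = (e , flip2 i , flip2 t)

-- Penrose identification p1 ~ q1, p2 ~ q2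
pen : ∀ {m} → End m → End m
pen (e , i , t) = (e , flip2 i , t)

_≟E_ : ∀ {m} → DecidableEquality (End m)
_≟E_ = ×P.≡-dec _≟F_ (×P.≡-dec _≟F_ _≟F_)

allEnd : ∀ m → List (End m)
allEnd m = concatMap (λ e → concatMap (λ i → map (λ t → (e , i , t)) (allFin 2)) (allFin 2)) (allFin m)

-- A packaged arrow presentation with m edges.
--  * gap : the matching of arrow endpoints given by the pieces of circle
--    between consecutive arrows (the circles are the cycles of gap ∪ arc);
--  * empties : circles carrying no arrow, each with (vertex-block label,
--    boundary-block label);
--  * vl / bl : label of the block of 𝒱 (resp. ℬ) containing the vertex
--    (resp. boundary component) through an endpoint.
-- Blocks of 𝒱 / ℬ are the distinct labels.

record Pres (m : ℕ) : Set where
  field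
    gap     : End m → End m
    vl      : End m → ℕ
    bl      : End m → ℕ
    empties : List (ℕ × ℕ)
open Pres public

record WF {m} (P : Pres m) : Set where
  field
    gap-invol : ∀ x → gap P (gap P x) ≡ x
    gap-nofix : ∀ x → gap P x ≢ x
    vl-gap    : ∀ x → vl P (gap P x) ≡ vl P x
    vl-arc    : ∀ x → vl P (arc x) ≡ vl P x
    bl-gap    : ∀ x → bl P (gap P x) ≡ bl P x
    bl-conn   : ∀ x → bl P (conn x) ≡ bl P x

module Graph {X : Set} (enum : List X) (_≟X_ : DecidableEquality X) where

  _∈ᵇ_ : X → List X → Bool
  x ∈ᵇ xs = any (λ y → ⌊ x ≟X y ⌋) xs

  reach : (X → X) → (X → X) → ℕ → List X → List X
  reach σ τ zero S = S
  reach σ τ (suc k) S = reach σ τ k (deduplicate _≟X_ (S ++ map σ S ++ map τ S))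

  comp : (X → X) → (X → X) → X → List X
  comp σ τ x = reach σ τ (length enum) (x ∷ [])

  connected : (X → X) → (X → X) → X → X → Bool
  connected σ τ x y = y ∈ᵇ comp σ τ x

  reps : (X → X) → (X → X) → List X
  reps σ τ = go enum []
    where
    go : List X → List X → List X
    go [] prev = []
    go (x ∷ xs) prev =
      if any (λ y → connected σ τ x y) prev then go xs (x ∷ prev)
      else x ∷ go xs (x ∷ prev)

  ncomp : (X → X) → (X → X) → ℕ
  ncomp σ τ = length (reps σ τ)

ndistinct : List ℕ → ℕ
ndistinct xs = length (deduplicate Data.Nat._≟_ xs)

nVert : ∀ {m} → Pres m → ℕ
nVert {m} P = Graph.ncomp (allEnd m) _≟E_ (gap P) arc ℕ.+ length (empties P)

nVblocks : ∀ {m} → Pres m → ℕ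
nVblocks {m} P = ndistinct (map (vl P) (allEnd m) ++ map proj₁ (empties P))

nBblocks : ∀ {m} → Pres m → ℕ
nBblocks {m} P = ndistinct (map (bl P) (allEnd m) ++ map proj₂ (empties P))

merge : (ℕ → ℕ) → ℕ → ℕ → ℕ → ℕ
merge r x y l = if r l ≡ᵇ r y then r x else r l

-- Generic surgery: from a finite set X of endpoints, remove the arrows
-- at the endpoints satisfying rem together with the interiors of their
-- arcs, identifying each removed endpoint z with μ z; keep the
-- endpoints in the image of emb.

rebuild : {X : Set} (enum : List X) (_≟X_ : DecidableEquality X) {m' : ℕ}
          (emb : End m' → X) (gapX : X → X) (rem : X → Bool) (μ : X → X)
          (arcX : X → X) (vlX blX : X → ℕ) (rv rb : ℕ → ℕ)
          (oldEmpties : List (ℕ × ℕ)) → Pres m'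
rebuild {X} enum _≟X_ {m'} emb gapX rem μ arcX vlX blX rv rb oldEmpties = record
  { gap     = λ x → back (allEnd m') (hop (length enum) (gapX (emb x))) x
  ; vl      = λ x → rv (vlX (emb x))
  ; bl      = λ x → rb (blX (emb x))
  ; empties = map (λ p → rv (proj₁ p) , rb (proj₂ p))
                  (oldEmpties ++ map (λ r → vlX r , blX r) newReps)
  }
  where
  open Graph enum _≟X_
  hop : ℕ → X → X
  hop zero y = y
  hop (suc k) y = if rem y then hop k (gapX (μ y)) else y
  back : List (End m') → X → End m' → End m'
  back [] y d = d
  back (z ∷ zs) y d = if ⌊ emb z ≟X y ⌋ then z else back zs y d
  vgraph : X → X
  vgraph x = if rem x then μ x else arcX x
  newReps : List X
  newReps = filterᵇ (λ r → all rem (comp gapX vgraph r)) (reps gapX vgraph)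

-- Deletion, contraction, Penrose-contraction and the merge variants
-- for edge e (arrows p1p2 = arrow 0, q1q2 = arrow 1).

module EdgeOp {n : ℕ} (P : Pres (suc n)) (e : Fin (suc n)) where
  private
    z0 o1 : Fin 2
    z0 = zero
    o1 = suc zero
  Lu Lv La Lb : ℕ
  Lu = vl P (e , z0 , z0)
  Lv = vl P (e , o1 , z0)
  La = bl P (e , z0 , z0)   -- boundary a containing p1 (and q2)
  Lb = bl P (e , z0 , o1)   -- boundary b containing p2 (and q1)

  op : (μ : End (suc n) → End (suc n)) (rv rb : ℕ → ℕ) → Pres n
  op μ rv rb = rebuild (allEnd (suc n)) _≟E_ (λ { (f , i , t) → (punchIn e f , i , t) })
                 (gap P) (λ x → ⌊ edgeOf x ≟F e ⌋) μ arc (vl P) (bl P) rv rb (empties P)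

  mergeV mergeB : ℕ → ℕ
  mergeV = merge id Lu Lv
  mergeB = merge id La Lb

_∖_ _∖ₘ_ _/_ _/ₘ_ _†_ : ∀ {n} → Pres (suc n) → Fin (suc n) → Pres n
P ∖ e  = EdgeOp.op P e arc  id                     (EdgeOp.mergeB P e)
P ∖ₘ e = EdgeOp.op P e arc  (EdgeOp.mergeV P e)    (EdgeOp.mergeB P e)
P / e  = EdgeOp.op P e conn (EdgeOp.mergeV P e)    id
P /ₘ e = EdgeOp.op P e conn (EdgeOp.mergeV P e)    (EdgeOp.mergeB P e)
P † e  = EdgeOp.op P e pen  (EdgeOp.mergeV P e)    (EdgeOp.mergeB P e)

-- a coupling of edge f and edge e: bijection from the arrows of f to
-- the arrows of e
Coupling : Set
Coupling = Fin 2 ⤖ Fin 2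

module TwoSum {n k : ℕ} (P : Pres (suc n)) (H : Pres (suc k)) (e : Fin (suc k))
              (φ : Coupling) where
  -- the edge f of P used is edge zero
  X : Set
  X = End (suc n) ⊎ End (suc k)

  _≟X_ : DecidableEquality X
  _≟X_ = ⊎P.≡-dec _≟E_ _≟E_

  enum : List X
  enum = map inj₁ (allEnd (suc n)) ++ map inj₂ (allEnd (suc k))

  φt : Fin 2 → Fin 2
  φt = Bijection.to φ

  φinv : Fin 2 → Fin 2
  φinv j = if ⌊ φt zero ≟F j ⌋ then zero else suc zero

  gapX : X → X
  gapX (inj₁ x) = inj₁ (gap P x)
  gapX (inj₂ y) = inj₂ (gap H y)

  rem : X → Bool
  rem (inj₁ x) = ⌊ edgeOf x ≟F zero ⌋
  rem (inj₂ y) = ⌊ edgeOf y ≟F e ⌋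

  μ : X → X
  μ (inj₁ (_ , i , t)) = inj₂ (e , φt i , t)
  μ (inj₂ (_ , j , t)) = inj₁ (zero , φinv j , t)

  arcX connX : X → X
  arcX (inj₁ x) = inj₁ (arc x)
  arcX (inj₂ y) = inj₂ (arc y)
  connX (inj₁ x) = inj₁ (conn x)
  connX (inj₂ y) = inj₂ (conn y)

  -- labels of the two packages are kept apart (even / odd)
  tagP tagH : ℕ → ℕ
  tagP l = 2 ℕ.* l
  tagH l = suc (2 ℕ.* l)

  vlX blX : X → ℕ
  vlX (inj₁ x) = tagP (vl P x)
  vlX (inj₂ y) = tagH (vl H y)
  blX (inj₁ x) = tagP (bl P x)
  blX (inj₂ y) = tagH (bl H y)

  emb : End (n ℕ.+ k) → X
  emb (g , i , t) with splitAt n g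
  ... | inj₁ a = inj₁ (suc a , i , t)
  ... | inj₂ b = inj₂ (punchIn e b , i , t)

  private
    z0 o1 : Fin 2
    z0 = zero
    o1 = suc zero
  p₁ p₂ p₃ p₄ q₁ q₂ q₃ : X
  p₁ = inj₁ (zero , z0 , z0)
  p₂ = inj₁ (zero , z0 , o1)
  p₃ = inj₁ (zero , o1 , z0)
  p₄ = inj₁ (zero , o1 , o1)
  q₁ = μ p₁
  q₂ = μ p₂
  q₃ = μ p₃

  open Graph enum _≟X_

  vgraph bgraph : X → X
  vgraph x = if rem x then μ x else arcX x
  bgraph x = if rem x then μ x else connX x

  -- do {α₀,β₀} and {γ₀,δ₀} share a vertex?  do {h,k} and {i,j} share a
  -- boundary component?
  vshare bshare : Bool
  vshare = connected gapX vgraph p₁ p₃ ∨ connected gapX vgraph p₁ p₄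
         ∨ connected gapX vgraph p₂ p₃ ∨ connected gapX vgraph p₂ p₄
  bshare = connected gapX bgraph p₁ p₂ ∨ connected gapX bgraph p₁ p₃
         ∨ connected gapX bgraph p₄ p₂ ∨ connected gapX bgraph p₄ p₃

  rv₀ rv rb₀ rb : ℕ → ℕ
  rv₀ = merge (merge id (vlX p₁) (vlX q₁)) (vlX p₃) (vlX q₃)
  rv  = if vshare then merge rv₀ (vlX p₁) (vlX p₃) else rv₀
  rb₀ = merge (merge id (blX p₁) (blX q₁)) (blX p₂) (blX q₂)
  rb  = if bshare then merge rb₀ (blX p₁) (blX p₂) else rb₀

  result : Pres (n ℕ.+ k)
  result = rebuild enum _≟X_ emb gapX rem μ arcX vlX blX rv rb
             (map (λ p → tagP (proj₁ p) , tagP (proj₂ p)) (empties P)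
              ++ map (λ p → tagH (proj₁ p) , tagH (proj₂ p)) (empties H))

-- 2-sum of P (along its edge zero) and H (along e) via the coupling φ
twoSum : ∀ {n k} → Pres (suc n) → Pres (suc k) → Fin (suc k) → Coupling → Pres (n ℕ.+ k)
twoSum P H e φ = TwoSum.result P H e φ

-- Tensor product: 2-sum with a fresh copy of H along every edge of P.

tcount : ℕ → ℕ → ℕ → ℕ
tcount k zero j = j
tcount k (suc n) j = tcount k n (j ℕ.+ k)

tens : ∀ {k} (H : Pres (suc k)) (e : Fin (suc k)) (n j : ℕ) →
       Pres (n ℕ.+ j) → (Fin n → Coupling) → Pres (tcount k n j)
tens H e zero j P φ = P
tens {k} H e (suc n) j P φ =
  tens H e n (j ℕ.+ k) (subst Pres (+-assoc n j k) (twoSum P H e (φ zero))) (φ ∘ suc)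

tensor : ∀ {n k} (P : Pres n) (H : Pres (suc k)) (e : Fin (suc k)) →
         (Fin n → Coupling) → Pres (tcount k n 0)
tensor {n} P H e φ = tens H e n 0 (subst Pres (sym (+-identityʳ n)) P) φ

module Poly {c ℓ : Level} (R : CommutativeRing c ℓ) where
  open CommutativeRing R hiding (zero)

  pow : Carrier → ℕ → Carrier
  pow r zero = 1#
  pow r (suc k) = r * pow r k

  Q : ∀ {m} → Pres m → (a b c' x y α β γ : Carrier) → Carrier
  Q {zero} P a b c' x y α β γ =
    pow α (nVert P) * pow β (nVblocks P) * pow γ (nBblocks P)
  Q {suc n} P a b c' x y α β γ =
      a  * Q (P ∖ zero)  a b c' x y α β γ
    + b  * Q (P / zero)  a b c' x y α β γ
    + c' * Q (P † zero)  a b c' x y α β γ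
    + x  * Q (P ∖ₘ zero) a b c' x y α β γ
    + y  * Q (P /ₘ zero) a b c' x y α β γ

  -- (φ₁,…,φ₅) = (φ_(=,2), φ_(∥,2), φ_×, φ_(=,1), φ_(∥,1)) solves the
  -- 5×5 linear system of the theorem
  Solves : ∀ {k} → Pres (suc k) → Fin (suc k) → (a b c' x y α β γ : Carrier) →
           (φ₁ φ₂ φ₃ φ₄ φ₅ : Carrier) → Set ℓ
  Solves H e a b c' x y α β γ φ₁ φ₂ φ₃ φ₄ φ₅ =
      (αβγ * (α * β * φ₁ + φ₂ + φ₃ + α * φ₄ + φ₅) ≈ Q (H ∖ e) a b c' x y α β γ)
    × (αβγ * (φ₁ + α * γ * φ₂ + φ₃ + φ₄ + α * φ₅) ≈ Q (H / e) a b c' x y α β γ)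
    × (αβγ * (φ₁ + φ₂ + α * φ₃ + φ₄ + φ₅) ≈ Q (H † e) a b c' x y α β γ)
    × (αβγ * (α * φ₁ + φ₂ + φ₃ + α * φ₄ + φ₅) ≈ Q (H ∖ₘ e) a b c' x y α β γ)
    × (αβγ * (φ₁ + α * φ₂ + φ₃ + φ₄ + α * φ₅) ≈ Q (H /ₘ e) a b c' x y α β γ)
    where
    αβγ : Carrier
    αβγ = α * β * γ

  UniqueSolution : ∀ {k} → Pres (suc k) → Fin (suc k) → (a b c' x y α β γ : Carrier) →
                   (φ₁ φ₂ φ₃ φ₄ φ₅ : Carrier) → Set (c Level.⊔ ℓ)
  UniqueSolution H e a b c' x y α β γ φ₁ φ₂ φ₃ φ₄ φ₅ =
      Solves H e a b c' x y α β γ φ₁ φ₂ φ₃ φ₄ φ₅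
    × (∀ ψ₁ ψ₂ ψ₃ ψ₄ ψ₅ → Solves H e a b c' x y α β γ ψ₁ ψ₂ ψ₃ ψ₄ ψ₅ →
         (ψ₁ ≈ φ₁) × (ψ₂ ≈ φ₂) × (ψ₃ ≈ φ₃) × (ψ₄ ≈ φ₄) × (ψ₅ ≈ φ₅))

{-# OPTIONS --safe #-}
-- Fix one of the five operations on every edge.  The resulting edgeless presentation is counted by
-- three equivalence relations on the arrow endpoints and empty circles: generated by the gaps and the
-- prescribed arcs for vertices, and by equality of labels together with the prescribed mergers for the
-- two kinds of blocks.  Hence Q is a sum over such states, and the order of the edges is irrelevant.
--
-- A state of H ∖ e joins up the four endpoints of e in one of three ways, and it may further merge
-- the two vertex blocks or the two boundary blocks at e; this leaves exactly five possibilities, and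
-- the two ends of e then behave like one of the five operations.  So substituting H for f acts on P
-- like that operation on f, up to a monomial counting the classes of H that miss e.  Let C o be the
-- sum of weight times monomial over the states of type o.  An operation performed at e itself also
-- just joins the endpoints of e, which yields the linear system for the C o; by uniqueness they are
-- the given φ's.
module Submission where

open import Defs
open import Level using (Level; 0ℓ)
open import Function using (_∘_; id)
open import Function.Bundles using (Inverse; module Bijection)
import Function.Consequences.Setoid as Consequences
open import Function.Construct.Composition using () renaming (inverse to ≃-trans)
open import Function.Construct.Symmetry using () renaming (inverse to ≃-sym)
open import Algebra.Bundles using (CommutativeRing)
import Algebra.Solver.Ring.NaturalCoefficients.Default as Solver
open import Data.Empty using (⊥; ⊥-elim)
open import Data.Unit using (tt)
open import Data.Nat as ℕ using (ℕ; zero; suc; _≤_; _<_; z≤n; s≤s; _≤?_; _≡ᵇ_)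
import Data.Nat.Properties as ℕ
open import Data.Nat.Induction using (<-rec)
open import Data.Fin as Fin using (Fin; zero; suc; punchIn; toℕ; splitAt; _↑ˡ_; _↑ʳ_)
import Data.Fin.Properties as Fin
open import Data.Fin.Permutation using (↔⇒≡)
open import Data.Bool as Bool using (Bool; if_then_else_; true; false; not; _∧_; _∨_)
open import Data.Bool.ListAction using (any; all)
open import Data.List using (List; []; _∷_; length; map; _++_; filterᵇ; filter; lookup; deduplicate; concatMap; allFin; cartesianProduct)
open import Data.List.Relation.Unary.All as All using (All; []; _∷_)
import Data.List.Relation.Unary.All.Properties as All
open import Data.List.Relation.Unary.Any as Any using (Any; here; there)
import Data.List.Relation.Unary.Any.Properties as Any
open import Data.List.Relation.Unary.AllPairs using (AllPairs; []; _∷_)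
open import Data.List.Relation.Unary.Unique.Propositional using (Unique)
import Data.List.Relation.Unary.Unique.DecPropositional.Properties as DecUnique
import Data.List.Relation.Unary.Unique.DecSetoid.Properties as DecSetoidUnique
open import Data.List.Membership.Propositional using (_∈_; _∉_; find; lose)
open import Data.List.Membership.Propositional.Properties
  using (∈-++⁺ˡ; ∈-++⁺ʳ; ∈-++⁻; ∈-map⁺; ∈-map⁻; ∈-deduplicate⁺; ∈-deduplicate⁻; ∈-filter⁺; ∈-filter⁻;
         ∈-lookup; ∈-concatMap⁺; ∈-allFin; ∈-cartesianProduct⁺)
import Data.List.Membership.DecPropositional as DecMem
open import Data.Vec as Vec using (Vec; []; _∷_)
import Data.Vec.Properties as Vec
open import Data.Product using (Σ; ∃; _×_; _,_; proj₁; proj₂)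
import Data.Product.Properties as ×P
open import Data.Sum as Sum using (_⊎_; inj₁; inj₂)
open import Data.Sum.Properties using (inj₁-injective; inj₂-injective)
open import Data.Sum.Relation.Binary.Pointwise using (_⊎ₛ_; Pointwise; inj₁; inj₂; Pointwise-≡↔≡; drop-inj₁)
open import Data.Sum.Function.Setoid using (_⊎-inverse_)
open import Relation.Binary using (Rel; Setoid; DecSetoid; IsEquivalence)
open import Relation.Binary.Definitions using (DecidableEquality)
open import Relation.Binary.PropositionalEquality
  using (_≡_; _≢_; refl; sym; trans; cong; cong₂; subst; subst₂; setoid)
open import Relation.Binary.Construct.Closure.Equivalence as Closure using (EqClosure)
open import Relation.Binary.Construct.Closure.Symmetric using (fwd; bwd)
open import Relation.Binary.Construct.Closure.ReflexiveTransitive using (ε; _◅_; _◅◅_)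
open import Relation.Binary.Construct.Union using (_∪_)
import Relation.Binary.Construct.On as On
import Relation.Binary.Reasoning.Setoid as SetoidReasoning
open import Relation.Nullary using (¬_; Dec; yes; no; contradiction)
open import Relation.Nullary.Decidable using (⌊_⌋; toWitness; _→-dec_; _⊎-dec_; _×-dec_; ¬?)

-- Breadth-first search and component representatives

-- Why exactly five types: away from `e`, the circles of a state pair up the four endpoints of `e`
-- in one of three ways. Labels of 𝒱 agree along the arrows of `e`, labels of ℬ along its boundary
-- connectors, and endpoints joined by circles share a class of both kinds. If the pairing is that
-- of the arrows, all four endpoints fall into one class for ℬ and only 𝒱 has a choice; the
-- connectors are dual; the Penrose pairing merges both. This makes 2 + 2 + 1. A matrix entry counts
-- the blocks of the join of two such partitions: two different pairings of four points connect
-- everything, so an exponent is 2 for equal pairings and 1 otherwise, whence the common factor αβγ.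
-- The main obstacle is that the definitions are algorithms: walks with fuel, searches, mergers of
-- numeric labels. They are matched with generated equivalences for arbitrary surgeries, because
-- edge operations, 2-sums and the excision of all edges but `e` follow one pattern. A single gluing
-- lemma, `glue-≃`, serves twice: with four bare endpoints it yields the matrix, with `P` the
-- substitution.

false≢true : ∀ {b} → b ≡ false → b ≡ true → ⊥
false≢true refl ()

∧-elim : ∀ {a b} → a ∧ b ≡ true → a ≡ true × b ≡ true
∧-elim {true} {true} refl = refl , refl

all⁻ : {X : Set} (p : X → Bool) (xs : List X) → all p xs ≡ true → ∀ {x} → x ∈ xs → p x ≡ true
all⁻ p (x ∷ xs) h (here refl) = proj₁ (∧-elim h)
all⁻ p (x ∷ xs) h (there x∈) = all⁻ p xs (proj₂ (∧-elim h)) x∈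

all⁺ : {X : Set} (p : X → Bool) (xs : List X) → (∀ {x} → x ∈ xs → p x ≡ true) → all p xs ≡ true
all⁺ p [] h = refl
all⁺ p (x ∷ xs) h rewrite h (here refl) = all⁺ p xs (h ∘ there)

any⁻ : {X : Set} (p : X → Bool) (xs : List X) → any p xs ≡ true → Σ X λ x → x ∈ xs × p x ≡ true
any⁻ p (x ∷ xs) h with p x in eq
... | true = x , here refl , eq
... | false with y , y∈ , py ← any⁻ p xs h = y , there y∈ , py

any-false : {X : Set} (p : X → Bool) (xs : List X) → any p xs ≡ false → ∀ {x} → x ∈ xs → p x ≡ false
any-false p (x ∷ xs) h (here refl) with p x
any-false p (x ∷ xs) h (here refl) | false = refl
any-false p (x ∷ xs) h (there y∈) with p x
... | false = any-false p xs h y∈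

∈-filterᵇ⁺ : {X : Set} (p : X → Bool) {xs : List X} {x : X} → x ∈ xs → p x ≡ true → x ∈ filterᵇ p xs
∈-filterᵇ⁺ p {x ∷ xs} (here refl) px rewrite px = here refl
∈-filterᵇ⁺ p {y ∷ xs} (there x∈) px with p y
... | true = there (∈-filterᵇ⁺ p x∈ px)
... | false = ∈-filterᵇ⁺ p x∈ px

∈-filterᵇ⁻ : {X : Set} (p : X → Bool) {xs : List X} {x : X} → x ∈ filterᵇ p xs → x ∈ xs × p x ≡ true
∈-filterᵇ⁻ p {y ∷ xs} x∈ with p y in eq
∈-filterᵇ⁻ p {y ∷ xs} (here refl) | true = here refl , eq
∈-filterᵇ⁻ p {y ∷ xs} (there x∈) | true with x∈′ , px ← ∈-filterᵇ⁻ p x∈ = there x∈′ , px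
∈-filterᵇ⁻ p {y ∷ xs} x∈ | false with x∈′ , px ← ∈-filterᵇ⁻ p x∈ = there x∈′ , px

AllPairs-filterᵇ : {X : Set} {R : Rel X 0ℓ} (p : X → Bool) {xs : List X} → AllPairs R xs → AllPairs R (filterᵇ p xs)
AllPairs-filterᵇ p [] = []
AllPairs-filterᵇ p {x ∷ xs} (h ∷ hs) with p x
... | true = All.tabulate (λ y∈ → All.lookup h (proj₁ (∈-filterᵇ⁻ p y∈))) ∷ AllPairs-filterᵇ p hs
... | false = AllPairs-filterᵇ p hs

-- The relation may be asymmetric, as it is for representatives found by a search in one direction;
-- hence its failure is required in both orders.
AllPairs-lookup : {X : Set} {R : Rel X 0ℓ} {xs : List X} → AllPairs R xs →
  (i j : Fin (length xs)) → (R (lookup xs i) (lookup xs j) → ⊥) → (R (lookup xs j) (lookup xs i) → ⊥) → i ≡ j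
AllPairs-lookup (h ∷ hs) zero zero n n′ = refl
AllPairs-lookup {xs = x ∷ xs} (h ∷ hs) zero (suc j) n n′ = ⊥-elim (n (All.lookup h (∈-lookup j)))
AllPairs-lookup {xs = x ∷ xs} (h ∷ hs) (suc i) zero n n′ = ⊥-elim (n′ (All.lookup h (∈-lookup i)))
AllPairs-lookup (h ∷ hs) (suc i) (suc j) n n′ = cong suc (AllPairs-lookup hs i j n n′)

Unique⇒length≤ : {X : Set} {xs ys : List X} → Unique xs → (∀ {x} → x ∈ xs → x ∈ ys) → length xs ≤ length ys
Unique⇒length≤ {xs = xs} {ys} u sub with length xs ≤? length ys
... | yes p = p
... | no ¬p with i , j , i<j , eq ← Fin.pigeonhole (ℕ.≰⇒> ¬p) (λ i → Any.index (sub (∈-lookup i))) =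
  contradiction (AllPairs-lookup u i j (λ n → n same) (λ n → n (sym same))) (Fin.<⇒≢ i<j)
  where
  same : lookup xs i ≡ lookup xs j
  same = trans (Any.lookup-index (sub (∈-lookup i)))
           (trans (cong (lookup ys) eq) (sym (Any.lookup-index (sub (∈-lookup j)))))

infix 4 _≃_
_≃_ : Setoid 0ℓ 0ℓ → Setoid 0ℓ 0ℓ → Set
_≃_ = Inverse

⟨_⟩ : {A : Set} → Rel A 0ℓ → Setoid 0ℓ 0ℓ
⟨ R ⟩ = Closure.setoid R

mk≃ : {S T : Setoid 0ℓ 0ℓ} (f : Setoid.Carrier S → Setoid.Carrier T) (g : Setoid.Carrier T → Setoid.Carrier S) →
  (∀ {x y} → Setoid._≈_ S x y → Setoid._≈_ T (f x) (f y)) → (∀ {x y} → Setoid._≈_ T x y → Setoid._≈_ S (g x) (g y)) →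
  (∀ y → Setoid._≈_ T (f (g y)) y) → (∀ x → Setoid._≈_ S (g (f x)) x) → S ≃ T
mk≃ {S} {T} f g fc gc fg gf = record
  { to = f ; from = g ; to-cong = fc ; from-cong = gc
  ; inverse = Consequences.strictlyInverseˡ⇒inverseˡ S T fc fg , Consequences.strictlyInverseʳ⇒inverseʳ S T gc gf }

-- The universal property of the generated equivalence: any invariant valued in a setoid needs
-- checking on generators only.
extend : {A : Set} {R : Rel A 0ℓ} (T : Setoid 0ℓ 0ℓ) (f : A → Setoid.Carrier T) →
  (∀ {x y} → R x y → Setoid._≈_ T (f x) (f y)) → ∀ {x y} → EqClosure R x y → Setoid._≈_ T (f x) (f y)
extend T f h = Closure.gfold (Setoid.isEquivalence T) f h

closure-≃ : {A B : Set} {R : Rel A 0ℓ} {S : Rel B 0ℓ} (f : A → B) (g : B → A) →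
  (∀ {x y} → R x y → EqClosure S (f x) (f y)) → (∀ {x y} → S x y → EqClosure R (g x) (g y)) →
  (∀ y → EqClosure S (f (g y)) y) → (∀ x → EqClosure R (g (f x)) x) → ⟨ R ⟩ ≃ ⟨ S ⟩
closure-≃ {R = R} {S} f g fc gc fg gf = mk≃ f g (extend ⟨ S ⟩ f fc) (extend ⟨ R ⟩ g gc) fg gf

closure-sym : {A : Set} {R : Rel A 0ℓ} {x y : A} → EqClosure R x y → EqClosure R y x
closure-sym {R = R} = Closure.symmetric R

module Bfs {X : Set} (enum : List X) (_≟X_ : DecidableEquality X) (complete : (x : X) → x ∈ enum)
           (σ τ : X → X) where
  open Graph enum _≟X_ using (comp; connected; reach)

  Closed : List X → Set
  Closed S = ∀ {y} → y ∈ S → σ y ∈ S × τ y ∈ S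

  step : List X → List X
  step S = deduplicate _≟X_ (S ++ map σ S ++ map τ S)

  step-self : ∀ {S y} → y ∈ S → y ∈ step S
  step-self y∈ = ∈-deduplicate⁺ _≟X_ (∈-++⁺ˡ y∈)

  step-σ : ∀ {S y} → y ∈ S → σ y ∈ step S
  step-σ {S} y∈ = ∈-deduplicate⁺ _≟X_ (∈-++⁺ʳ S (∈-++⁺ˡ (∈-map⁺ σ y∈)))

  step-τ : ∀ {S y} → y ∈ S → τ y ∈ step S
  step-τ {S} y∈ = ∈-deduplicate⁺ _≟X_ (∈-++⁺ʳ S (∈-++⁺ʳ (map σ S) (∈-map⁺ τ y∈)))

  reach-elim : (Q : X → Set) → (∀ {y} → Q y → Q (σ y)) → (∀ {y} → Q y → Q (τ y)) →
    ∀ k S → (∀ {y} → y ∈ S → Q y) → ∀ {y} → y ∈ reach σ τ k S → Q y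
  reach-elim Q qσ qτ zero S h = h
  reach-elim Q qσ qτ (suc k) S h = reach-elim Q qσ qτ k (step S) (λ y∈ → go (∈-++⁻ S (∈-deduplicate⁻ _≟X_ _ y∈)))
    where
    go : ∀ {y} → y ∈ S ⊎ y ∈ map σ S ++ map τ S → Q y
    go (inj₁ y∈) = h y∈
    go (inj₂ y∈) with ∈-++⁻ (map σ S) y∈
    ... | inj₁ y∈σ with z , z∈ , refl ← ∈-map⁻ σ y∈σ = qσ (h z∈)
    ... | inj₂ y∈τ with z , z∈ , refl ← ∈-map⁻ τ y∈τ = qτ (h z∈)

  reach-self : ∀ k S {y} → y ∈ S → y ∈ reach σ τ k S
  reach-self zero S y∈ = y∈
  reach-self (suc k) S y∈ = reach-self k (step S) (step-self y∈)

  reach-closed : ∀ k S → Closed S → Closed (reach σ τ k S)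
  reach-closed k S c y∈ = reach-self k S (proj₁ (c y∈S)) , reach-self k S (proj₂ (c y∈S))
    where
    y∈S = reach-elim (_∈ S) (proj₁ ∘ c) (proj₂ ∘ c) k S id y∈

  step-grows : ∀ {S y} → Unique S → y ∈ step S → y ∉ S → suc (length S) ≤ length (step S)
  step-grows {S} {y} u y∈ y∉ = Unique⇒length≤ {xs = y ∷ S} (All.¬Any⇒All¬ S y∉ ∷ u)
    (λ { (here refl) → y∈ ; (there z∈) → step-self z∈ })

  -- A round that adds nothing leaves the set closed for good; any other round adds at least one
  -- element. Starting from one element, `length enum` rounds without closing would therefore
  -- produce a list without repetitions longer than `enum`, which is how `comp-closed` concludes.
  reach-grows : ∀ k S → Unique S → Closed (reach σ τ k S) ⊎ (k ℕ.+ length S ≤ length (reach σ τ k S) × Unique (reach σ τ k S))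
  reach-grows zero S u = inj₂ (ℕ.≤-refl , u)
  reach-grows (suc k) S u with All.all? (λ y → DecMem._∈?_ _≟X_ y S) (step S)
  ... | yes a = inj₁ (reach-closed (suc k) S (λ y∈ → All.lookup a (step-σ y∈) , All.lookup a (step-τ y∈)))
  ... | no ¬a with reach-grows k (step S) (DecUnique.deduplicate-! _≟X_ _)
  ... | inj₁ c = inj₁ c
  ... | inj₂ (le , u′) = inj₂ (ℕ.≤-trans bound le , u′)
    where
    new : Σ X λ y → y ∈ step S × y ∉ S
    new = find (All.¬All⇒Any¬ (λ y → DecMem._∈?_ _≟X_ y S) (step S) ¬a)
    bound : suc k ℕ.+ length S ≤ k ℕ.+ length (step S)
    bound with y , y∈ , y∉ ← new = subst (_≤ k ℕ.+ length (step S)) (ℕ.+-suc k (length S)) (ℕ.+-monoʳ-≤ k (step-grows u y∈ y∉))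

  comp-self : ∀ x → x ∈ comp σ τ x
  comp-self x = reach-self (length enum) (x ∷ []) (here refl)

  comp-closed : ∀ x → Closed (comp σ τ x)
  comp-closed x with reach-grows (length enum) (x ∷ []) ([] ∷ [])
  ... | inj₁ c = c
  ... | inj₂ (le , u) = contradiction (ℕ.≤-trans le (Unique⇒length≤ u (λ _ → complete _)))
          (ℕ.<⇒≱ (subst (length enum <_) (ℕ.+-comm 1 (length enum)) (ℕ.n<1+n _)))

  comp-elim : (Q : X → Set) → (∀ {y} → Q y → Q (σ y)) → (∀ {y} → Q y → Q (τ y)) →
    ∀ {x} → Q x → ∀ {y} → y ∈ comp σ τ x → Q y
  comp-elim Q qσ qτ qx = reach-elim Q qσ qτ (length enum) _ (λ { (here refl) → qx })

  connected⇒∈ : ∀ {x y} → connected σ τ x y ≡ true → y ∈ comp σ τ x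
  connected⇒∈ {x} {y} h with z , z∈ , eq ← any⁻ _ (comp σ τ x) h with y ≟X z
  ... | yes refl = z∈

  ∉-connected : ∀ {x y} → connected σ τ x y ≡ false → y ∉ comp σ τ x
  ∉-connected {x} {y} h y∈ with eq ← any-false (λ z → ⌊ y ≟X z ⌋) _ h y∈ with y ≟X y
  ... | no y≢y = y≢y refl

-- The function go local to Graph.reps has no name outside Defs; unification recovers it from the
-- first unfolding of reps.
module Reps {X : Set} (_≟X_ : DecidableEquality X) (σ τ : X → X) where
  mutual
    go : List X → List X → List X → List X
    go = _

    reps-go : (x : X) (xs : List X) → Graph.reps (x ∷ xs) _≟X_ σ τ ≡ x ∷ go (x ∷ xs) xs (x ∷ [])
    reps-go x xs with x List.∷ xs | x List.∷ List.[]
    ... | enum | prev = refl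

  module _ (enum : List X) (complete : (x : X) → x ∈ enum) where
    open Graph enum _≟X_ using (comp; connected; reps)
    open Bfs enum _≟X_ complete σ τ

    -- Reachability is not assumed symmetric, so only one direction is available: a kept element
    -- reaches nothing listed before it. The second component carries this for all of `prev`,
    -- skipped elements included.
    go-separated : ∀ xs prev → AllPairs (λ r r′ → r ∉ comp σ τ r′) (go enum xs prev) ×
      All (λ r → All (λ y → y ∉ comp σ τ r) prev) (go enum xs prev)
    go-separated [] prev = [] , []
    go-separated (x ∷ xs) prev with any (λ y → connected σ τ x y) prev in eq | go-separated xs (x ∷ prev)
    ... | true | ps , qs = ps , All.map (λ { (_ ∷ q) → q }) qs
    ... | false | ps , qs = All.map (λ { (q ∷ _) → q }) qs ∷ ps ,
      All.tabulate (λ y∈ → ∉-connected (any-false (connected σ τ x) prev eq y∈)) ∷ All.map (λ { (_ ∷ q) → q }) qs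

    reps-separated : AllPairs (λ r r′ → r ∉ comp σ τ r′) (reps σ τ)
    reps-separated = proj₁ (go-separated enum [])

    -- An element is skipped only when it reaches an earlier one; `link` then passes `P` forward to
    -- that one and brings `R` back. In this form, going backwards along the search is asked for
    -- only on elements satisfying `P`, which will be those in wholly removed components.
    go-represents : (P : X → Set) (R : X → Set) → (∀ {x y} → P x → y ∈ comp σ τ x → P y × (R y → R x)) →
      ∀ xs prev → (∀ {x} → x ∈ go enum xs prev → P x → R x) → (∀ {y} → y ∈ prev → P y → R y) →
      ∀ {x} → x ∈ xs → P x → R x
    go-represents P R link (x ∷ xs) prev hr hp y∈ py with any (λ y → connected σ τ x y) prev in eq
    go-represents P R link (x ∷ xs) prev hr hp y∈ py | true
      with z , z∈ , cz ← any⁻ (connected σ τ x) prev eq = case y∈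
      where
      rx : P x → R x
      rx px with pz , back ← link px (connected⇒∈ cz) = back (hp z∈ pz)
      case : _ ∈ x ∷ xs → R _
      case (here refl) = rx py
      case (there y∈) = go-represents P R link xs (x ∷ prev) hr (λ { (here refl) → rx ; (there z∈) → hp z∈ }) y∈ py
    go-represents P R link (x ∷ xs) prev hr hp (here refl) py | false = hr (here refl) py
    go-represents P R link (x ∷ xs) prev hr hp (there y∈) py | false =
      go-represents P R link xs (x ∷ prev) (hr ∘ there) (λ { (here refl) → hr (here refl) ; (there z∈) → hp z∈ }) y∈ py

    reps-represents : (P : X → Set) (R : X → Set) → (∀ {x y} → P x → y ∈ comp σ τ x → P y × (R y → R x)) →
      (∀ {x} → x ∈ reps σ τ → P x → R x) → ∀ {x} → P x → R x
    reps-represents P R link hr = go-represents P R link enum [] hr (λ ()) (complete _)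

-- Excising arrows from the gap matching

∈-allEnd : ∀ {m} (x : End m) → x ∈ allEnd m
∈-allEnd (e , i , t) = ∈-concatMap⁺ (λ e → concatMap (λ i → map (λ t → (e , i , t)) (allFin 2)) (allFin 2))
  (lose (∈-allFin e) (inner i t))
  where
  inner : ∀ i t → (e , i , t) ∈ (e , zero , zero) ∷ (e , zero , suc zero) ∷ (e , suc zero , zero) ∷ (e , suc zero , suc zero) ∷ []
  inner zero zero = here refl
  inner zero (suc zero) = there (here refl)
  inner (suc zero) zero = there (there (here refl))
  inner (suc zero) (suc zero) = there (there (there (here refl)))

module Surgery {X : Set} (enum : List X) (_≟X_ : DecidableEquality X) {m′ : ℕ}
               (emb : End m′ → X) (gapX : X → X) (rem : X → Bool) (μ : X → X) (arcX : X → X) where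

  vgraph : X → X
  vgraph x = if rem x then μ x else arcX x

  newReps : List X
  newReps = filterᵇ (λ r → all rem (Graph.comp enum _≟X_ gapX vgraph r)) (Graph.reps enum _≟X_ gapX vgraph)

  hop : ℕ → X → X
  hop zero y = y
  hop (suc k) y = if rem y then hop k (gapX (μ y)) else y

  back : List (End m′) → X → End m′ → End m′
  back [] y d = d
  back (z ∷ zs) y d = if ⌊ emb z ≟X y ⌋ then z else back zs y d

  gap′ : End m′ → End m′
  gap′ z = back (allEnd m′) (hop (length enum) (gapX (emb z))) z

  module _ (vlX blX : X → ℕ) (rv rb : ℕ → ℕ) (oldEmpties : List (ℕ × ℕ)) where
    result : Pres m′
    result = rebuild enum _≟X_ emb gapX rem μ arcX vlX blX rv rb oldEmpties

    -- The composite of the functions back and hop local to rebuild, recovered as in Reps.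
    mutual
      trace : List (End m′) → ℕ → X → End m′ → End m′
      trace = _

      gap-trace : (x : End m′) → gap result x ≡ trace (allEnd m′) (length enum) (gapX (emb x)) x
      gap-trace x with allEnd m′ | length enum | gapX (emb x)
      ... | zs | n | y = refl

    trace-zero : (zs : List (End m′)) (y : X) (d : End m′) → trace zs zero y d ≡ back zs y d
    trace-zero [] y d = refl
    trace-zero (z ∷ zs) y d rewrite trace-zero zs y d = refl

    trace-hop : (zs : List (End m′)) (n : ℕ) (y : X) (d : End m′) → trace zs n y d ≡ back zs (hop n y) d
    trace-hop zs zero y d = trace-zero zs y d
    trace-hop zs (suc n) y d with rem y
    ... | true = trace-hop zs n (gapX (μ y)) d
    ... | false = trace-zero zs y d

    gap-result : (z : End m′) → gap result z ≡ gap′ z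
    gap-result z = trans (gap-trace z) (trace-hop (allEnd m′) (length enum) (gapX (emb z)) z)

  -- The common ground of three uses: an operation at one edge, the 2-sum, and the excision of all
  -- edges of `H` except `e`.
  record Laws : Set where
    field
      complete  : (x : X) → x ∈ enum
      gap-invol : ∀ x → gapX (gapX x) ≡ x
      gap-nofix : ∀ x → gapX x ≢ x
      μ-rem     : ∀ {x} → rem x ≡ true → rem (μ x) ≡ true
      μ-invol   : ∀ {x} → rem x ≡ true → μ (μ x) ≡ x
      μ-nofix   : ∀ {x} → rem x ≡ true → μ x ≢ x
      emb-inj   : ∀ {z z′} → emb z ≡ emb z′ → z ≡ z′
      emb-rem   : ∀ z → rem (emb z) ≡ false
      emb-surj  : ∀ {x} → rem x ≡ false → Σ (End m′) λ z → emb z ≡ x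

  data Geo : Rel X 0ℓ where
    gap-step : ∀ x → Geo x (gapX x)
    μ-step   : ∀ {x} → rem x ≡ true → Geo x (μ x)

  -- The walk traced by `hop`, freed from its fuel: cross `μ` and then a gap as long as the current
  -- endpoint is removed.
  data Exits : X → X → Set where
    done : ∀ {x} → rem x ≡ false → Exits x x
    step : ∀ {x z} → rem x ≡ true → Exits (gapX (μ x)) z → Exits x z

  data Gap′ {K : Set} : Rel (End m′ ⊎ K) 0ℓ where
    gap-step′ : ∀ z → Gap′ (inj₁ z) (inj₁ (gap′ z))

  module WithLaws (laws : Laws) where
    open Laws laws
    open Graph enum _≟X_ using (comp)
    open Bfs enum _≟X_ complete gapX vgraph using (comp-self; comp-closed; comp-elim)

    private
      N : ℕ
      N = length enum

    f : X → X
    f x = gapX (μ x)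

    gap-inj : ∀ {x y} → gapX x ≡ gapX y → x ≡ y
    gap-inj {x} {y} eq = trans (sym (gap-invol x)) (trans (cong gapX eq) (gap-invol y))

    f-inj : ∀ {x y} → rem x ≡ true → rem y ≡ true → f x ≡ f y → x ≡ y
    f-inj rx ry eq = trans (sym (μ-invol rx)) (trans (cong μ (gap-inj eq)) (μ-invol ry))

    iter : ℕ → X → X
    iter zero x = x
    iter (suc k) x = iter k (f x)

    iter-+ : ∀ i k x → iter (i ℕ.+ k) x ≡ iter k (iter i x)
    iter-+ zero k x = refl
    iter-+ (suc i) k x = iter-+ i k (f x)

    iter-suc : ∀ k x → iter (suc k) x ≡ f (iter k x)
    iter-suc k x = trans (cong (λ n → iter n x) (ℕ.+-comm 1 k)) (iter-+ k 1 x)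

    hop-stuck : ∀ k {x} → rem (hop k x) ≡ true → ∀ {i} → i ≤ k → rem (iter i x) ≡ true
    hop-stuck zero h z≤n = h
    hop-stuck (suc k) {x} h le with rem x in eq
    hop-stuck (suc k) {x} h le | false = ⊥-elim (false≢true eq h)
    hop-stuck (suc k) {x} h {zero} le | true = eq
    hop-stuck (suc k) {x} h {suc i} (s≤s le) | true = hop-stuck k h le

    iter-repeats : ∀ x → ∃ λ i → ∃ λ j → i < j × j ≤ N × iter i x ≡ iter j x
    iter-repeats x with i , j , i<j , eq ← Fin.pigeonhole (ℕ.n<1+n N) (λ (i : Fin (suc N)) → Any.index (complete (iter (toℕ i) x))) =
      toℕ i , toℕ j , i<j , Fin.toℕ≤pred[n] j ,
      trans (Any.lookup-index (complete (iter (toℕ i) x)))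
        (trans (cong (lookup enum) eq) (sym (Any.lookup-index (complete (iter (toℕ j) x)))))

    -- Among its first `N` + 1 positions the walk already repeats one, so every later position
    -- equals an earlier one, known to be removed. Running out of fuel thus means being trapped.
    stuck-forever : ∀ {x} → rem (hop N x) ≡ true → ∀ k → rem (iter k x) ≡ true
    stuck-forever {x} h with i , j , i<j , j≤N , eq ← iter-repeats x = <-rec (λ k → rem (iter k x) ≡ true) go
      where
      go : ∀ k → (∀ {k′} → k′ < k → rem (iter k′ x) ≡ true) → rem (iter k x) ≡ true
      go k ih with k ≤? N
      ... | yes k≤N = hop-stuck N h k≤N
      ... | no k≰N = subst (λ y → rem y ≡ true) earlier (ih (subst (i ℕ.+ (k ℕ.∸ j) <_) jd (ℕ.+-monoˡ-< _ i<j)))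
        where
        jd : j ℕ.+ (k ℕ.∸ j) ≡ k
        jd = ℕ.m+[n∸m]≡n (ℕ.≤-trans j≤N (ℕ.<⇒≤ (ℕ.≰⇒> k≰N)))
        earlier : iter (i ℕ.+ (k ℕ.∸ j)) x ≡ iter k x
        earlier = trans (iter-+ i _ x) (trans (cong (iter (k ℕ.∸ j)) eq)
                    (trans (sym (iter-+ j _ x)) (cong (λ n → iter n x) jd)))

    exits-from : ∀ {x y z} → x ≡ y → Exits x z → Exits y z
    exits-from refl p = p

    exits-iter : ∀ {x z} → Exits x z → ∃ λ k → iter k x ≡ z
    exits-iter (done _) = 0 , refl
    exits-iter (step _ p) with k , eq ← exits-iter p = suc k , eq

    exits-nonrem : ∀ {x z} → Exits x z → rem z ≡ false
    exits-nonrem (done r) = r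
    exits-nonrem (step _ p) = exits-nonrem p

    exits-unique : ∀ {x z w} → Exits x z → Exits x w → z ≡ w
    exits-unique (done _) (done _) = refl
    exits-unique (done r) (step r′ _) = ⊥-elim (false≢true r r′)
    exits-unique (step r _) (done r′) = ⊥-elim (false≢true r′ r)
    exits-unique (step _ p) (step _ q) = exits-unique p q

    hop-exits : ∀ k {x} → rem (hop k x) ≡ false → Exits x (hop k x)
    hop-exits zero r = done r
    hop-exits (suc k) {x} r with rem x in eq
    ... | true = step eq (hop-exits k r)
    ... | false = done eq

    stuck⇒no-exit : ∀ {x z} → rem (hop N x) ≡ true → ¬ Exits x z
    stuck⇒no-exit {x} h p with k , refl ← exits-iter p = false≢true (exits-nonrem p) (stuck-forever h k)

    iter-inj : ∀ i {x y} → (∀ k → rem (iter k x) ≡ true) → (∀ k → rem (iter k y) ≡ true) → iter i x ≡ iter i y → x ≡ y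
    iter-inj zero hx hy eq = eq
    iter-inj (suc i) hx hy eq = f-inj (hx 0) (hy 0) (iter-inj i (hx ∘ suc) (hy ∘ suc) eq)

    -- f is injective on removed endpoints, so an orbit trapped there is a cycle through its
    -- starting point gapX x; the predecessor of gapX x would have to be μ x, which is not removed.
    gap-exits : ∀ {x} → rem x ≡ false → rem (hop N (gapX x)) ≡ false
    gap-exits {x} r with rem (hop N (gapX x)) in h
    ... | false = refl
    ... | true with i , j , i<j , j≤N , eq ← iter-repeats (gapX x) = ⊥-elim (go (j ℕ.∸ i) (ℕ.m<n⇒0<n∸m i<j) cycle)
      where
      trapped = stuck-forever h
      cycle : gapX x ≡ iter (j ℕ.∸ i) (gapX x)
      cycle = iter-inj i trapped (λ k → trans (cong rem (sym (iter-+ (j ℕ.∸ i) k _))) (trapped (j ℕ.∸ i ℕ.+ k)))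
                (trans eq (trans (cong (λ n → iter n (gapX x)) (sym (ℕ.m∸n+n≡m (ℕ.<⇒≤ i<j)))) (iter-+ (j ℕ.∸ i) i _)))
      go : ∀ d → 0 < d → gapX x ≡ iter d (gapX x) → ⊥
      go (suc d) _ eq = false≢true r (subst (λ y → rem y ≡ true) (sym (gap-inj (trans eq (iter-suc d _)))) (μ-rem (trapped d)))

    back-emb : ∀ zs {z d} → z ∈ zs → back zs (emb z) d ≡ z
    back-emb (w ∷ zs) {z} z∈ with emb w ≟X emb z
    ... | yes eq = emb-inj eq
    back-emb (w ∷ zs) (here refl) | no ne = contradiction refl ne
    back-emb (w ∷ zs) (there z∈) | no ne = back-emb zs z∈

    gap′-exits : ∀ z → Exits (gapX (emb z)) (emb (gap′ z))
    gap′-exits z with r ← gap-exits (emb-rem z) with w , eq ← emb-surj r =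
      subst (Exits _) (trans (sym eq) (cong emb (sym gap′-w))) (hop-exits N r)
      where
      gap′-w : gap′ z ≡ w
      gap′-w = trans (cong (λ y → back (allEnd m′) y z) (sym eq)) (back-emb (allEnd m′) (∈-allEnd w))

    -- The walk from `gapX z` has to retrace the one from `x` to `z` backwards, each step being
    -- forced; what remains after the retracing starts at `gapX x`.
    exits-reverse : ∀ {x z w} → Exits x z → Exits (gapX z) w → Exits (gapX x) w
    exits-reverse (done _) q = q
    exits-reverse {x} (step r p) q with exits-reverse p q
    ... | s rewrite gap-invol (μ x) with s
    ... | done r′ = ⊥-elim (false≢true r′ (μ-rem r))
    ... | step _ s′ rewrite μ-invol r = s′

    exits-gap : ∀ {x z} → Exits x (emb z) → Exits (gapX x) (emb (gap′ z))
    exits-gap {z = z} p = exits-reverse p (gap′-exits z)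

    gap′-invol : ∀ z → gap′ (gap′ z) ≡ z
    gap′-invol z = emb-inj (exits-unique (exits-from (gap-invol (emb z)) (exits-gap (gap′-exits z))) (done (emb-rem z)))

    -- Behind `gap′-nofix`: a walk that comes back to its origin is its own reverse. Stripping one
    -- step from either end repeatedly exposes a fixed point of `gapX` or of `μ` in the middle,
    -- according to the parity of `j`.
    no-palindrome : ∀ j y → (∀ k → k < j → rem (iter k y) ≡ true) → iter j y ≢ gapX y
    no-palindrome zero y h eq = gap-nofix y (sym eq)
    no-palindrome (suc zero) y h eq = μ-nofix (h 0 (s≤s z≤n)) (gap-inj eq)
    no-palindrome (suc (suc j)) y h eq = no-palindrome j (f y) (λ k k<j → h (suc k) (s≤s (ℕ.m<n⇒m<1+n k<j)))
      (trans (trans (sym (μ-invol (h (suc j) (ℕ.n<1+n _)))) (cong μ (gap-inj (trans (sym (iter-suc (suc j) y)) eq))))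
        (sym (gap-invol (μ y))))

    exits-steps : ∀ {x z} → Exits x z → ∃ λ k → iter k x ≡ z × (∀ i → i < k → rem (iter i x) ≡ true)
    exits-steps (done _) = 0 , refl , λ _ ()
    exits-steps (step r p) with k , eq , h ← exits-steps p = suc k , eq , λ { zero _ → r ; (suc i) (s≤s i<k) → h i i<k }

    gap′-nofix : ∀ z → gap′ z ≢ z
    gap′-nofix z eq with k , last , h ← exits-steps (gap′-exits z) =
      no-palindrome k _ h (trans last (trans (cong emb eq) (sym (gap-invol (emb z)))))

    -- Such a component closes up into a circle without arrows; these are the circles that the
    -- surgery adds to `empties`.
    Removed : X → Set
    Removed x = ∀ {y} → y ∈ comp gapX vgraph x → rem y ≡ true

    vgraph-rem : ∀ {x} → rem x ≡ true → vgraph x ≡ μ x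
    vgraph-rem {x} r with rem x
    ... | true = refl

    comp⇒Geo : ∀ {x y} → Removed x → y ∈ comp gapX vgraph x → EqClosure Geo x y
    comp⇒Geo {x} rx y∈ = proj₂ (comp-elim (λ y → y ∈ comp gapX vgraph x × EqClosure Geo x y)
      (λ { (y∈ , p) → proj₁ (comp-closed x y∈) , p ◅◅ Closure.return (gap-step _) })
      (λ { {y} (y∈ , p) → proj₂ (comp-closed x y∈) ,
             subst (EqClosure Geo x) (sym (vgraph-rem (rx y∈))) (p ◅◅ Closure.return (μ-step (rx y∈))) })
      (comp-self x , ε) y∈)

    Geo⇒comp : ∀ {x y} → Removed x → EqClosure Geo x y → y ∈ comp gapX vgraph x
    Geo⇒comp {x} rx = go (comp-self x)
      where
      μ∈ : ∀ {y} → y ∈ comp gapX vgraph x → μ y ∈ comp gapX vgraph x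
      μ∈ y∈ = subst (_∈ comp gapX vgraph x) (vgraph-rem (rx y∈)) (proj₂ (comp-closed x y∈))
      go : ∀ {y z} → y ∈ comp gapX vgraph x → EqClosure Geo y z → z ∈ comp gapX vgraph x
      go y∈ ε = y∈
      go y∈ (fwd (gap-step _) ◅ p) = go (proj₁ (comp-closed x y∈)) p
      go y∈ (fwd (μ-step _) ◅ p) = go (μ∈ y∈) p
      go y∈ (bwd (gap-step y) ◅ p) = go (subst (_∈ comp gapX vgraph x) (gap-invol y) (proj₁ (comp-closed x y∈))) p
      go y∈ (bwd (μ-step r) ◅ p) = go (subst (_∈ comp gapX vgraph x) (μ-invol r) (μ∈ y∈)) p

    exits⇒Geo : ∀ {x z} → Exits x z → EqClosure Geo x z
    exits⇒Geo (done _) = ε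
    exits⇒Geo (step r p) = fwd (μ-step r) ◅ fwd (gap-step _) ◅ exits⇒Geo p

    -- Having no exit spreads along gaps by reversing walks and, because an endpoint without exit is
    -- removed, along `μ` too; hence it fills the whole component.
    no-exit⇒Removed : ∀ {x} → (∀ {z} → ¬ Exits x z) → Removed x
    no-exit⇒Removed {x} h y∈ = rem-of (comp-elim (λ y → ∀ {z} → ¬ Exits y z) closed-gap closed-vgraph h y∈)
      where
      rem-of : ∀ {y} → (∀ {z} → ¬ Exits y z) → rem y ≡ true
      rem-of {y} h with rem y in eq
      ... | true = refl
      ... | false = ⊥-elim (h (done eq))
      closed-gap : ∀ {y} → (∀ {z} → ¬ Exits y z) → ∀ {z} → ¬ Exits (gapX y) z
      closed-gap {y} h p with w , refl ← emb-surj (exits-nonrem p) =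
        h (exits-from (gap-invol y) (exits-gap p))
      closed-vgraph : ∀ {y} → (∀ {z} → ¬ Exits y z) → ∀ {z} → ¬ Exits (vgraph y) z
      closed-vgraph {y} h p with r ← rem-of h with exits-from (vgraph-rem r) p
      ... | done r′ = false≢true r′ (μ-rem r)
      ... | step _ q = closed-gap h (exits-from (cong gapX (μ-invol r)) q)

    rep : Fin (length newReps) → X
    rep = lookup newReps

    rep-removed : ∀ j → Removed (rep j)
    rep-removed j = all⁻ rem _ (proj₂ (∈-filterᵇ⁻ _ {xs = Graph.reps enum _≟X_ gapX vgraph} (∈-lookup j)))

    rep-unique : ∀ {i j} → EqClosure Geo (rep i) (rep j) → i ≡ j
    rep-unique {i} {j} p = AllPairs-lookup (AllPairs-filterᵇ _ (Reps.reps-separated _≟X_ gapX vgraph enum complete)) i j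
      (λ n → n (Geo⇒comp (rep-removed j) (closure-sym p))) (λ n → n (Geo⇒comp (rep-removed i) p))

    rep-exists : ∀ {x} → Removed x → Σ (Fin (length newReps)) λ j → EqClosure Geo (rep j) x
    rep-exists = Reps.reps-represents _≟X_ gapX vgraph enum complete Removed
      (λ x → Σ (Fin (length newReps)) λ j → EqClosure Geo (rep j) x) link here-rep
      where
      link : ∀ {x y} → Removed x → y ∈ comp gapX vgraph x → Removed y × ((Σ _ λ j → EqClosure Geo (rep j) y) → (Σ _ λ j → EqClosure Geo (rep j) x))
      link {x} rx y∈ = (λ z∈ → rx (comp-elim (_∈ comp gapX vgraph x) (proj₁ ∘ comp-closed x) (proj₂ ∘ comp-closed x) y∈ z∈)) ,
        λ { (j , p) → j , p ◅◅ closure-sym (comp⇒Geo rx y∈) }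
      here-rep : ∀ {x} → x ∈ Graph.reps enum _≟X_ gapX vgraph → Removed x → Σ _ λ j → EqClosure Geo (rep j) x
      here-rep {x} x∈ rx with x∈′ ← ∈-filterᵇ⁺ (λ r → all rem (comp gapX vgraph r)) x∈ (all⁺ rem _ rx) =
        Any.index x∈′ , subst (EqClosure Geo (rep (Any.index x∈′))) (sym (Any.lookup-index x∈′)) ε

    data Fate (x : X) : Set where
      exits : ∀ z → Exits x (emb z) → Fate x
      stays : ∀ j → EqClosure Geo (rep j) x → Fate x

    fate : ∀ x → Fate x
    fate x with rem (hop N x) in eq
    ... | true with j , p ← rep-exists (no-exit⇒Removed (stuck⇒no-exit eq)) = stays j p
    ... | false with z , e ← emb-surj eq = exits z (subst (Exits x) (sym e) (hop-exits N eq))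

    exits-or-stays : ∀ {x z j} → Exits x (emb z) → ¬ EqClosure Geo (rep j) x
    exits-or-stays {z = z} {j} p q = false≢true (emb-rem z) (rep-removed j (Geo⇒comp (rep-removed j) (q ◅◅ exits⇒Geo p)))

    ι : End m′ ⊎ Fin (length newReps) → X
    ι (inj₁ z) = emb z
    ι (inj₂ j) = rep j

    target : ∀ {x} → Fate x → End m′ ⊎ Fin (length newReps)
    target (exits z _) = inj₁ z
    target (stays j _) = inj₂ j

    -- A retraction onto the points of the new presentation: an endpoint goes to where its walk
    -- leaves the removed part, or to the circle in which the walk is trapped. `ι` is a section of
    -- it, and `ι ∘ ρ` stays within `Geo`-classes.
    ρ : X → End m′ ⊎ Fin (length newReps)
    ρ x = target (fate x)

    ρ-exits : ∀ {x z} → Exits x (emb z) → ρ x ≡ inj₁ z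
    ρ-exits {x} p with fate x
    ... | exits z q = cong inj₁ (emb-inj (exits-unique q p))
    ... | stays j q = ⊥-elim (exits-or-stays p q)

    ρ-stays : ∀ {x j} → EqClosure Geo (rep j) x → ρ x ≡ inj₂ j
    ρ-stays {x} p with fate x
    ... | exits z q = ⊥-elim (exits-or-stays q p)
    ... | stays i q = cong inj₂ (rep-unique (q ◅◅ closure-sym p))

    ρ-ι : ∀ i → ρ (ι i) ≡ i
    ρ-ι (inj₁ z) = ρ-exits (done (emb-rem z))
    ρ-ι (inj₂ j) = ρ-stays ε

    ι-ρ : ∀ x → EqClosure Geo (ι (ρ x)) x
    ι-ρ x with fate x
    ... | exits z p = closure-sym (exits⇒Geo p)
    ... | stays j p = p

    ρ-Geo : ∀ {x y} → Geo x y → EqClosure Gap′ (ρ x) (ρ y)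
    ρ-Geo {x} {y} s with fate x
    ... | stays j p = subst (EqClosure Gap′ (inj₂ j)) (sym (ρ-stays (p ◅◅ Closure.return s))) ε
    ρ-Geo (gap-step x) | exits z p = subst (EqClosure Gap′ (inj₁ z)) (sym (ρ-exits (exits-gap p))) (Closure.return (gap-step′ z))
    ρ-Geo (μ-step r) | exits z (done r′) = ⊥-elim (false≢true r′ r)
    ρ-Geo (μ-step {x} r) | exits z (step _ p) = subst (EqClosure Gap′ (inj₁ z))
      (sym (ρ-exits (exits-from (gap-invol (μ x)) (exits-gap p)))) (Closure.return (gap-step′ z))

    gap′-Geo : ∀ z → EqClosure Geo (emb z) (emb (gap′ z))
    gap′-Geo z = fwd (gap-step _) ◅ exits⇒Geo (gap′-exits z)

-- Labels after surgery

-- Circles without arrows are identified by their position in `empties`, as several may carry the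
-- same labels. This calls for bijections between the positions in a list and those in its image
-- under a map or in a concatenation.
mapI : {A B : Set} (f : A → B) (xs : List A) → Fin (length xs) → Fin (length (map f xs))
mapI f (x ∷ xs) zero = zero
mapI f (x ∷ xs) (suc i) = suc (mapI f xs i)

unmapI : {A B : Set} (f : A → B) (xs : List A) → Fin (length (map f xs)) → Fin (length xs)
unmapI f (x ∷ xs) zero = zero
unmapI f (x ∷ xs) (suc i) = suc (unmapI f xs i)

unmapI-mapI : {A B : Set} (f : A → B) (xs : List A) → ∀ i → unmapI f xs (mapI f xs i) ≡ i
unmapI-mapI f (x ∷ xs) zero = refl
unmapI-mapI f (x ∷ xs) (suc i) = cong suc (unmapI-mapI f xs i)

mapI-unmapI : {A B : Set} (f : A → B) (xs : List A) → ∀ i → mapI f xs (unmapI f xs i) ≡ i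
mapI-unmapI f (x ∷ xs) zero = refl
mapI-unmapI f (x ∷ xs) (suc i) = cong suc (mapI-unmapI f xs i)

lookup-unmapI : {A B : Set} (f : A → B) (xs : List A) → ∀ i → lookup (map f xs) i ≡ f (lookup xs (unmapI f xs i))
lookup-unmapI f (x ∷ xs) zero = refl
lookup-unmapI f (x ∷ xs) (suc i) = lookup-unmapI f xs i

joinI : {A : Set} (xs ys : List A) → Fin (length xs) ⊎ Fin (length ys) → Fin (length (xs ++ ys))
joinI (x ∷ xs) ys (inj₁ zero) = zero
joinI (x ∷ xs) ys (inj₁ (suc i)) = suc (joinI xs ys (inj₁ i))
joinI [] ys (inj₂ j) = j
joinI (x ∷ xs) ys (inj₂ j) = suc (joinI xs ys (inj₂ j))

splitI : {A : Set} (xs ys : List A) → Fin (length (xs ++ ys)) → Fin (length xs) ⊎ Fin (length ys)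
splitI [] ys j = inj₂ j
splitI (x ∷ xs) ys zero = inj₁ zero
splitI (x ∷ xs) ys (suc i) = Sum.map₁ suc (splitI xs ys i)

splitI-joinI : {A : Set} (xs ys : List A) → ∀ i → splitI xs ys (joinI xs ys i) ≡ i
splitI-joinI (x ∷ xs) ys (inj₁ zero) = refl
splitI-joinI (x ∷ xs) ys (inj₁ (suc i)) = cong (Sum.map₁ suc) (splitI-joinI xs ys (inj₁ i))
splitI-joinI [] ys (inj₂ j) = refl
splitI-joinI (x ∷ xs) ys (inj₂ j) = cong (Sum.map₁ suc) (splitI-joinI xs ys (inj₂ j))

joinI-splitI : {A : Set} (xs ys : List A) → ∀ i → joinI xs ys (splitI xs ys i) ≡ i
joinI-splitI [] ys j = refl
joinI-splitI (x ∷ xs) ys zero = refl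
joinI-splitI (x ∷ xs) ys (suc i) with splitI xs ys i | joinI-splitI xs ys i
... | inj₁ j | eq = cong suc eq
... | inj₂ j | eq = cong suc eq

lookup-splitI : {A : Set} (xs ys : List A) → ∀ i → lookup (xs ++ ys) i ≡ Sum.[ lookup xs , lookup ys ]′ (splitI xs ys i)
lookup-splitI [] ys j = refl
lookup-splitI (x ∷ xs) ys zero = refl
lookup-splitI (x ∷ xs) ys (suc i) with splitI xs ys i | lookup-splitI xs ys i
... | inj₁ j | eq = eq
... | inj₂ j | eq = eq

data Image {A B : Set} (f : A → B) (T : Rel A 0ℓ) : Rel B 0ℓ where
  image : ∀ {x y} → T x y → Image f T (f x) (f y)

-- `B` is what a presentation provides by itself, `T` what the operations add; the latter only ever
-- link endpoints, never circles without arrows.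
data Gens {E D : Set} (B : Rel (E ⊎ D) 0ℓ) (T : Rel E 0ℓ) : Rel (E ⊎ D) 0ℓ where
  base : ∀ {i j} → B i j → Gens B T i j
  link : ∀ {x y} → T x y → Gens B T (inj₁ x) (inj₁ y)

data GapRel {E D : Set} (g : E → E) : Rel (E ⊎ D) 0ℓ where
  gap-rel : ∀ x → GapRel g (inj₁ x) (inj₁ (g x))

Equal : {I : Set} (l : I → ℕ) → Rel I 0ℓ
Equal l i j = l i ≡ l j

labels : {E : Set} (es : List (ℕ × ℕ)) (l : E → ℕ) (π : ℕ × ℕ → ℕ) → E ⊎ Fin (length es) → ℕ
labels es l π = Sum.[ l , π ∘ lookup es ]′

module SurgeryLabels {X : Set} (enum : List X) (_≟X_ : DecidableEquality X) {m′ : ℕ}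
               (emb : End m′ → X) (gapX : X → X) (rem : X → Bool) (μ : X → X) (arcX : X → X)
               (laws : Surgery.Laws enum _≟X_ emb gapX rem μ arcX)
               (vlX blX : X → ℕ) (rv rb : ℕ → ℕ) (old : List (ℕ × ℕ)) where
  open Surgery enum _≟X_ emb gapX rem μ arcX
  open WithLaws laws

  private
    P′ : Pres m′
    P′ = result vlX blX rv rb old

    relabel : ℕ × ℕ → ℕ × ℕ
    relabel p = rv (proj₁ p) , rb (proj₂ p)

    newLabel : X → ℕ × ℕ
    newLabel r = vlX r , blX r

    Pt′ : Set
    Pt′ = End m′ ⊎ Fin (length (empties P′))

    PtX : Set
    PtX = X ⊎ Fin (length old)

  unfold : Fin (length (empties P′)) → Fin (length old) ⊎ Fin (length newReps)
  unfold i = Sum.map₂ (unmapI newLabel newReps) (splitI old (map newLabel newReps) (unmapI relabel (old ++ map newLabel newReps) i))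

  refold : Fin (length old) ⊎ Fin (length newReps) → Fin (length (empties P′))
  refold i = mapI relabel (old ++ map newLabel newReps) (joinI old (map newLabel newReps) (Sum.map₂ (mapI newLabel newReps) i))

  refold-unfold : ∀ i → refold (unfold i) ≡ i
  refold-unfold i = trans (cong (mapI relabel all′ ∘ joinI old new) (cancel (splitI old new (unmapI relabel all′ i))))
      (trans (cong (mapI relabel all′) (joinI-splitI old new _)) (mapI-unmapI relabel all′ i))
    where
    new = map newLabel newReps
    all′ = old ++ new
    cancel : ∀ j → Sum.map₂ (mapI newLabel newReps) (Sum.map₂ (unmapI newLabel newReps) j) ≡ j
    cancel (inj₁ j) = refl
    cancel (inj₂ j) = cong inj₂ (mapI-unmapI newLabel newReps j)

  unfold-refold : ∀ i → unfold (refold i) ≡ i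
  unfold-refold i = trans (cong (Sum.map₂ (unmapI newLabel newReps)) (trans (cong (splitI old new) (unmapI-mapI relabel all′ _)) (splitI-joinI old new _))) (cancel i)
    where
    new = map newLabel newReps
    all′ = old ++ new
    cancel : ∀ j → Sum.map₂ (unmapI newLabel newReps) (Sum.map₂ (mapI newLabel newReps) j) ≡ j
    cancel (inj₁ j) = refl
    cancel (inj₂ j) = cong inj₂ (unmapI-mapI newLabel newReps j)

  fromNew : Fin (length old) ⊎ Fin (length newReps) → PtX
  fromNew (inj₁ a) = inj₂ a
  fromNew (inj₂ j) = inj₁ (rep j)

  -- A circle created by the surgery is sent to its representative endpoint, so that it can be
  -- compared with points that existed before.
  up : Pt′ → PtX
  up (inj₁ z) = inj₁ (emb z)
  up (inj₂ i) = fromNew (unfold i)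

  settle : End m′ ⊎ Fin (length newReps) → Pt′
  settle (inj₁ z) = inj₁ z
  settle (inj₂ j) = inj₂ (refold (inj₂ j))

  down : PtX → Pt′
  down (inj₁ x) = settle (ρ x)
  down (inj₂ a) = inj₂ (refold (inj₁ a))

  up-settle : ∀ i → up (settle i) ≡ inj₁ (ι i)
  up-settle (inj₁ z) = refl
  up-settle (inj₂ j) = cong fromNew (unfold-refold (inj₂ j))

  down-up : ∀ i → down (up i) ≡ i
  down-up (inj₁ z) = cong settle (ρ-ι (inj₁ z))
  down-up (inj₂ i) with unfold i | refold-unfold i
  ... | inj₁ a | eq = cong inj₂ eq
  ... | inj₂ j | eq = trans (cong settle (ρ-ι (inj₂ j))) (cong inj₂ eq)

  lookup-unfold : ∀ i → lookup (empties P′) i ≡ relabel (Sum.[ lookup old , newLabel ∘ rep ]′ (unfold i))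
  lookup-unfold i = trans (lookup-unmapI relabel all′ i) (cong relabel
      (trans (lookup-splitI old new (unmapI relabel all′ i)) (inner (splitI old new (unmapI relabel all′ i)))))
    where
    new = map newLabel newReps
    all′ = old ++ new
    inner : ∀ j → Sum.[ lookup old , lookup new ]′ j ≡ Sum.[ lookup old , newLabel ∘ rep ]′ (Sum.map₂ (unmapI newLabel newReps) j)
    inner (inj₁ a) = refl
    inner (inj₂ b) = lookup-unmapI newLabel newReps b

  vlabel-up : ∀ i → labels (empties P′) (vl P′) proj₁ i ≡ rv (labels old vlX proj₁ (up i))
  vlabel-up (inj₁ z) = refl
  vlabel-up (inj₂ i) with unfold i | lookup-unfold i
  ... | inj₁ a | eq = cong proj₁ eq
  ... | inj₂ j | eq = cong proj₁ eq

  blabel-up : ∀ i → labels (empties P′) (bl P′) proj₂ i ≡ rb (labels old blX proj₂ (up i))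
  blabel-up (inj₁ z) = refl
  blabel-up (inj₂ i) with unfold i | lookup-unfold i
  ... | inj₁ a | eq = cong proj₂ eq
  ... | inj₂ j | eq = cong proj₂ eq

  module _ (Src : Rel PtX 0ℓ) (Tgt : Rel Pt′ 0ℓ) where
    -- `down ∘ up` is the identity, whereas `up ∘ down` moves endpoints along `Geo`; the first
    -- hypothesis keeps this motion inside the classes of `Src`.
    transfer : (∀ {x y} → Geo x y → EqClosure Src (inj₁ x) (inj₁ y)) →
      (∀ {i j} → Tgt i j → EqClosure Src (up i) (up j)) →
      (∀ {i j} → Src i j → EqClosure Tgt (down i) (down j)) → ⟨ Tgt ⟩ ≃ ⟨ Src ⟩
    transfer geo up-ok down-ok = closure-≃ up down up-ok down-ok up-down
        (λ i → subst (λ j → EqClosure Tgt j i) (sym (down-up i)) ε)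
      where
      up-down : ∀ i → EqClosure Src (up (down i)) i
      up-down (inj₁ x) = subst (λ j → EqClosure Src j (inj₁ x)) (sym (up-settle (ρ x)))
        (extend ⟨ Src ⟩ inj₁ geo (ι-ρ x))
      up-down (inj₂ a) = subst (λ j → EqClosure Src j (inj₂ a)) (sym (cong fromNew (unfold-refold (inj₁ a)))) ε

  module _ (RG : Rel X 0ℓ) (T : Rel (End m′) 0ℓ) where
    kept-down : ∀ {B x y} → Image emb T x y → EqClosure (Gens B T) (down (inj₁ x)) (down (inj₁ y))
    kept-down {B} (image {x} {y} t) = subst₂ (EqClosure (Gens B T)) (sym (cong settle (ρ-ι (inj₁ x)))) (sym (cong settle (ρ-ι (inj₁ y))))
      (Closure.return (link t))

    -- `RG` stands in for `μ`: it has to generate `μ` and stay inside the closure of `Geo`. This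
    -- leaves room to link by a partition of the four endpoints at an edge, and by the bare
    -- crossings in a 2-sum.
    gap-transfer : (∀ {x y} → RG x y → EqClosure Geo x y) → (∀ {x} → rem x ≡ true → EqClosure RG x (μ x)) →
      ⟨ Gens (GapRel (gap P′)) T ⟩ ≃ ⟨ Gens (GapRel gapX) (RG ∪ Image emb T) ⟩
    gap-transfer RG⊆Geo μ⊆RG = transfer _ _ geo up-ok down-ok
      where
      Src : Rel PtX 0ℓ
      Src = Gens (GapRel gapX) (RG ∪ Image emb T)
      Tgt : Rel Pt′ 0ℓ
      Tgt = Gens (GapRel (gap P′)) T
      geo : ∀ {x y} → Geo x y → EqClosure Src (inj₁ x) (inj₁ y)
      geo (gap-step x) = Closure.return (base (gap-rel x))
      geo (μ-step r) = Closure.gmap inj₁ (link ∘ inj₁) (μ⊆RG r)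
      up-ok : ∀ {i j} → Tgt i j → EqClosure Src (up i) (up j)
      up-ok (base (gap-rel z)) = subst (λ w → EqClosure Src (inj₁ (emb z)) (inj₁ (emb w))) (sym (gap-result vlX blX rv rb old z))
        (extend ⟨ Src ⟩ inj₁ geo (gap′-Geo z))
      up-ok (link t) = Closure.return (link (inj₂ (image t)))
      gap-ok : ∀ {i j} → Gap′ i j → EqClosure Tgt (settle i) (settle j)
      gap-ok (gap-step′ z) = subst (λ w → EqClosure Tgt (inj₁ z) (inj₁ w)) (gap-result vlX blX rv rb old z) (Closure.return (base (gap-rel z)))
      geo-down : ∀ {x y} → Geo x y → EqClosure Tgt (down (inj₁ x)) (down (inj₁ y))
      geo-down s = extend ⟨ Tgt ⟩ settle gap-ok (ρ-Geo s)
      down-ok : ∀ {i j} → Src i j → EqClosure Tgt (down i) (down j)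
      down-ok (base (gap-rel x)) = geo-down (gap-step x)
      down-ok (link (inj₁ s)) = extend ⟨ Tgt ⟩ (down ∘ inj₁) geo-down (RG⊆Geo s)
      down-ok (link (inj₂ t)) = kept-down t

    -- Blocks are merged by the relabelling `r`. Its invariance under `Geo` and `RG` says that it
    -- merges enough, and `ker` that it merges nothing beyond what is generated.
    label-transfer : (l : PtX → ℕ) (l′ : Pt′ → ℕ) (r : ℕ → ℕ) → (∀ i → l′ i ≡ r (l (up i))) →
      (∀ {x y} → Geo x y → r (l (inj₁ x)) ≡ r (l (inj₁ y))) → (∀ {x y} → RG x y → r (l (inj₁ x)) ≡ r (l (inj₁ y))) →
      (∀ i j → r (l i) ≡ r (l j) → EqClosure (Gens (Equal l) (RG ∪ Image emb T)) i j) →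
      ⟨ Gens (Equal l′) T ⟩ ≃ ⟨ Gens (Equal l) (RG ∪ Image emb T) ⟩
    label-transfer l l′ r l′-up geo-inv RG-inv ker = transfer Src Tgt (λ s → ker _ _ (geo-inv s)) up-ok down-ok
      where
      Src : Rel PtX 0ℓ
      Src = Gens (Equal l) (RG ∪ Image emb T)
      Tgt : Rel Pt′ 0ℓ
      Tgt = Gens (Equal l′) T
      up-ok : ∀ {i j} → Tgt i j → EqClosure Src (up i) (up j)
      up-ok (base eq) = ker _ _ (trans (sym (l′-up _)) (trans eq (l′-up _)))
      up-ok (link t) = Closure.return (link (inj₂ (image t)))
      l′-down : ∀ i → l′ (down i) ≡ r (l i)
      l′-down i = trans (l′-up (down i)) (inner i)
        where
        inner : ∀ i → r (l (up (down i))) ≡ r (l i)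
        inner (inj₁ x) = trans (cong (r ∘ l) (up-settle (ρ x))) (extend (setoid ℕ) (r ∘ l ∘ inj₁) geo-inv (ι-ρ x))
        inner (inj₂ a) = cong (r ∘ l ∘ fromNew) (unfold-refold (inj₁ a))
      down-ok : ∀ {i j} → Src i j → EqClosure Tgt (down i) (down j)
      down-ok (base eq) = Closure.return (base (trans (l′-down _) (trans (cong r eq) (sym (l′-down _)))))
      down-ok (link (inj₁ s)) = Closure.return (base (trans (l′-down _) (trans (RG-inv s) (sym (l′-down _)))))
      down-ok (link (inj₂ t)) = kept-down t

  module _ (arc-emb : ∀ z → rv (vlX (emb (arc z))) ≡ rv (vlX (emb z)))
           (conn-emb : ∀ z → rb (blX (emb (conn z))) ≡ rb (blX (emb z)))
           (v-geo : ∀ {x y} → Geo x y → rv (vlX x) ≡ rv (vlX y))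
           (b-geo : ∀ {x y} → Geo x y → rb (blX x) ≡ rb (blX y)) where
    result-WF : WF P′
    result-WF = record
      { gap-invol = λ z → trans (gap-eq (gap P′ z)) (trans (cong gap′ (gap-eq z)) (gap′-invol z))
      ; gap-nofix = λ z eq → gap′-nofix z (trans (sym (gap-eq z)) eq)
      ; vl-gap = λ z → trans (cong (rv ∘ vlX ∘ emb) (gap-eq z)) (sym (extend (setoid ℕ) (rv ∘ vlX) v-geo (gap′-Geo z)))
      ; vl-arc = arc-emb
      ; bl-gap = λ z → trans (cong (rb ∘ blX ∘ emb) (gap-eq z)) (sym (extend (setoid ℕ) (rb ∘ blX) b-geo (gap′-Geo z)))
      ; bl-conn = conn-emb
      }
      where gap-eq = gap-result vlX blX rv rb old

-- Operations on a single edge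

-- circles, blocks of 𝒱, blocks of ℬ
data Kind : Set where
  cyc vtx bdy : Kind

data Op : Set where
  del con penrose mdel mcon : Op

data Part : Set where
  arcs conns pens full : Part

Term : Set
Term = Fin 2 × Fin 2

-- The blocks of a partition of the four endpoints of an edge, as the fibres of a map.
key : Part → Term → Fin 2
key arcs (i , t) = i
key conns (zero , t) = t
key conns (suc _ , t) = flip2 t
key pens (i , t) = t
key full _ = zero

-- Endpoints identified by an operation, joined for the two kinds of blocks with the pairs whose
-- labels agree anyway (arcs for 𝒱, conns for ℬ).
part : Kind → Op → Part
part cyc del = arcs
part cyc con = conns
part cyc penrose = pens
part cyc mdel = arcs
part cyc mcon = conns
part vtx del = arcs
part vtx _ = full
part bdy con = conns
part bdy _ = full

mate : Op → ∀ {m} → End m → End m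
mate del = arc
mate mdel = arc
mate con = conn
mate mcon = conn
mate penrose = pen

Pt : ∀ {m} → Pres m → Set
Pt {m} P = End m ⊎ Fin (length (empties P))

vlabel blabel : ∀ {m} (P : Pres m) → Pt P → ℕ
vlabel P = labels (empties P) (vl P) proj₁
blabel P = labels (empties P) (bl P) proj₂

Base : Kind → ∀ {m} (P : Pres m) → Rel (Pt P) 0ℓ
Base cyc P = GapRel (gap P)
Base vtx P = Equal (vlabel P)
Base bdy P = Equal (blabel P)

data Link (κ : Kind) {m} (s : Vec Op m) : Rel (End m) 0ℓ where
  same : ∀ {f z w} → key (part κ (Vec.lookup s f)) z ≡ key (part κ (Vec.lookup s f)) w → Link κ s (f , z) (f , w)

data EdgeLink (p : Part) {m} (e : Fin m) : Rel (End m) 0ℓ where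
  same : ∀ {z w} → key p z ≡ key p w → EdgeLink p e (e , z) (e , w)

punch : ∀ {m} → Fin (suc m) → End m → End (suc m)
punch e x = punchIn e (proj₁ x) , proj₂ x

classes : Kind → ∀ {m} (P : Pres m) → Rel (End m) 0ℓ → Setoid 0ℓ 0ℓ
classes κ P T = ⟨ Gens (Base κ P) T ⟩

apply : Op → ∀ {n} → Pres (suc n) → Fin (suc n) → Pres n
apply del = _∖_
apply con = _/_
apply penrose = _†_
apply mdel = _∖ₘ_
apply mcon = _/ₘ_

flip2-flip2 : ∀ t → flip2 (flip2 t) ≡ t
flip2-flip2 zero = refl
flip2-flip2 (suc zero) = refl

flip2-≢ : ∀ t → flip2 t ≢ t
flip2-≢ zero ()
flip2-≢ (suc zero) ()

mate-edge : ∀ o {m} (x : End m) → proj₁ (mate o x) ≡ proj₁ x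
mate-edge del x = refl
mate-edge con x = refl
mate-edge penrose x = refl
mate-edge mdel x = refl
mate-edge mcon x = refl

mate-invol : ∀ o {m} (x : End m) → mate o (mate o x) ≡ x
mate-invol del (e , i , t) = cong (λ u → e , i , u) (flip2-flip2 t)
mate-invol mdel (e , i , t) = cong (λ u → e , i , u) (flip2-flip2 t)
mate-invol con (e , i , t) = cong₂ (λ u v → e , u , v) (flip2-flip2 i) (flip2-flip2 t)
mate-invol mcon (e , i , t) = cong₂ (λ u v → e , u , v) (flip2-flip2 i) (flip2-flip2 t)
mate-invol penrose (e , i , t) = cong (λ u → e , u , t) (flip2-flip2 i)

mate-nofix : ∀ o {m} (x : End m) → mate o x ≢ x
mate-nofix del (e , i , t) eq = flip2-≢ t (cong (proj₂ ∘ proj₂) eq)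
mate-nofix mdel (e , i , t) eq = flip2-≢ t (cong (proj₂ ∘ proj₂) eq)
mate-nofix con (e , i , t) eq = flip2-≢ t (cong (proj₂ ∘ proj₂) eq)
mate-nofix mcon (e , i , t) eq = flip2-≢ t (cong (proj₂ ∘ proj₂) eq)
mate-nofix penrose (e , i , t) eq = flip2-≢ i (cong (proj₁ ∘ proj₂) eq)

∀T? : {P : Term → Set} → (∀ z → Dec (P z)) → Dec (∀ z → P z)
∀T? {P} P? with Fin.all? (λ i → Fin.all? (λ t → P? (i , t)))
... | yes p = yes (λ z → p (proj₁ z) (proj₂ z))
... | no ¬p = no (λ h → ¬p (λ i t → h (i , t)))

_≟T_ : DecidableEquality Term
_≟T_ = ×P.≡-dec Fin._≟_ Fin._≟_

flipKey : Part → Term → Term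
flipKey arcs (i , t) = i , flip2 t
flipKey conns (i , t) = flip2 i , flip2 t
flipKey pens (i , t) = flip2 i , t
flipKey full z = z

key-fibre : ∀ p → p ≢ full → ∀ z w → key p z ≡ key p w → w ≡ z ⊎ w ≡ flipKey p z
key-fibre arcs _ = toWitness {a? = ∀T? λ z → ∀T? λ w → (key arcs z Fin.≟ key arcs w) →-dec ((w ≟T z) ⊎-dec (w ≟T flipKey arcs z))} tt
key-fibre conns _ = toWitness {a? = ∀T? λ z → ∀T? λ w → (key conns z Fin.≟ key conns w) →-dec ((w ≟T z) ⊎-dec (w ≟T flipKey conns z))} tt
key-fibre pens _ = toWitness {a? = ∀T? λ z → ∀T? λ w → (key pens z Fin.≟ key pens w) →-dec ((w ≟T z) ⊎-dec (w ≟T flipKey pens z))} tt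
key-fibre full n = ⊥-elim (n refl)

key-flip : ∀ p z → key p z ≡ key p (flipKey p z)
key-flip arcs = toWitness {a? = ∀T? λ z → key arcs z Fin.≟ key arcs (flipKey arcs z)} tt
key-flip conns = toWitness {a? = ∀T? λ z → key conns z Fin.≟ key conns (flipKey conns z)} tt
key-flip pens = toWitness {a? = ∀T? λ z → key pens z Fin.≟ key pens (flipKey pens z)} tt
key-flip full z = refl

partG≢full : ∀ o → part cyc o ≢ full
partG≢full del ()
partG≢full con ()
partG≢full penrose ()
partG≢full mdel ()
partG≢full mcon ()

mate-flipKey : ∀ o {m} (e : Fin m) z → mate o (e , z) ≡ (e , flipKey (part cyc o) z)
mate-flipKey del e z = refl
mate-flipKey con e z = refl
mate-flipKey penrose e z = refl
mate-flipKey mdel e z = refl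
mate-flipKey mcon e z = refl

≡ᵇ-true : ∀ {m n} → (m ≡ᵇ n) ≡ true → m ≡ n
≡ᵇ-true {m} {n} h = ℕ.≡ᵇ⇒≡ m n (subst Bool.T (sym h) tt)

≡ᵇ-refl : ∀ n → (n ≡ᵇ n) ≡ true
≡ᵇ-refl zero = refl
≡ᵇ-refl (suc n) = ≡ᵇ-refl n

merge-merges : ∀ r x y → merge r x y x ≡ merge r x y y
merge-merges r x y with r x ≡ᵇ r y
... | true rewrite ≡ᵇ-refl (r y) = refl
... | false rewrite ≡ᵇ-refl (r y) = refl

-- An index whose label is overwritten is traded for `jx`, at the price of one use of the pair `jx`,
-- `jy`. After the trade, equal merged labels are equal values of `r`, and `ker` applies.
merge-ker : {J : Set} (S : Rel J 0ℓ) → IsEquivalence S → (l : J → ℕ) (r : ℕ → ℕ) →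
  (∀ i j → r (l i) ≡ r (l j) → S i j) → ∀ {x y jx jy} → l jx ≡ x → l jy ≡ y → S jx jy →
  ∀ i j → merge r x y (l i) ≡ merge r x y (l j) → S i j
merge-ker S eqv l r ker {x} {y} {jx} {jy} refl refl sxy i j eq =
  join (adjust i) (adjust j)
  where
  module E = IsEquivalence eqv
  adjust : ∀ i → ∃ λ i′ → S i i′ × r (l i′) ≡ merge r x y (l i)
  adjust i with r (l i) ≡ᵇ r y in h
  ... | true = jx , E.trans (ker i jy (≡ᵇ-true h)) (E.sym sxy) , refl
  ... | false = i , E.refl , refl
  join : (∃ λ i′ → S i i′ × r (l i′) ≡ merge r x y (l i)) → (∃ λ j′ → S j j′ × r (l j′) ≡ merge r x y (l j)) → S i j
  join (i′ , si , ei) (j′ , sj , ej) = E.trans si (E.trans (ker i′ j′ (trans ei (trans eq (sym ej)))) (E.sym sj))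

merge-cong : ∀ r x y {l l′} → r l ≡ r l′ → merge r x y l ≡ merge r x y l′
merge-cong r x y eq rewrite eq = refl

-- Endpoints identified by an operation end up on one circle and on one boundary component, so the
-- partition for either kind of block must contain the matching.
mate-refines : ∀ κ o z → key (part κ o) z ≡ key (part κ o) (flipKey (part cyc o) z)
mate-refines cyc o z = key-flip (part cyc o) z
mate-refines vtx del z = key-flip arcs z
mate-refines vtx con z = refl
mate-refines vtx penrose z = refl
mate-refines vtx mdel z = refl
mate-refines vtx mcon z = refl
mate-refines bdy con z = key-flip conns z
mate-refines bdy del z = refl
mate-refines bdy penrose z = refl
mate-refines bdy mdel z = refl
mate-refines bdy mcon z = refl

module _ {n} (P : Pres (suc n)) (wf : WF P) (e : Fin (suc n)) where
  open WF wf

  vl-key : ∀ z w → key arcs z ≡ key arcs w → vl P (e , z) ≡ vl P (e , w)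
  vl-key z w eq with key-fibre arcs (λ ()) z w eq
  ... | inj₁ refl = refl
  ... | inj₂ refl = sym (vl-arc (e , z))

  bl-key : ∀ z w → key conns z ≡ key conns w → bl P (e , z) ≡ bl P (e , w)
  bl-key z w eq with key-fibre conns (λ ()) z w eq
  ... | inj₁ refl = refl
  ... | inj₂ refl = sym (bl-conn (e , z))

  rvO rbO : Op → ℕ → ℕ
  rvO del = id
  rvO _ = EdgeOp.mergeV P e
  rbO con = id
  rbO _ = EdgeOp.mergeB P e

  removed : End (suc n) → Bool
  removed x = ⌊ proj₁ x Fin.≟ e ⌋

  op-result : ∀ μ rv rb → EdgeOp.op P e μ rv rb ≡ Surgery.result (allEnd (suc n)) _≟E_ (punch e) (gap P) removed μ arc (vl P) (bl P) rv rb (empties P)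
  op-result μ rv rb = refl

  private
    as-result : ∀ o μ rv rb → μ ≡ mate o → rv ≡ rvO o → rb ≡ rbO o → EdgeOp.op P e μ rv rb ≡
      Surgery.result (allEnd (suc n)) _≟E_ (punch e) (gap P) removed (mate o) arc (vl P) (bl P) (rvO o) (rbO o) (empties P)
    as-result o _ _ _ refl refl refl = op-result (mate o) (rvO o) (rbO o)

  apply-op : ∀ o → apply o P e ≡
    Surgery.result (allEnd (suc n)) _≟E_ (punch e) (gap P) removed (mate o) arc (vl P) (bl P) (rvO o) (rbO o) (empties P)
  apply-op del = as-result del arc id (EdgeOp.mergeB P e) refl refl refl
  apply-op con = as-result con conn (EdgeOp.mergeV P e) id refl refl refl
  apply-op penrose = as-result penrose pen (EdgeOp.mergeV P e) (EdgeOp.mergeB P e) refl refl refl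
  apply-op mdel = as-result mdel arc (EdgeOp.mergeV P e) (EdgeOp.mergeB P e) refl refl refl
  apply-op mcon = as-result mcon conn (EdgeOp.mergeV P e) (EdgeOp.mergeB P e) refl refl refl

  removed⁻ : ∀ {x} → removed x ≡ true → proj₁ x ≡ e
  removed⁻ {x} h with proj₁ x Fin.≟ e
  ... | yes eq = eq

  removed⁺ : ∀ z → removed (e , z) ≡ true
  removed⁺ z with e Fin.≟ e
  ... | yes _ = refl
  ... | no ne = contradiction refl ne

  laws : ∀ o → Surgery.Laws (allEnd (suc n)) _≟E_ (punch e) (gap P) removed (mate o) arc
  laws o = record
    { complete = ∈-allEnd ; gap-invol = gap-invol ; gap-nofix = gap-nofix
    ; μ-rem = λ {x} r → trans (cong (λ f → ⌊ f Fin.≟ e ⌋) (mate-edge o x)) r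
    ; μ-invol = λ _ → mate-invol o _ ; μ-nofix = λ _ → mate-nofix o _
    ; emb-inj = λ eq → cong₂ _,_ (Fin.punchIn-injective e _ _ (cong proj₁ eq)) (cong proj₂ eq)
    ; emb-rem = emb-rem
    ; emb-surj = emb-surj
    }
    where
    emb-rem : ∀ x → removed (punch e x) ≡ false
    emb-rem x with punchIn e (proj₁ x) Fin.≟ e
    ... | yes eq = contradiction eq (Fin.punchInᵢ≢i e (proj₁ x))
    ... | no _ = refl
    emb-surj : ∀ {x} → removed x ≡ false → Σ (End n) λ z → punch e z ≡ x
    emb-surj {f , z} h with f Fin.≟ e
    ... | no ne = (Fin.punchOut (ne ∘ sym) , z) , cong (_, z) (Fin.punchIn-punchOut (ne ∘ sym))

  mergeV-all : ∀ z w → EdgeOp.mergeV P e (vl P (e , z)) ≡ EdgeOp.mergeV P e (vl P (e , w))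
  mergeV-all z w = trans (to-first z) (sym (to-first w))
    where
    to-first : ∀ z → EdgeOp.mergeV P e (vl P (e , z)) ≡ EdgeOp.mergeV P e (vl P (e , zero , zero))
    to-first (zero , t) = cong (EdgeOp.mergeV P e) (vl-key _ _ refl)
    to-first (suc zero , t) = trans (cong (EdgeOp.mergeV P e) (vl-key _ (suc zero , zero) refl)) (sym (merge-merges id (vl P (e , zero , zero)) (vl P (e , suc zero , zero))))

  mergeB-all : ∀ z w → EdgeOp.mergeB P e (bl P (e , z)) ≡ EdgeOp.mergeB P e (bl P (e , w))
  mergeB-all z w = trans (to-first z) (sym (to-first w))
    where
    to-first : ∀ z → EdgeOp.mergeB P e (bl P (e , z)) ≡ EdgeOp.mergeB P e (bl P (e , zero , zero))
    to-first z with key conns z in eq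
    ... | zero = cong (EdgeOp.mergeB P e) (bl-key z _ eq)
    ... | suc zero = trans (cong (EdgeOp.mergeB P e) (bl-key z (zero , suc zero) eq)) (sym (merge-merges id (bl P (e , zero , zero)) (bl P (e , zero , suc zero))))

  rvO-link : ∀ o z w → key (part vtx o) z ≡ key (part vtx o) w → rvO o (vl P (e , z)) ≡ rvO o (vl P (e , w))
  rvO-link del z w eq = vl-key z w eq
  rvO-link con z w eq = mergeV-all z w
  rvO-link penrose z w eq = mergeV-all z w
  rvO-link mdel z w eq = mergeV-all z w
  rvO-link mcon z w eq = mergeV-all z w

  rbO-link : ∀ o z w → key (part bdy o) z ≡ key (part bdy o) w → rbO o (bl P (e , z)) ≡ rbO o (bl P (e , w))
  rbO-link con z w eq = bl-key z w eq
  rbO-link del z w eq = mergeB-all z w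
  rbO-link penrose z w eq = mergeB-all z w
  rbO-link mdel z w eq = mergeB-all z w
  rbO-link mcon z w eq = mergeB-all z w

  module _ (o : Op) where
    open Surgery (allEnd (suc n)) _≟E_ (punch e) (gap P) removed (mate o) arc using (Geo; gap-step; μ-step)
    open SurgeryLabels (allEnd (suc n)) _≟E_ (punch e) (gap P) removed (mate o) arc (laws o) (vl P) (bl P) (rvO o) (rbO o) (empties P)

    v-geo : ∀ {x y} → Geo x y → rvO o (vl P x) ≡ rvO o (vl P y)
    v-geo (gap-step x) = cong (rvO o) (sym (vl-gap x))
    v-geo (μ-step {f , z} r) with refl ← removed⁻ {f , z} r =
      trans (rvO-link o z _ (mate-refines vtx o z)) (cong (rvO o ∘ vl P) (sym (mate-flipKey o e z)))

    b-geo : ∀ {x y} → Geo x y → rbO o (bl P x) ≡ rbO o (bl P y)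
    b-geo (gap-step x) = cong (rbO o) (sym (bl-gap x))
    b-geo (μ-step {f , z} r) with refl ← removed⁻ {f , z} r =
      trans (rbO-link o z _ (mate-refines bdy o z)) (cong (rbO o ∘ bl P) (sym (mate-flipKey o e z)))

    apply-WF : WF (apply o P e)
    apply-WF = subst WF (sym (apply-op o)) (result-WF
      (λ z → cong (rvO o) (vl-arc (punch e z))) (λ z → cong (rbO o) (bl-conn (punch e z))) v-geo b-geo)

    -- Instead of disappearing, the edge `e` keeps its endpoints, linked by `part κ o`. Links at
    -- different edges merely accumulate in a union, so the order in which edges are processed
    -- leaves no trace.
    apply-classes : ∀ κ (T : Rel (End n) 0ℓ) →
      classes κ (apply o P e) T ≃ classes κ P (EdgeLink (part κ o) e ∪ Image (punch e) T)
    apply-classes κ T = subst (λ P′ → classes κ P′ T ≃ classes κ P (EdgeLink (part κ o) e ∪ Image (punch e) T)) (sym (apply-op o)) (go κ)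
      where
      ker-V : ∀ o i j → rvO o (vlabel P i) ≡ rvO o (vlabel P j) → EqClosure (Gens (Base vtx P) (EdgeLink (part vtx o) e ∪ Image (punch e) T)) i j
      ker-V del i j eq = Closure.return (base eq)
      ker-V con = merge-ker _ (Closure.isEquivalence _) (vlabel P) id (λ i j eq → Closure.return (base eq)) refl refl (Closure.return (link (inj₁ (same refl))))
      ker-V penrose = merge-ker _ (Closure.isEquivalence _) (vlabel P) id (λ i j eq → Closure.return (base eq)) refl refl (Closure.return (link (inj₁ (same refl))))
      ker-V mdel = merge-ker _ (Closure.isEquivalence _) (vlabel P) id (λ i j eq → Closure.return (base eq)) refl refl (Closure.return (link (inj₁ (same refl))))
      ker-V mcon = merge-ker _ (Closure.isEquivalence _) (vlabel P) id (λ i j eq → Closure.return (base eq)) refl refl (Closure.return (link (inj₁ (same refl))))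
      ker-B : ∀ o i j → rbO o (blabel P i) ≡ rbO o (blabel P j) → EqClosure (Gens (Base bdy P) (EdgeLink (part bdy o) e ∪ Image (punch e) T)) i j
      ker-B con i j eq = Closure.return (base eq)
      ker-B del = merge-ker _ (Closure.isEquivalence _) (blabel P) id (λ i j eq → Closure.return (base eq)) refl refl (Closure.return (link (inj₁ (same refl))))
      ker-B penrose = merge-ker _ (Closure.isEquivalence _) (blabel P) id (λ i j eq → Closure.return (base eq)) refl refl (Closure.return (link (inj₁ (same refl))))
      ker-B mdel = merge-ker _ (Closure.isEquivalence _) (blabel P) id (λ i j eq → Closure.return (base eq)) refl refl (Closure.return (link (inj₁ (same refl))))
      ker-B mcon = merge-ker _ (Closure.isEquivalence _) (blabel P) id (λ i j eq → Closure.return (base eq)) refl refl (Closure.return (link (inj₁ (same refl))))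

      P′ : Pres n
      P′ = Surgery.result (allEnd (suc n)) _≟E_ (punch e) (gap P) removed (mate o) arc (vl P) (bl P) (rvO o) (rbO o) (empties P)

      go : ∀ κ → classes κ P′ T ≃ classes κ P (EdgeLink (part κ o) e ∪ Image (punch e) T)
      go cyc = gap-transfer (EdgeLink (part cyc o) e) T link⊆Geo μ⊆link
        where
        link⊆Geo : ∀ {x y} → EdgeLink (part cyc o) e x y → EqClosure Geo x y
        link⊆Geo (same {z} {w} eq) with key-fibre (part cyc o) (partG≢full o) z w eq
        ... | inj₁ refl = ε
        ... | inj₂ refl = subst (EqClosure Geo (e , z)) (mate-flipKey o e z) (Closure.return (μ-step (removed⁺ z)))
        μ⊆link : ∀ {x} → removed x ≡ true → EqClosure (EdgeLink (part cyc o) e) x (mate o x)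
        μ⊆link {f , z} r with refl ← removed⁻ {f , z} r =
          subst (EqClosure (EdgeLink (part cyc o) e) (e , z)) (sym (mate-flipKey o e z)) (Closure.return (same (mate-refines cyc o z)))
      go vtx = label-transfer (EdgeLink (part vtx o) e) T (vlabel P) (vlabel P′) (rvO o) vlabel-up v-geo
        (λ { (same eq) → rvO-link o _ _ eq }) (ker-V o)
      go bdy = label-transfer (EdgeLink (part bdy o) e) T (blabel P) (blabel P′) (rbO o) blabel-up b-geo
        (λ { (same eq) → rbO-link o _ _ eq }) (ker-B o)

-- Counting classes and gluing

FinS : ℕ → Setoid 0ℓ 0ℓ
FinS n = setoid (Fin n)

same-count : {S : Setoid 0ℓ 0ℓ} {m n : ℕ} → S ≃ FinS m → S ≃ FinS n → m ≡ n
same-count p q = ↔⇒≡ (≃-trans (≃-sym p) q)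

⊎-count : {S T : Setoid 0ℓ 0ℓ} {m n : ℕ} → S ≃ FinS m → T ≃ FinS n → (S ⊎ₛ T) ≃ FinS (m ℕ.+ n)
⊎-count {m = m} p q = ≃-trans (p ⊎-inverse q) (≃-trans (Pointwise-≡↔≡ _ _) (≃-sym (Fin.+↔⊎ {m})))

enumerate : (S D : Setoid 0ℓ 0ℓ) (f : Setoid.Carrier S → Setoid.Carrier D) →
  (∀ {i j} → Setoid._≈_ S i j → Setoid._≈_ D (f i) (f j)) → (∀ {i j} → Setoid._≈_ D (f i) (f j) → Setoid._≈_ S i j) →
  (ys : List (Setoid.Carrier D)) → AllPairs (λ x y → ¬ Setoid._≈_ D x y) ys → (∀ i → Any (Setoid._≈_ D (f i)) ys) →
  (∀ {y} → y ∈ ys → Σ (Setoid.Carrier S) λ i → Setoid._≈_ D (f i) y) → S ≃ FinS (length ys)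
enumerate S D f f-cong f-inj ys u hit pre = mk≃ to from
    (λ {i} {j} ij → distinct (DS.trans (DS.sym (Any.lookup-index (hit i))) (DS.trans (f-cong ij) (Any.lookup-index (hit j)))))
    (λ { refl → Setoid.refl S })
    (λ k → distinct (DS.trans (DS.sym (Any.lookup-index (hit (from k)))) (proj₂ (pre (∈-lookup k)))))
    (λ i → f-inj (DS.trans (proj₂ (pre (∈-lookup (to i)))) (DS.sym (Any.lookup-index (hit i)))))
  where
  module DS = Setoid D
  to : Setoid.Carrier S → Fin (length ys)
  to i = Any.index (hit i)
  from : Fin (length ys) → Setoid.Carrier S
  from k = proj₁ (pre (∈-lookup k))
  distinct : ∀ {k l} → DS._≈_ (lookup ys k) (lookup ys l) → k ≡ l
  distinct {k} {l} eq = AllPairs-lookup u k l (λ n → n eq) (λ n → n (DS.sym eq))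

size : Kind → ∀ {m} → Pres m → ℕ
size cyc = nVert
size vtx = nVblocks
size bdy = nBblocks

N : Kind → ∀ {m} → Pres m → Vec Op m → ℕ
N κ P [] = size κ P
N κ P (o ∷ s) = N κ (apply o P zero) s

Gens-map : {E D : Set} {B : Rel (E ⊎ D) 0ℓ} {T T′ : Rel E 0ℓ} → (∀ {x y} → T x y → T′ x y) →
  ∀ {i j} → Gens B T i j → Gens B T′ i j
Gens-map h (base b) = base b
Gens-map h (link t) = link (h t)

classes-cong : ∀ κ {m} (P : Pres m) {T T′ : Rel (End m) 0ℓ} → (∀ {x y} → T x y → T′ x y) → (∀ {x y} → T′ x y → T x y) →
  classes κ P T ≃ classes κ P T′
classes-cong κ P h h′ = closure-≃ id id (λ g → Closure.return (Gens-map h g)) (λ g → Closure.return (Gens-map h′ g)) (λ _ → ε) (λ _ → ε)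

label-count : {T : Rel (End 0) 0ℓ} (es : List (ℕ × ℕ)) (l : End 0 → ℕ) (π : ℕ × ℕ → ℕ) →
  ⟨ Gens (Equal (labels es l π)) T ⟩ ≃ FinS (ndistinct (map π es))
label-count {T} es l π = enumerate _ (setoid ℕ) (labels es l π) (extend (setoid ℕ) (labels es l π) compat) (λ eq → Closure.return (base eq))
    (deduplicate ℕ._≟_ (map π es)) (DecUnique.deduplicate-! ℕ._≟_ (map π es)) hit pre
  where
  compat : ∀ {i j} → Gens (Equal (labels es l π)) T i j → labels es l π i ≡ labels es l π j
  compat (base eq) = eq
  compat (link {() , _} _)
  hit : ∀ i → labels es l π i ∈ deduplicate ℕ._≟_ (map π es)
  hit (inj₁ (() , _))
  hit (inj₂ a) = ∈-deduplicate⁺ ℕ._≟_ (∈-map⁺ π (∈-lookup a))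
  pre : ∀ {y} → y ∈ deduplicate ℕ._≟_ (map π es) → Σ (End 0 ⊎ Fin (length es)) λ i → labels es l π i ≡ y
  pre y∈ with x , x∈ , refl ← ∈-map⁻ π (∈-deduplicate⁻ ℕ._≟_ (map π es) y∈) = inj₂ (Any.index x∈) , cong π (sym (Any.lookup-index x∈))

-- `N` operates on edge `zero` again and again. Trading each operation for its links turns the
-- result into the number of classes of one relation on `P`, in which all edges play symmetric
-- parts.
classes-count : ∀ {m} (P : Pres m) → WF P → ∀ κ s → classes κ P (Link κ s) ≃ FinS (N κ P s)
classes-count P wf cyc [] = mk≃ to inj₂ (extend (FinS _) to compat) (λ { refl → ε }) (λ _ → refl) (λ { (inj₁ (() , _)) ; (inj₂ a) → ε })
  where
  to : Pt P → Fin (length (empties P))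
  to (inj₂ a) = a
  compat : ∀ {i j} → Gens (Base cyc P) (Link cyc []) i j → to i ≡ to j
  compat (base (gap-rel (() , _)))
  compat (link {() , _} _)
classes-count P wf vtx [] = label-count (empties P) (vl P) proj₁
classes-count P wf bdy [] = label-count (empties P) (bl P) proj₂
classes-count P wf κ (o ∷ s) = ≃-trans (classes-cong κ P split unsplit)
    (≃-trans (≃-sym (apply-classes P wf zero o κ (Link κ s))) (classes-count (apply o P zero) (apply-WF P wf zero o) κ s))
  where
  split : ∀ {x y} → Link κ (o ∷ s) x y → (EdgeLink (part κ o) zero ∪ Image (punch zero) (Link κ s)) x y
  split (same {zero} eq) = inj₁ (same eq)
  split (same {suc f} eq) = inj₂ (image (same eq))
  unsplit : ∀ {x y} → (EdgeLink (part κ o) zero ∪ Image (punch zero) (Link κ s)) x y → Link κ (o ∷ s) x y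
  unsplit (inj₁ (same eq)) = same eq
  unsplit (inj₂ (image (same eq))) = same eq

-- Deciding a generated equivalence on a finite set

module Decide {I : Set} (xs : List I) (complete : ∀ i → i ∈ xs) where
  code : I → ℕ
  code i = toℕ (Any.index (complete i))

  code-inj : ∀ i j → code i ≡ code j → i ≡ j
  code-inj i j eq = trans (Any.lookup-index (complete i)) (trans (cong (lookup xs) (Fin.toℕ-injective eq)) (sym (Any.lookup-index (complete j))))

  -- Union-find by relabelling: from distinct codes, the pairs are merged one at a time, and
  -- `merge-ker` bounds what this identifies.
  quotient : (ps : List (I × I)) → Σ (ℕ → ℕ) λ r →
    (∀ i j → r (code i) ≡ r (code j) → EqClosure (λ i j → (i , j) ∈ ps) i j) ×
    (∀ {i j} → (i , j) ∈ ps → r (code i) ≡ r (code j))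
  quotient [] = id , (λ i j eq → subst (EqClosure _ i) (code-inj i j eq) ε) , λ ()
  quotient ((x , y) ∷ ps) with r , ker , compat ← quotient ps =
    merge r (code x) (code y) ,
    merge-ker _ (Closure.isEquivalence _) code r (λ i j eq → Closure.map there (ker i j eq)) refl refl (Closure.return (here refl)) ,
    λ { (here refl) → merge-merges r (code x) (code y) ; (there p) → merge-cong r (code x) (code y) (compat p) }

  closure? : {R : Rel I 0ℓ} → (∀ i j → Dec (R i j)) → ∀ i j → Dec (EqClosure R i j)
  closure? {R} R? i j with r , ker , compat ← quotient (filter (λ p → R? (proj₁ p) (proj₂ p)) (cartesianProduct xs xs))
    with r (code i) ℕ.≟ r (code j)
  ... | yes eq = yes (Closure.map (λ p → proj₂ (∈-filter⁻ (λ p → R? (proj₁ p) (proj₂ p)) {xs = cartesianProduct xs xs} p)) (ker i j eq))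
  ... | no ne = no (λ p → ne (extend (setoid ℕ) (r ∘ code)
          (λ s → compat (∈-filter⁺ (λ p → R? (proj₁ p) (proj₂ p)) (∈-cartesianProduct⁺ (complete _) (complete _)) s)) p))

-- Gluing two relations along a set of terminals

data GlueRel {A B Z : Set} (RA : Rel A 0ℓ) (RB : Rel B 0ℓ) (p : Z → A) (q : Z → B) : Rel (A ⊎ B) 0ℓ where
  left  : ∀ {a b} → RA a b → GlueRel RA RB p q (inj₁ a) (inj₁ b)
  right : ∀ {a b} → RB a b → GlueRel RA RB p q (inj₂ a) (inj₂ b)
  seam  : ∀ z → GlueRel RA RB p q (inj₁ (p z)) (inj₂ (q z))

data KeyRel {A Z : Set} (p : Z → A) (k : Z → Fin 2) : Rel A 0ℓ where
  key-rel : ∀ {z w} → k z ≡ k w → KeyRel p k (p z) (p w)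

Near Far : {B Z : Set} (RB : Rel B 0ℓ) (q : Z → B) → B → Set
Near RB q b = Σ _ λ z → EqClosure RB b (q z)
Far RB q b = ¬ Near RB q b

FarS : {B Z : Set} (RB : Rel B 0ℓ) (q : Z → B) → Setoid 0ℓ 0ℓ
FarS {B} RB q = On.setoid ⟨ RB ⟩ (proj₁ {B = Far RB q})

module _ {B : Set} (RB : Rel B 0ℓ) (RB? : ∀ b c → Dec (EqClosure RB b c)) (xs : List B) (complete : ∀ b → b ∈ xs) (q : Term → B) where
  near? : ∀ b → Dec (Near RB q b)
  near? b with Fin.any? (λ i → Fin.any? (λ t → RB? b (q (i , t))))
  ... | yes (i , t , p) = yes ((i , t) , p)
  ... | no n = no (λ { ((i , t) , p) → n (i , t , p) })

  far? : ∀ b → Dec (Far RB q b)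
  far? b with near? b
  ... | yes p = no (λ n → n p)
  ... | no n = yes n

  private
    decS : DecSetoid 0ℓ 0ℓ
    decS = record { isDecEquivalence = record { isEquivalence = Closure.isEquivalence RB ; _≟_ = RB? } }

  farCount : ℕ
  farCount = length (deduplicate RB? (filter far? xs))

  far-count : FarS RB q ≃ FinS farCount
  far-count = enumerate (FarS RB q) ⟨ RB ⟩ proj₁ id id (deduplicate RB? (filter far? xs)) (DecSetoidUnique.deduplicate-! decS (filter far? xs)) hit pre
    where
    hit : (i : Σ B (Far RB q)) → Any (EqClosure RB (proj₁ i)) (deduplicate RB? (filter far? xs))
    hit (b , f) = Any.deduplicate⁺ RB? (λ yx bx → bx ◅◅ closure-sym yx) (lose (∈-filter⁺ far? (complete b) f) ε)
    pre : ∀ {y} → y ∈ deduplicate RB? (filter far? xs) → Σ (Σ B (Far RB q)) λ i → EqClosure RB (proj₁ i) y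
    pre {y} y∈ = (y , proj₂ (∈-filter⁻ far? {xs = xs} (∈-deduplicate⁻ RB? (filter far? xs) y∈))) , ε

module _ {A B Z : Set} (RA : Rel A 0ℓ) (RB : Rel B 0ℓ) (p : Z → A) (q : Z → B) (k : Z → Fin 2)
         (q-key : ∀ z w → EqClosure RB (q z) (q w) → k z ≡ k w) (key-q : ∀ z w → k z ≡ k w → EqClosure RB (q z) (q w))
         (near? : ∀ b → Dec (Near RB q b)) where
  private
    Cut : Setoid 0ℓ 0ℓ
    Cut = ⟨ RA ∪ KeyRel p k ⟩ ⊎ₛ FarS RB q

  cut : A ⊎ B → A ⊎ Σ B (Far RB q)
  cut (inj₁ a) = inj₁ a
  cut (inj₂ b) with near? b
  ... | yes (z , _) = inj₁ (p z)
  ... | no far = inj₂ (b , far)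

  paste : A ⊎ Σ B (Far RB q) → A ⊎ B
  paste = Sum.map₂ proj₁

  -- A class of `B` meeting the seam is absorbed into `A` at any terminal it contains; its only
  -- effect is to relate terminals with the same `k`. A class avoiding the seam survives unchanged.
  -- So the gluing depends on `B` only through `k` and the far classes.
  glue-≃ : ⟨ GlueRel RA RB p q ⟩ ≃ Cut
  glue-≃ = mk≃ cut paste (extend Cut cut cut-ok) paste-ok cut-paste paste-cut
    where
    cut-ok : ∀ {i j} → GlueRel RA RB p q i j → Setoid._≈_ Cut (cut i) (cut j)
    cut-ok (left s) = inj₁ (Closure.return (inj₁ s))
    cut-ok (right {b} {c} s) with near? b | near? c
    ... | yes (z , bz) | yes (w , cw) = inj₁ (Closure.return (inj₂ (key-rel (q-key z w (closure-sym bz ◅◅ fwd s ◅ cw)))))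
    ... | yes (z , bz) | no far = ⊥-elim (far (z , bwd s ◅ bz))
    ... | no far | yes (w , cw) = ⊥-elim (far (w , fwd s ◅ cw))
    ... | no far | no far′ = inj₂ (Closure.return s)
    cut-ok (seam z) with near? (q z)
    ... | yes (w , zw) = inj₁ (Closure.return (inj₂ (key-rel (q-key z w zw))))
    ... | no far = ⊥-elim (far (z , ε))
    key-ok : ∀ {a b} → (RA ∪ KeyRel p k) a b → EqClosure (GlueRel RA RB p q) (inj₁ a) (inj₁ b)
    key-ok (inj₁ s) = Closure.return (left s)
    key-ok (inj₂ (key-rel {z} {w} eq)) = fwd (seam z) ◅ Closure.gmap inj₂ right (key-q z w eq) ◅◅ Closure.symmetric _ (Closure.return (seam w))
    paste-ok : ∀ {i j} → Setoid._≈_ Cut i j → EqClosure (GlueRel RA RB p q) (paste i) (paste j)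
    paste-ok (inj₁ s) = extend ⟨ GlueRel RA RB p q ⟩ inj₁ key-ok s
    paste-ok (inj₂ s) = Closure.gmap inj₂ right s
    cut-paste : ∀ i → Setoid._≈_ Cut (cut (paste i)) i
    cut-paste (inj₁ a) = inj₁ ε
    cut-paste (inj₂ (b , far)) with near? b
    ... | yes near = ⊥-elim (far near)
    ... | no _ = inj₂ ε
    paste-cut : ∀ i → EqClosure (GlueRel RA RB p q) (paste (cut i)) i
    paste-cut (inj₁ a) = ε
    paste-cut (inj₂ b) with near? b
    ... | yes (z , bz) = fwd (seam z) ◅ Closure.gmap inj₂ right (closure-sym bz)
    ... | no _ = ε

-- The part of H away from e, seen from the endpoints of e

image? : {A B : Set} (f : A → B) → (∀ {x y} → f x ≡ f y → x ≡ y) → (∀ b → Dec (Σ A λ a → f a ≡ b)) →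
  {T : Rel A 0ℓ} → (∀ x y → Dec (T x y)) → ∀ b c → Dec (Image f T b c)
image? f f-inj pre {T} T? b c with pre b | pre c
... | no n | _ = no (λ { (image {x} {y} t) → n (x , refl) })
... | yes _ | no n = no (λ { (image {x} {y} t) → n (y , refl) })
... | yes (x , refl) | yes (y , refl) with T? x y
... | yes t = yes (image t)
... | no n = no (λ i → n (unimage i refl refl))
  where
  unimage : ∀ {b c} → Image f T b c → b ≡ f x → c ≡ f y → T x y
  unimage (image t) eq eq′ = subst₂ T (f-inj eq) (f-inj eq′) t

Link? : ∀ κ {m} (s : Vec Op m) x y → Dec (Link κ s x y)
Link? κ s (f , z) (g , w) with f Fin.≟ g
... | no n = no (λ { (same _) → n refl })
... | yes refl with key (part κ (Vec.lookup s f)) z Fin.≟ key (part κ (Vec.lookup s f)) w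
... | yes eq = yes (same eq)
... | no n = no (λ { (same eq) → n eq })

Base? : ∀ κ {m} (P : Pres m) i j → Dec (Base κ P i j)
Base? vtx P i j = vlabel P i ℕ.≟ vlabel P j
Base? bdy P i j = blabel P i ℕ.≟ blabel P j
Base? cyc P (inj₁ x) (inj₁ y) with gap P x ≟E y
... | yes refl = yes (gap-rel x)
... | no n = no (λ { (gap-rel _) → n refl })
Base? cyc P (inj₁ x) (inj₂ b) = no (λ ())
Base? cyc P (inj₂ a) j = no (λ ())

Gens? : {E D : Set} {B : Rel (E ⊎ D) 0ℓ} {T : Rel E 0ℓ} → (∀ i j → Dec (B i j)) → (∀ x y → Dec (T x y)) →
  ∀ i j → Dec (Gens B T i j)
Gens? B? T? i j with B? i j
... | yes b = yes (base b)
Gens? B? T? (inj₁ x) (inj₁ y) | no n with T? x y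
... | yes t = yes (link t)
... | no n′ = no (λ { (base b) → n b ; (link t) → n′ t })
Gens? B? T? (inj₁ x) (inj₂ b) | no n = no (λ { (base b) → n b })
Gens? B? T? (inj₂ a) j | no n = no (λ { (base b) → n b })

points : ∀ {m} (P : Pres m) → List (Pt P)
points {m} P = map inj₁ (allEnd m) ++ map inj₂ (allFin (length (empties P)))

∈-points : ∀ {m} (P : Pres m) (i : Pt P) → i ∈ points P
∈-points P (inj₁ x) = ∈-++⁺ˡ (∈-map⁺ inj₁ (∈-allEnd x))
∈-points {m} P (inj₂ a) = ∈-++⁺ʳ (map inj₁ (allEnd m)) (∈-map⁺ inj₂ (∈-allFin a))

punch-inj : ∀ {n} (e : Fin (suc n)) {x y : End n} → punch e x ≡ punch e y → x ≡ y
punch-inj e eq = cong₂ _,_ (Fin.punchIn-injective e _ _ (cong proj₁ eq)) (cong proj₂ eq)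

punch-pre : ∀ {n} (e : Fin (suc n)) (y : End (suc n)) → Dec (Σ (End n) λ x → punch e x ≡ y)
punch-pre e (f , z) with e Fin.≟ f
... | yes refl = no (λ { ((g , w) , eq) → Fin.punchInᵢ≢i e g (cong proj₁ eq) })
... | no ne = yes ((Fin.punchOut ne , z) , cong (_, z) (Fin.punchIn-punchOut ne))

same-key? : ∀ p z w → Dec (key p z ≡ key p w)
same-key? p z w = key p z Fin.≟ key p w

first : Term
first = zero , zero

-- Four points have three perfect matchings, told apart by the partner of `first`. For any point
-- outside that first pair, three of the four candidates for its partner are excluded.
matching : (h : Term → Term) → (∀ z → h (h z) ≡ z) → (∀ z → h z ≢ z) →
  Σ Part λ p → p ≢ full × (∀ z → h z ≡ flipKey p z)
matching h invol nofix = shape (h first) refl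
  where
  fourth : ∀ p (a b : Term) → Set
  fourth p z w = z ≢ first → z ≢ flipKey p first → w ≢ z → w ≢ first → w ≢ flipKey p first → w ≡ flipKey p z
  fourth? : ∀ p → Dec (∀ z w → fourth p z w)
  fourth? p = ∀T? λ z → ∀T? λ w → ¬? (z ≟T first) →-dec (¬? (z ≟T flipKey p first) →-dec (¬? (w ≟T z) →-dec
    (¬? (w ≟T first) →-dec (¬? (w ≟T flipKey p first) →-dec (w ≟T flipKey p z)))))
  determined : ∀ p → (∀ z w → fourth p z w) → (∀ z → flipKey p (flipKey p z) ≡ z) → h first ≡ flipKey p first → ∀ z → h z ≡ flipKey p z
  determined p last flips eq z with z ≟T first
  ... | yes refl = eq
  ... | no n with z ≟T flipKey p first
  ... | yes refl = trans (trans (cong h (sym eq)) (invol first)) (sym (flips first))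
  ... | no n′ = last z (h z) n n′ (nofix z) (λ hz → n′ (trans (sym (invol z)) (trans (cong h hz) eq)))
                  (λ hz → n (trans (sym (invol z)) (trans (cong h (trans hz (sym eq))) (invol first))))
  flips : ∀ p z → flipKey p (flipKey p z) ≡ z
  flips arcs (i , t) = cong (i ,_) (flip2-flip2 t)
  flips conns (i , t) = cong₂ _,_ (flip2-flip2 i) (flip2-flip2 t)
  flips pens (i , t) = cong (_, t) (flip2-flip2 i)
  flips full z = refl
  shape : ∀ w → h first ≡ w → Σ Part λ p → p ≢ full × (∀ z → h z ≡ flipKey p z)
  shape (zero , zero) eq = ⊥-elim (nofix first eq)
  shape (zero , suc zero) eq = arcs , (λ ()) , determined arcs (toWitness {a? = fourth? arcs} tt) (flips arcs) eq
  shape (suc zero , zero) eq = pens , (λ ()) , determined pens (toWitness {a? = fourth? pens} tt) (flips pens) eq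
  shape (suc zero , suc zero) eq = conns , (λ ()) , determined conns (toWitness {a? = fourth? conns} tt) (flips conns) eq

only-edge : (x : End 1) → x ≡ (zero , proj₂ x)
only-edge (zero , z) = refl

matching-End1 : (g : End 1 → End 1) → (∀ z → g (g z) ≡ z) → (∀ z → g z ≢ z) →
  Σ Part λ p → p ≢ full × (∀ z → g (zero , z) ≡ (zero , flipKey p z))
matching-End1 g invol nofix with p , p≢full , eq ← matching (λ z → proj₂ (g (zero , z)))
    (λ z → cong proj₂ (trans (cong g (sym (only-edge (g (zero , z))))) (invol (zero , z))))
    (λ z eq → nofix (zero , z) (trans (only-edge (g (zero , z))) (cong (zero ,_) eq))) =
  p , p≢full , λ z → trans (only-edge (g (zero , z))) (cong (zero ,_) (eq z))

Describes : Part → Rel Term 0ℓ → Set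
Describes p R = (∀ z w → R z w → key p z ≡ key p w) × (∀ z w → key p z ≡ key p w → R z w)

full-describes : ∀ {R} → (∀ z w → R z w) → Describes full R
full-describes all = (λ _ _ _ → refl) , (λ z w _ → all z w)

module _ {R : Rel Term 0ℓ} (eqv : IsEquivalence R) where
  private module Eq = IsEquivalence eqv

  -- With only two blocks in `p`, no partition lies strictly between it and the trivial one, so a
  -- single pair across the blocks decides between this lemma and `finer`.
  coarser : ∀ p {z₀ z₁} → key p z₀ ≡ zero → key p z₁ ≡ suc zero → (∀ z w → key p z ≡ key p w → R z w) →
    R z₀ z₁ → ∀ z w → R z w
  coarser p {z₀} {z₁} k₀ k₁ fine r z w = Eq.trans (to-z₀ z) (Eq.sym (to-z₀ w))
    where
    to-z₀ : ∀ z → R z z₀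
    to-z₀ z with key p z in eq
    ... | zero = fine z z₀ (trans eq (sym k₀))
    ... | suc zero = Eq.trans (fine z z₁ (trans eq (sym k₁))) (Eq.sym r)

  finer : ∀ p {z₀ z₁} → key p z₀ ≡ zero → key p z₁ ≡ suc zero → (∀ z w → key p z ≡ key p w → R z w) →
    ¬ R z₀ z₁ → ∀ z w → R z w → key p z ≡ key p w
  finer p {z₀} {z₁} k₀ k₁ fine n z w r with key p z in ez | key p w in ew
  ... | zero | zero = refl
  ... | suc zero | suc zero = refl
  ... | zero | suc zero = ⊥-elim (n (Eq.trans (fine z₀ z (trans k₀ (sym ez))) (Eq.trans r (fine w z₁ (trans ew (sym k₁))))))
  ... | suc zero | zero = ⊥-elim (n (Eq.trans (fine z₀ w (trans k₀ (sym ew))) (Eq.trans (Eq.sym r) (fine z z₁ (trans ez (sym k₁))))))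

-- The type of a state of `H` away from `e`

module Outside {k} (H : Pres (suc k)) (wf : WF H) (e : Fin (suc k)) (t : Vec Op k) where
  open WF wf

  -- The state links endpoints at every edge but `e`, whose four endpoints stay free as terminals
  -- for whatever is glued on.
  Rest : Kind → Rel (Pt H) 0ℓ
  Rest κ = Gens (Base κ H) (Image (punch e) (Link κ t))

  terminal : Term → Pt H
  terminal z = inj₁ (e , z)

  Rest? : ∀ κ i j → Dec (EqClosure (Rest κ) i j)
  Rest? κ = Decide.closure? (points H) (∈-points H) (Gens? (Base? κ H) (image? (punch e) (punch-inj e) (punch-pre e) (Link? κ t)))

  private
    opAt : Fin (suc k) → Op
    opAt f with e Fin.≟ f
    ... | yes _ = del
    ... | no ne = Vec.lookup t (Fin.punchOut ne)

    opAt-punchIn : ∀ g → opAt (punchIn e g) ≡ Vec.lookup t g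
    opAt-punchIn g with e Fin.≟ punchIn e g
    ... | yes eq = contradiction (sym eq) (Fin.punchInᵢ≢i e g)
    ... | no ne = cong (Vec.lookup t) (trans (Fin.punchOut-cong e refl) (Fin.punchOut-punchIn e))

    -- A surgery the other way round: every edge except `e` is excised, each with the identification
    -- prescribed by its own operation. A single edge remains, and its gap matching shows how the
    -- circles of the state join the four endpoints.
    emb : End 1 → End (suc k)
    emb (_ , z) = e , z

    rem : End (suc k) → Bool
    rem (f , _) = not ⌊ e Fin.≟ f ⌋

    μ : End (suc k) → End (suc k)
    μ (f , z) = f , flipKey (part cyc (opAt f)) z

    μ-mate : ∀ x → mate (opAt (proj₁ x)) x ≡ μ x
    μ-mate (f , z) = mate-flipKey (opAt f) f z

    laws′ : Surgery.Laws (allEnd (suc k)) _≟E_ emb (gap H) rem μ arc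
    laws′ = record
      { complete = ∈-allEnd ; gap-invol = gap-invol ; gap-nofix = gap-nofix
      ; μ-rem = id
      ; μ-invol = λ {x} _ → trans (sym (μ-mate (μ x))) (trans (cong (mate (opAt (proj₁ x))) (sym (μ-mate x))) (mate-invol (opAt (proj₁ x)) x))
      ; μ-nofix = λ {x} _ eq → mate-nofix (opAt (proj₁ x)) x (trans (μ-mate x) eq)
      ; emb-inj = λ { {zero , z} {zero , w} refl → refl }
      ; emb-rem = λ _ → emb-kept
      ; emb-surj = λ {x} r → (zero , proj₂ x) , cong (_, proj₂ x) (kept⁻ r)
      }
      where
      emb-kept : not ⌊ e Fin.≟ e ⌋ ≡ false
      emb-kept with e Fin.≟ e
      ... | yes _ = refl
      ... | no ne = contradiction refl ne
      kept⁻ : ∀ {f} → not ⌊ e Fin.≟ f ⌋ ≡ false → e ≡ f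
      kept⁻ {f} h with e Fin.≟ f
      ... | yes eq = eq

    open Surgery (allEnd (suc k)) _≟E_ emb (gap H) rem μ arc
    open WithLaws laws′ using (gap′-invol; gap′-nofix; gap′-Geo; ρ-Geo; ρ; ρ-ι)

    shape : Σ Part λ p → p ≢ full × (∀ z → gap′ (zero , z) ≡ (zero , flipKey p z))
    shape = matching-End1 gap′ gap′-invol gap′-nofix

    Geo⇒Rest : ∀ {x y} → Geo x y → EqClosure (Rest cyc) (inj₁ x) (inj₁ y)
    Geo⇒Rest (gap-step x) = Closure.return (base (gap-rel x))
    Geo⇒Rest (μ-step {f , z} r) with punch-pre e (f , z)
    ... | yes ((g , z) , refl) = Closure.return (link (image (same (trans (key-flip (part cyc (Vec.lookup t g)) z)
            (cong (λ o → key (part cyc (Vec.lookup t g)) (flipKey (part cyc o) z)) (sym (opAt-punchIn g)))))))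
    ... | no n with e Fin.≟ f
    ... | no ne = ⊥-elim (n ((Fin.punchOut ne , z) , cong (_, z) (Fin.punchIn-punchOut ne)))

    removed-punch : ∀ g → not ⌊ e Fin.≟ punchIn e g ⌋ ≡ true
    removed-punch g with e Fin.≟ punchIn e g
    ... | yes eq = contradiction (sym eq) (Fin.punchInᵢ≢i e g)
    ... | no _ = refl

    Rest⇒Geo : ∀ {x y} → EqClosure (Rest cyc) (inj₁ x) (inj₁ y) → EqClosure Geo x y
    Rest⇒Geo p = drop-inj₁ (extend (⟨ Geo ⟩ ⊎ₛ setoid (Fin (length (empties H)))) id respects p)
      where
      respects : ∀ {i j} → Rest cyc i j → Pointwise (EqClosure Geo) _≡_ i j
      respects (base (gap-rel x)) = inj₁ (Closure.return (gap-step x))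
      respects (link (image (same {g} {z} {w} eq))) with key-fibre (part cyc (Vec.lookup t g)) (partG≢full (Vec.lookup t g)) z w eq
      ... | inj₁ refl = inj₁ ε
      ... | inj₂ refl = inj₁ (subst (λ o → EqClosure Geo (punchIn e g , z) (punchIn e g , flipKey (part cyc o) z)) (opAt-punchIn g)
                          (Closure.return (μ-step {x = punchIn e g , z} (removed-punch g))))

    On-terminals : Kind → Rel Term 0ℓ
    On-terminals κ z w = EqClosure (Rest κ) (terminal z) (terminal w)

    equivalence : ∀ κ → IsEquivalence (On-terminals κ)
    equivalence κ = On.isEquivalence terminal (Closure.isEquivalence (Rest κ))

    -- Excision preserves connectivity in both directions: `ρ` carries paths in `H` to the
    -- presentation with the single edge, and `gap′-Geo` realises each of its gaps by a path in `H`.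
    cyc-describes : ∀ p → p ≢ full → (∀ z → gap′ (zero , z) ≡ (zero , flipKey p z)) → Describes p (On-terminals cyc)
    cyc-describes p p≢full hp = to , from
      where
      to : ∀ z w → On-terminals cyc z w → key p z ≡ key p w
      to z w r = extend (setoid (Fin 2)) keyOf gap′-key (subst₂ (EqClosure Gap′) (ρ-ι (inj₁ (zero , z))) (ρ-ι (inj₁ (zero , w)))
          (extend ⟨ Gap′ ⟩ ρ ρ-Geo (Rest⇒Geo r)))
        where
        keyOf : ∀ {K : Set} → End 1 ⊎ K → Fin 2
        keyOf (inj₁ (_ , z)) = key p z
        keyOf (inj₂ _) = zero
        gap′-key : ∀ {K : Set} {i j : End 1 ⊎ K} → Gap′ i j → keyOf i ≡ keyOf j
        gap′-key (gap-step′ (zero , z)) = trans (key-flip p z) (cong (key p ∘ proj₂) (sym (hp z)))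
      from : ∀ z w → key p z ≡ key p w → On-terminals cyc z w
      from z w eq with key-fibre p p≢full z w eq
      ... | inj₁ refl = ε
      ... | inj₂ refl = subst (λ x → EqClosure (Rest cyc) (terminal z) (terminal (proj₂ x))) (hp z)
                          (extend ⟨ Rest cyc ⟩ inj₁ Geo⇒Rest (gap′-Geo (zero , z)))

    -- Labels are constant along gaps, and the partition of an operation contains its matching for
    -- each kind. This inclusion is what restricts the combinations of partitions to five.
    cyc⊆ : ∀ κ {i j} → EqClosure (Rest cyc) i j → EqClosure (Rest κ) i j
    cyc⊆ κ = extend ⟨ Rest κ ⟩ id (respects κ)
      where
      base-step : ∀ κ x → EqClosure (Rest κ) (inj₁ x) (inj₁ (gap H x))
      base-step cyc x = Closure.return (base (gap-rel x))
      base-step vtx x = Closure.return (base (sym (vl-gap x)))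
      base-step bdy x = Closure.return (base (sym (bl-gap x)))
      respects : ∀ κ {i j} → Rest cyc i j → EqClosure (Rest κ) i j
      respects κ (base (gap-rel x)) = base-step κ x
      respects κ (link (image (same {g} {z} {w} eq))) with key-fibre (part cyc (Vec.lookup t g)) (partG≢full (Vec.lookup t g)) z w eq
      ... | inj₁ refl = ε
      ... | inj₂ refl = Closure.return (link (image (same (mate-refines κ (Vec.lookup t g) z))))

    arcs⊆ : ∀ z w → key arcs z ≡ key arcs w → On-terminals vtx z w
    arcs⊆ z w eq = Closure.return (base (vl-key H wf e z w eq))

    conns⊆ : ∀ z w → key conns z ≡ key conns w → On-terminals bdy z w
    conns⊆ z w eq = Closure.return (base (bl-key H wf e z w eq))

  -- Seen from its terminals, `H` in the state `t` cannot be told from the operation `o`, for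
  -- circles and both kinds of blocks at once.
  Type : Op → Set
  Type o = ∀ κ → Describes (part κ o) (λ z w → EqClosure (Rest κ) (terminal z) (terminal w))

  private
    typed : ∀ o → Describes (part cyc o) (On-terminals cyc) → Describes (part vtx o) (On-terminals vtx) →
      Describes (part bdy o) (On-terminals bdy) → Type o
    typed o g v b cyc = g
    typed o g v b vtx = v
    typed o g v b bdy = b

    vtx-merged : ∀ {z₀ z₁} → key arcs z₀ ≡ zero → key arcs z₁ ≡ suc zero → On-terminals vtx z₀ z₁ → Describes full (On-terminals vtx)
    vtx-merged k₀ k₁ r = full-describes (coarser (equivalence vtx) arcs k₀ k₁ arcs⊆ r)

    bdy-merged : ∀ {z₀ z₁} → key conns z₀ ≡ zero → key conns z₁ ≡ suc zero → On-terminals bdy z₀ z₁ → Describes full (On-terminals bdy)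
    bdy-merged k₀ k₁ r = full-describes (coarser (equivalence bdy) conns k₀ k₁ conns⊆ r)

    -- The arrows are joined by circles and the connectors by labels of ℬ; together they connect all
    -- four endpoints. So the boundary blocks merge in any case, and only the vertex blocks leave an
    -- alternative.
    classify-arcs : Describes arcs (On-terminals cyc) → Dec (On-terminals vtx (zero , zero) (suc zero , zero)) → Σ Op Type
    classify-arcs d r? = split r?
      where
      merged = bdy-merged {zero , zero} {zero , suc zero} refl refl (cyc⊆ bdy (proj₂ d _ _ refl))
      split : Dec (On-terminals vtx (zero , zero) (suc zero , zero)) → Σ Op Type
      split (yes r) = mdel , typed mdel d (vtx-merged refl refl r) merged
      split (no n) = del , typed del d (finer (equivalence vtx) arcs refl refl arcs⊆ n , arcs⊆) merged

    classify-conns : Describes conns (On-terminals cyc) → Dec (On-terminals bdy (zero , zero) (zero , suc zero)) → Σ Op Type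
    classify-conns d r? = split r?
      where
      merged = vtx-merged {zero , zero} {suc zero , suc zero} refl refl (cyc⊆ vtx (proj₂ d _ _ refl))
      split : Dec (On-terminals bdy (zero , zero) (zero , suc zero)) → Σ Op Type
      split (yes r) = mcon , typed mcon d merged (bdy-merged refl refl r)
      split (no n) = con , typed con d merged (finer (equivalence bdy) conns refl refl conns⊆ n , conns⊆)

    classify : ∀ p → p ≢ full → Describes p (On-terminals cyc) → Σ Op Type
    classify full n d = ⊥-elim (n refl)
    classify arcs n d = classify-arcs d (Rest? vtx (terminal (zero , zero)) (terminal (suc zero , zero)))
    classify conns n d = classify-conns d (Rest? bdy (terminal (zero , zero)) (terminal (zero , suc zero)))
    classify pens n d = penrose , typed penrose d
      (vtx-merged {zero , zero} {suc zero , zero} refl refl (cyc⊆ vtx (proj₂ d _ _ refl)))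
      (bdy-merged {zero , zero} {suc zero , zero} refl refl (cyc⊆ bdy (proj₂ d _ _ refl)))

    classified : (Σ Part λ p → p ≢ full × (∀ z → gap′ (zero , z) ≡ (zero , flipKey p z))) → Σ Op Type
    classified (p , p≢full , hp) = classify p p≢full (cyc-describes p p≢full hp)

  opaque
    type : Op
    type = proj₁ (classified shape)

    type-describes : Type type
    type-describes = proj₂ (classified shape)

    far : Kind → ℕ
    far κ = farCount (Rest κ) (Rest? κ) (points H) (∈-points H) terminal

    far-classes : ∀ κ → FarS (Rest κ) terminal ≃ FinS (far κ)
    far-classes κ = far-count (Rest κ) (Rest? κ) (points H) (∈-points H) terminal

  near : ∀ κ b → Dec (Near (Rest κ) terminal b)
  near κ = near? (Rest κ) (Rest? κ) (points H) (∈-points H) terminal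

-- Joins of two partitions of the four endpoints: the exponents in the matrix

rank : Part → Part → ℕ
rank arcs arcs = 2
rank conns conns = 2
rank pens pens = 2
rank _ _ = 1

SameKey : Part → Rel Term 0ℓ
SameKey p z w = key p z ≡ key p w

module _ (p p′ : Part) where
  Join : Rel Term 0ℓ
  Join = SameKey p ∪ KeyRel id (key p′)

  join-one : (∀ z w → Σ Term λ u → key p z ≡ key p u × key p′ u ≡ key p′ w) → ⟨ Join ⟩ ≃ FinS 1
  join-one h = mk≃ (λ _ → zero) (λ _ → first) (λ _ → refl) (λ _ → ε) (λ { zero → refl }) (λ z → related first z)
    where
    related : ∀ z w → EqClosure Join z w
    related z w with u , zu , uw ← h z w = fwd (inj₁ zu) ◅ fwd (inj₂ (key-rel uw)) ◅ ε

join-two : ∀ p z₁ → key p first ≡ zero → key p z₁ ≡ suc zero → ⟨ Join p p ⟩ ≃ FinS 2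
join-two p z₁ k₀ k₁ = mk≃ (key p) from (extend (setoid (Fin 2)) (key p) compat) (λ { refl → ε }) key-from
    (λ z → Closure.return (inj₁ (key-from (key p z))))
  where
  from : Fin 2 → Term
  from zero = first
  from (suc _) = z₁
  key-from : ∀ i → key p (from i) ≡ i
  key-from zero = k₀
  key-from (suc zero) = k₁
  compat : ∀ {z w} → Join p p z w → key p z ≡ key p w
  compat (inj₁ eq) = eq
  compat (inj₂ (key-rel eq)) = eq

via? : ∀ p p′ → Dec (∀ z w → Σ (Fin 2) λ i → Σ (Fin 2) λ t → key p z ≡ key p (i , t) × key p′ (i , t) ≡ key p′ w)
via? p p′ = ∀T? λ z → ∀T? λ w → Fin.any? λ i → Fin.any? λ t → (key p z Fin.≟ key p (i , t)) ×-dec (key p′ (i , t) Fin.≟ key p′ w)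

via : ∀ p p′ → (∀ z w → Σ (Fin 2) λ i → Σ (Fin 2) λ t → key p z ≡ key p (i , t) × key p′ (i , t) ≡ key p′ w) →
  ∀ z w → Σ Term λ u → key p z ≡ key p u × key p′ u ≡ key p′ w
via p p′ h z w with i , t , eq ← h z w = (i , t) , eq

-- Two different matchings of four points form one cycle through all of them, so two classes remain
-- only when equal matchings meet.
join-count : ∀ p p′ → ⟨ Join p p′ ⟩ ≃ FinS (rank p p′)
join-count arcs arcs = join-two arcs (suc zero , zero) refl refl
join-count conns conns = join-two conns (zero , suc zero) refl refl
join-count pens pens = join-two pens (zero , suc zero) refl refl
join-count full p′ = join-one full p′ (λ z w → w , refl , refl)
join-count arcs full = join-one arcs full (λ z w → z , refl , refl)
join-count conns full = join-one conns full (λ z w → z , refl , refl)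
join-count pens full = join-one pens full (λ z w → z , refl , refl)
join-count arcs conns = join-one arcs conns (via arcs conns (toWitness {a? = via? arcs conns} tt))
join-count arcs pens = join-one arcs pens (via arcs pens (toWitness {a? = via? arcs pens} tt))
join-count conns arcs = join-one conns arcs (via conns arcs (toWitness {a? = via? conns arcs} tt))
join-count conns pens = join-one conns pens (via conns pens (toWitness {a? = via? conns pens} tt))
join-count pens arcs = join-one pens arcs (via pens arcs (toWitness {a? = via? pens arcs} tt))
join-count pens conns = join-one pens conns (via pens conns (toWitness {a? = via? pens conns} tt))

module ApplyCount {k} (H : Pres (suc k)) (wf : WF H) (e : Fin (suc k)) (t : Vec Op k) where
  open Outside H wf e t

  -- Linking endpoints at `e` amounts to gluing on a separate copy of them that carries the links,
  -- which is the form `glue-≃` expects.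
  reglue : ∀ κ o → classes κ H (EdgeLink (part κ o) e ∪ Image (punch e) (Link κ t)) ≃
    ⟨ GlueRel (SameKey (part κ o)) (Rest κ) id terminal ⟩
  reglue κ o = closure-≃ inj₂ from to-ok from-ok to-from (λ _ → ε)
    where
    R = GlueRel (SameKey (part κ o)) (Rest κ) id terminal
    L = Gens (Base κ H) (EdgeLink (part κ o) e ∪ Image (punch e) (Link κ t))
    from : Term ⊎ Pt H → Pt H
    from = Sum.[ terminal , id ]′
    to-ok : ∀ {i j} → L i j → EqClosure R (inj₂ i) (inj₂ j)
    to-ok (base b) = Closure.return (right (base b))
    to-ok (link (inj₁ (same {z} {w} eq))) = bwd (seam z) ◅ fwd (left eq) ◅ fwd (seam w) ◅ ε
    to-ok (link (inj₂ l)) = Closure.return (right (link l))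
    from-ok : ∀ {i j} → R i j → EqClosure L (from i) (from j)
    from-ok (left eq) = Closure.return (link (inj₁ (same eq)))
    from-ok (right g) = Closure.return (Gens-map inj₂ g)
    from-ok (seam z) = ε
    to-from : ∀ i → EqClosure R (inj₂ (from i)) i
    to-from (inj₁ z) = Closure.symmetric R (Closure.return (seam z))
    to-from (inj₂ i) = ε

  apply-count : ∀ κ o → N κ (apply o H e) t ≡ rank (part κ o) (part κ type) ℕ.+ far κ
  apply-count κ o = same-count (classes-count (apply o H e) (apply-WF H wf e o) κ t)
    (≃-trans (apply-classes H wf e o κ (Link κ t)) (≃-trans (reglue κ o)
      (≃-trans (glue-≃ (SameKey (part κ o)) (Rest κ) id terminal (key (part κ type)) (proj₁ (type-describes κ)) (proj₂ (type-describes κ)) (near κ))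
        (⊎-count (join-count (part κ o) (part κ type)) (far-classes κ)))))

-- The 2-sum

∨-elim : ∀ {a b} → a ∨ b ≡ true → a ≡ true ⊎ b ≡ true
∨-elim {true} h = inj₁ refl
∨-elim {false} h = inj₂ h

if-elim : {A : Set} {B : A → Set} (b : Bool) {x y : A} → (b ≡ true → B x) → (b ≡ false → B y) → B (if b then x else y)
if-elim true h h′ = h refl
if-elim false h h′ = h′ refl

merge-idle : ∀ r x y → r x ≡ r y → ∀ l → merge r x y l ≡ r l
merge-idle r x y eq l with r l ≡ᵇ r y in h
... | true = trans eq (sym (≡ᵇ-true h))
... | false = refl

flipArrow : Term → Term
flipArrow (i , t) = flip2 i , t

key-flipArrow : ∀ p z w → key p z ≡ key p w → key p (flipArrow z) ≡ key p (flipArrow w)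
key-flipArrow arcs = toWitness {a? = ∀T? λ z → ∀T? λ w → same-key? arcs z w →-dec same-key? arcs (flipArrow z) (flipArrow w)} tt
key-flipArrow conns = toWitness {a? = ∀T? λ z → ∀T? λ w → same-key? conns z w →-dec same-key? conns (flipArrow z) (flipArrow w)} tt
key-flipArrow pens = toWitness {a? = ∀T? λ z → ∀T? λ w → same-key? pens z w →-dec same-key? pens (flipArrow z) (flipArrow w)} tt
key-flipArrow full z w eq = refl

module CouplingFacts (φ : Coupling) where
  φt : Fin 2 → Fin 2
  φt = Bijection.to φ

  φt-cases : (∀ i → φt i ≡ i) ⊎ (∀ i → φt i ≡ flip2 i)
  φt-cases = cases (φt zero) (φt (suc zero)) refl refl
    where
    clash : φt zero ≢ φt (suc zero)
    clash eq with () ← Bijection.injective φ eq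
    cases : ∀ a b → φt zero ≡ a → φt (suc zero) ≡ b → (∀ i → φt i ≡ i) ⊎ (∀ i → φt i ≡ flip2 i)
    cases zero zero p q = ⊥-elim (clash (trans p (sym q)))
    cases zero (suc zero) p q = inj₁ (λ { zero → p ; (suc zero) → q })
    cases (suc zero) zero p q = inj₂ (λ { zero → p ; (suc zero) → q })
    cases (suc zero) (suc zero) p q = ⊥-elim (clash (trans p (sym q)))

  φinv : Fin 2 → Fin 2
  φinv j = if ⌊ φt zero Fin.≟ j ⌋ then zero else suc zero

  φinv-φt : ∀ i → φinv (φt i) ≡ i
  φinv-φt i with φt zero Fin.≟ φt i
  φinv-φt i | yes eq = Bijection.injective φ eq
  φinv-φt zero | no ne = ⊥-elim (ne refl)
  φinv-φt (suc zero) | no ne = refl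

  φt-φinv : ∀ j → φt (φinv j) ≡ j
  φt-φinv j with φt-cases
  ... | inj₁ h = trans (cong (φt ∘ φinv) (sym (h j))) (trans (cong φt (φinv-φt j)) (h j))
  ... | inj₂ h = trans (cong (φt ∘ φinv) (sym flipped)) (trans (cong φt (φinv-φt (flip2 j))) flipped)
    where
    flipped : φt (flip2 j) ≡ j
    flipped = trans (h (flip2 j)) (flip2-flip2 j)

  φT φT⁻¹ : Term → Term
  φT (i , t) = φt i , t
  φT⁻¹ (j , t) = φinv j , t

  -- A coupling sends tails to tails and heads to heads, so it is the identity or the exchange of
  -- the arrows, and the exchange permutes the blocks of each partition. This is why the couplings
  -- leave no trace in the polynomial.
  key-φT : ∀ p z w → key p z ≡ key p w → key p (φT z) ≡ key p (φT w)
  key-φT p z w eq with φt-cases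
  ... | inj₁ h rewrite h (proj₁ z) | h (proj₁ w) = eq
  ... | inj₂ h rewrite h (proj₁ z) | h (proj₁ w) = key-flipArrow p z w eq

  key-φT⁻¹ : ∀ p z w → key p z ≡ key p w → key p (φT⁻¹ z) ≡ key p (φT⁻¹ w)
  key-φT⁻¹ p z w eq with φt-cases
  ... | inj₁ h = subst₂ (λ i j → key p (i , proj₂ z) ≡ key p (j , proj₂ w)) (unchanged z) (unchanged w) eq
    where
    unchanged : ∀ z → proj₁ z ≡ φinv (proj₁ z)
    unchanged z = trans (sym (φinv-φt (proj₁ z))) (cong φinv (h (proj₁ z)))
  ... | inj₂ h = subst₂ (λ i j → key p (i , proj₂ z) ≡ key p (j , proj₂ w)) (flipped z) (flipped w) (key-flipArrow p z w eq)
    where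
    flipped : ∀ z → flip2 (proj₁ z) ≡ φinv (proj₁ z)
    flipped z = trans (sym (φinv-φt (flip2 (proj₁ z)))) (cong φinv (trans (h (flip2 (proj₁ z))) (flip2-flip2 (proj₁ z))))

module Sum2 {n k} (P : Pres (suc n)) (H : Pres (suc k)) (e : Fin (suc k)) (φ : Coupling) (wfP : WF P) (wfH : WF H) where
  module S = TwoSum P H e φ
  module WP = WF wfP
  module WH = WF wfH
  open CouplingFacts φ hiding (φt; φinv)

  tagEmptyP tagEmptyH : ℕ × ℕ → ℕ × ℕ
  tagEmptyP p = S.tagP (proj₁ p) , S.tagP (proj₂ p)
  tagEmptyH p = S.tagH (proj₁ p) , S.tagH (proj₂ p)

  old : List (ℕ × ℕ)
  old = map tagEmptyP (empties P) ++ map tagEmptyH (empties H)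

  sum₂ : Pres (n ℕ.+ k)
  sum₂ = Surgery.result S.enum S._≟X_ S.emb S.gapX S.rem S.μ S.arcX S.vlX S.blX S.rv S.rb old

  twoSum-result : twoSum P H e φ ≡ sum₂
  twoSum-result = refl

  removedP⁻ : ∀ {f} → ⌊ f Fin.≟ zero {n} ⌋ ≡ true → f ≡ zero
  removedP⁻ {f} h with f Fin.≟ zero
  ... | yes eq = eq

  removedH⁻ : ∀ {f} → ⌊ f Fin.≟ e ⌋ ≡ true → f ≡ e
  removedH⁻ {f} h with f Fin.≟ e
  ... | yes eq = eq

  removedH⁺ : ⌊ e Fin.≟ e ⌋ ≡ true
  removedH⁺ with e Fin.≟ e
  ... | yes _ = refl
  ... | no ne = contradiction refl ne

  place : Fin n ⊎ Fin k → Term → S.X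
  place (inj₁ a) z = inj₁ (suc a , z)
  place (inj₂ b) z = inj₂ (punchIn e b , z)

  emb-place : ∀ g z → S.emb (g , z) ≡ place (splitAt n g) z
  emb-place g z with splitAt n g
  ... | inj₁ a = refl
  ... | inj₂ b = refl

  emb-left : ∀ a z → S.emb (a ↑ˡ k , z) ≡ inj₁ (suc a , z)
  emb-left a z = trans (emb-place (a ↑ˡ k) z) (cong (λ u → place u z) (Fin.splitAt-↑ˡ n a k))

  emb-right : ∀ b z → S.emb (n ↑ʳ b , z) ≡ inj₂ (punchIn e b , z)
  emb-right b z = trans (emb-place (n ↑ʳ b) z) (cong (λ u → place u z) (Fin.splitAt-↑ʳ n k b))

  laws₂ : Surgery.Laws S.enum S._≟X_ S.emb S.gapX S.rem S.μ S.arcX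
  laws₂ = record
    { complete = λ { (inj₁ x) → ∈-++⁺ˡ (∈-map⁺ inj₁ (∈-allEnd x)) ; (inj₂ y) → ∈-++⁺ʳ (map inj₁ (allEnd (suc n))) (∈-map⁺ inj₂ (∈-allEnd y)) }
    ; gap-invol = λ { (inj₁ x) → cong inj₁ (WP.gap-invol x) ; (inj₂ y) → cong inj₂ (WH.gap-invol y) }
    ; gap-nofix = λ { (inj₁ x) eq → WP.gap-nofix x (inj₁-injective eq) ; (inj₂ y) eq → WH.gap-nofix y (inj₂-injective eq) }
    ; μ-rem = λ { {inj₁ x} r → removedH⁺ ; {inj₂ y} r → refl }
    ; μ-invol = invol
    ; μ-nofix = λ { {inj₁ x} r () ; {inj₂ y} r () }
    ; emb-inj = λ { {g , z} {g′ , z′} eq → emb-inj g z g′ z′ eq }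
    ; emb-rem = λ { (g , z) → trans (cong S.rem (emb-place g z)) (place-rem (splitAt n g) z) }
    ; emb-surj = surj
    }
    where
    invol : ∀ {x} → S.rem x ≡ true → S.μ (S.μ x) ≡ x
    invol {inj₁ (f , i , t)} r with refl ← removedP⁻ {f} r = cong (λ j → inj₁ (zero , j , t)) (φinv-φt i)
    invol {inj₂ (f , j , t)} r with refl ← removedH⁻ {f} r = cong (λ i → inj₂ (f , i , t)) (φt-φinv j)
    place-inj : ∀ u z u′ z′ → place u z ≡ place u′ z′ → u ≡ u′ × z ≡ z′
    place-inj (inj₁ a) z (inj₁ .a) .z refl = refl , refl
    place-inj (inj₂ b) z (inj₂ b′) z′ eq = cong inj₂ (Fin.punchIn-injective e b b′ (cong proj₁ (inj₂-injective eq))) , cong proj₂ (inj₂-injective eq)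
    emb-inj : ∀ g z g′ z′ → S.emb (g , z) ≡ S.emb (g′ , z′) → (g , z) ≡ (g′ , z′)
    emb-inj g z g′ z′ eq with u , v ← place-inj (splitAt n g) z (splitAt n g′) z′ (trans (sym (emb-place g z)) (trans eq (emb-place g′ z′))) =
      cong₂ _,_ (trans (sym (Fin.join-splitAt n k g)) (trans (cong (Fin.join n k) u) (Fin.join-splitAt n k g′))) v
    place-rem : ∀ u z → S.rem (place u z) ≡ false
    place-rem (inj₁ a) z = refl
    place-rem (inj₂ b) z with punchIn e b Fin.≟ e
    ... | yes eq = contradiction eq (Fin.punchInᵢ≢i e b)
    ... | no _ = refl
    surj : ∀ {x} → S.rem x ≡ false → Σ (End (n ℕ.+ k)) λ z → S.emb z ≡ x
    surj {inj₁ (zero , z)} ()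
    surj {inj₁ (suc a , z)} r = (a ↑ˡ k , z) , emb-left a z
    surj {inj₂ (f , z)} r with f Fin.≟ e
    ... | no ne = (n ↑ʳ Fin.punchOut (ne ∘ sym) , z) , trans (emb-right _ z) (cong (λ g → inj₂ (g , z)) (Fin.punchIn-punchOut (ne ∘ sym)))

  open Surgery S.enum S._≟X_ S.emb S.gapX S.rem S.μ S.arcX using (Geo; gap-step; μ-step)
  open SurgeryLabels S.enum S._≟X_ S.emb S.gapX S.rem S.μ S.arcX laws₂ S.vlX S.blX S.rv S.rb old

  private
    z₀₀ z₀₁ z₁₀ z₁₁ : Term
    z₀₀ = zero , zero
    z₀₁ = zero , suc zero
    z₁₀ = suc zero , zero
    z₁₁ = suc zero , suc zero

  vlP : ∀ z w → key arcs z ≡ key arcs w → S.vlX (inj₁ (zero , z)) ≡ S.vlX (inj₁ (zero , w))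
  vlP z w eq = cong S.tagP (vl-key P wfP zero z w eq)

  vlH : ∀ z w → key arcs z ≡ key arcs w → S.vlX (inj₂ (e , z)) ≡ S.vlX (inj₂ (e , w))
  vlH z w eq = cong S.tagH (vl-key H wfH e z w eq)

  blP : ∀ z w → key conns z ≡ key conns w → S.blX (inj₁ (zero , z)) ≡ S.blX (inj₁ (zero , w))
  blP z w eq = cong S.tagP (bl-key P wfP zero z w eq)

  blH : ∀ z w → key conns z ≡ key conns w → S.blX (inj₂ (e , z)) ≡ S.blX (inj₂ (e , w))
  blH z w eq = cong S.tagH (bl-key H wfH e z w eq)

  private
    merge₂ : (l : S.X → ℕ) (x₁ y₁ x₂ y₂ : S.X) → ℕ → ℕ
    merge₂ l x₁ y₁ x₂ y₂ = merge (merge id (l x₁) (l y₁)) (l x₂) (l y₂)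

    -- Labels are constant on the two fibres of `p` on either side, so one merger per fibre settles
    -- all four identifications. The second fibre is represented by the tail of the other arrow for
    -- 𝒱 and by the head of the first arrow for ℬ.
    merge₂-seam : (l : S.X → ℕ) (p : Part) (z₁ : Term) → key p z₀₀ ≡ zero → key p z₁ ≡ suc zero →
      (∀ z w → key p z ≡ key p w → l (inj₁ (zero , z)) ≡ l (inj₁ (zero , w))) →
      (∀ z w → key p z ≡ key p w → l (inj₂ (e , z)) ≡ l (inj₂ (e , w))) → ∀ z →
      let r = merge₂ l (inj₁ (zero , z₀₀)) (inj₂ (e , φT z₀₀)) (inj₁ (zero , z₁)) (inj₂ (e , φT z₁)) in
      r (l (inj₁ (zero , z))) ≡ r (l (inj₂ (e , φT z)))
    merge₂-seam l p z₁ k₀ k₁ lP lH z with key p z in eq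
    ... | zero = trans (cong r (lP z z₀₀ (trans eq (sym k₀))))
        (trans (merge-cong (merge id (l (inj₁ (zero , z₀₀))) (l (inj₂ (e , φT z₀₀)))) (l (inj₁ (zero , z₁))) (l (inj₂ (e , φT z₁)))
            {l (inj₁ (zero , z₀₀))} {l (inj₂ (e , φT z₀₀))} (merge-merges id (l (inj₁ (zero , z₀₀))) (l (inj₂ (e , φT z₀₀)))))
          (cong r (lH (φT z₀₀) (φT z) (key-φT p z₀₀ z (trans k₀ (sym eq))))))
      where r = merge₂ l (inj₁ (zero , z₀₀)) (inj₂ (e , φT z₀₀)) (inj₁ (zero , z₁)) (inj₂ (e , φT z₁))
    ... | suc zero = trans (cong r (lP z z₁ (trans eq (sym k₁))))
        (trans (merge-merges (merge id (l (inj₁ (zero , z₀₀))) (l (inj₂ (e , φT z₀₀)))) (l (inj₁ (zero , z₁))) (l (inj₂ (e , φT z₁))))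
          (cong r (lH (φT z₁) (φT z) (key-φT p z₁ z (trans k₁ (sym eq))))))
      where r = merge₂ l (inj₁ (zero , z₀₀)) (inj₂ (e , φT z₀₀)) (inj₁ (zero , z₁)) (inj₂ (e , φT z₁))

  rv₀-μ : ∀ x → S.rem x ≡ true → S.rv₀ (S.vlX x) ≡ S.rv₀ (S.vlX (S.μ x))
  rv₀-μ (inj₁ (f , z)) r with refl ← removedP⁻ {f} r = merge₂-seam S.vlX arcs z₁₀ refl refl vlP vlH z
  rv₀-μ (inj₂ (f , j , t)) r with refl ← removedH⁻ {f} r =
    sym (trans (merge₂-seam S.vlX arcs z₁₀ refl refl vlP vlH (φT⁻¹ (j , t))) (cong (λ i → S.rv₀ (S.vlX (inj₂ (f , i , t)))) (φt-φinv j)))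

  rb₀-μ : ∀ x → S.rem x ≡ true → S.rb₀ (S.blX x) ≡ S.rb₀ (S.blX (S.μ x))
  rb₀-μ (inj₁ (f , z)) r with refl ← removedP⁻ {f} r = merge₂-seam S.blX conns z₀₁ refl refl blP blH z
  rb₀-μ (inj₂ (f , j , t)) r with refl ← removedH⁻ {f} r =
    sym (trans (merge₂-seam S.blX conns z₀₁ refl refl blP blH (φT⁻¹ (j , t))) (cong (λ i → S.rb₀ (S.blX (inj₂ (f , i , t)))) (φt-φinv j)))

  vlX-gap : ∀ x → S.vlX (S.gapX x) ≡ S.vlX x
  vlX-gap (inj₁ x) = cong S.tagP (WP.vl-gap x)
  vlX-gap (inj₂ y) = cong S.tagH (WH.vl-gap y)

  vlX-arc : ∀ x → S.vlX (S.arcX x) ≡ S.vlX x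
  vlX-arc (inj₁ x) = cong S.tagP (WP.vl-arc x)
  vlX-arc (inj₂ y) = cong S.tagH (WH.vl-arc y)

  blX-gap : ∀ x → S.blX (S.gapX x) ≡ S.blX x
  blX-gap (inj₁ x) = cong S.tagP (WP.bl-gap x)
  blX-gap (inj₂ y) = cong S.tagH (WH.bl-gap y)

  blX-conn : ∀ x → S.blX (S.connX x) ≡ S.blX x
  blX-conn (inj₁ x) = cong S.tagP (WP.bl-conn x)
  blX-conn (inj₂ y) = cong S.tagH (WH.bl-conn y)

  rv₀-vgraph : ∀ x → S.rv₀ (S.vlX (S.vgraph x)) ≡ S.rv₀ (S.vlX x)
  rv₀-vgraph x = if-elim {B = λ y → S.rv₀ (S.vlX y) ≡ S.rv₀ (S.vlX x)} (S.rem x) (λ r → sym (rv₀-μ x r)) (λ _ → cong S.rv₀ (vlX-arc x))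

  rb₀-bgraph : ∀ x → S.rb₀ (S.blX (S.bgraph x)) ≡ S.rb₀ (S.blX x)
  rb₀-bgraph x = if-elim {B = λ y → S.rb₀ (S.blX y) ≡ S.rb₀ (S.blX x)} (S.rem x) (λ r → sym (rb₀-μ x r)) (λ _ → cong S.rb₀ (blX-conn x))

  open Surgery.Laws laws₂ using (complete)

  v-connected : ∀ x y → Graph.connected S.enum S._≟X_ S.gapX S.vgraph x y ≡ true → S.rv₀ (S.vlX y) ≡ S.rv₀ (S.vlX x)
  v-connected x y h = comp-elim (λ y → S.rv₀ (S.vlX y) ≡ S.rv₀ (S.vlX x))
      (λ {y} q → trans (cong S.rv₀ (vlX-gap y)) q) (λ {y} q → trans (rv₀-vgraph y) q) refl (connected⇒∈ h)
    where open Bfs S.enum S._≟X_ complete S.gapX S.vgraph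

  b-connected : ∀ x y → Graph.connected S.enum S._≟X_ S.gapX S.bgraph x y ≡ true → S.rb₀ (S.blX y) ≡ S.rb₀ (S.blX x)
  b-connected x y h = comp-elim (λ y → S.rb₀ (S.blX y) ≡ S.rb₀ (S.blX x))
      (λ {y} q → trans (cong S.rb₀ (blX-gap y)) q) (λ {y} q → trans (rb₀-bgraph y) q) refl (connected⇒∈ h)
    where open Bfs S.enum S._≟X_ complete S.gapX S.bgraph

  -- A vertex of the 2-sum through both ends of the edge forces u = v or u′ = v′, whose blocks are
  -- then already merged; hence the extra merging in rv (and likewise in rb) changes nothing.
  rv-rv₀ : ∀ l → S.rv l ≡ S.rv₀ l
  rv-rv₀ l = if-elim {B = λ r → r l ≡ S.rv₀ l} S.vshare {merge S.rv₀ (S.vlX S.p₁) (S.vlX S.p₃)} {S.rv₀} (λ h → merge-idle S.rv₀ (S.vlX S.p₁) (S.vlX S.p₃) (shared h) l) (λ _ → refl)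
    where
    shared : S.vshare ≡ true → S.rv₀ (S.vlX S.p₁) ≡ S.rv₀ (S.vlX S.p₃)
    shared h with ∨-elim h
    ... | inj₁ c = sym (v-connected S.p₁ S.p₃ c)
    ... | inj₂ h with ∨-elim h
    ... | inj₁ c = trans (sym (v-connected S.p₁ S.p₄ c)) (cong S.rv₀ (vlP z₁₁ z₁₀ refl))
    ... | inj₂ h with ∨-elim h
    ... | inj₁ c = trans (cong S.rv₀ (vlP z₀₀ z₀₁ refl)) (sym (v-connected S.p₂ S.p₃ c))
    ... | inj₂ c = trans (cong S.rv₀ (vlP z₀₀ z₀₁ refl)) (trans (sym (v-connected S.p₂ S.p₄ c)) (cong S.rv₀ (vlP z₁₁ z₁₀ refl)))

  rb-rb₀ : ∀ l → S.rb l ≡ S.rb₀ l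
  rb-rb₀ l = if-elim {B = λ r → r l ≡ S.rb₀ l} S.bshare {merge S.rb₀ (S.blX S.p₁) (S.blX S.p₂)} {S.rb₀} (λ h → merge-idle S.rb₀ (S.blX S.p₁) (S.blX S.p₂) (shared h) l) (λ _ → refl)
    where
    shared : S.bshare ≡ true → S.rb₀ (S.blX S.p₁) ≡ S.rb₀ (S.blX S.p₂)
    shared h with ∨-elim h
    ... | inj₁ c = sym (b-connected S.p₁ S.p₂ c)
    ... | inj₂ h with ∨-elim h
    ... | inj₁ c = trans (sym (b-connected S.p₁ S.p₃ c)) (cong S.rb₀ (blP z₁₀ z₀₁ refl))
    ... | inj₂ h with ∨-elim h
    ... | inj₁ c = trans (cong S.rb₀ (blP z₀₀ z₁₁ refl)) (sym (b-connected S.p₄ S.p₂ c))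
    ... | inj₂ c = trans (cong S.rb₀ (blP z₀₀ z₁₁ refl)) (trans (sym (b-connected S.p₄ S.p₃ c)) (cong S.rb₀ (blP z₁₀ z₀₁ refl)))

  v-geo₂ : ∀ {x y} → Geo x y → S.rv (S.vlX x) ≡ S.rv (S.vlX y)
  v-geo₂ (gap-step x) = cong S.rv (sym (vlX-gap x))
  v-geo₂ (μ-step {x} r) = trans (rv-rv₀ _) (trans (rv₀-μ x r) (sym (rv-rv₀ _)))

  b-geo₂ : ∀ {x y} → Geo x y → S.rb (S.blX x) ≡ S.rb (S.blX y)
  b-geo₂ (gap-step x) = cong S.rb (sym (blX-gap x))
  b-geo₂ (μ-step {x} r) = trans (rb-rb₀ _) (trans (rb₀-μ x r) (sym (rb-rb₀ _)))

  twoSum-WF : WF (twoSum P H e φ)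
  twoSum-WF = subst WF (sym twoSum-result) (result-WF
      (λ { (g , z) → cong S.rv (trans (cong S.vlX (trans (emb-place g (proj₁ z , flip2 (proj₂ z))) (place-arc (splitAt n g) z)))
                        (trans (vlX-arc (place (splitAt n g) z)) (cong S.vlX (sym (emb-place g z))))) })
      (λ { (g , z) → cong S.rb (trans (cong S.blX (trans (emb-place g (flip2 (proj₁ z) , flip2 (proj₂ z))) (place-conn (splitAt n g) z)))
                        (trans (blX-conn (place (splitAt n g) z)) (cong S.blX (sym (emb-place g z))))) })
      v-geo₂ b-geo₂)
    where
    place-arc : ∀ u z → place u (proj₁ z , flip2 (proj₂ z)) ≡ S.arcX (place u z)
    place-arc (inj₁ a) z = refl
    place-arc (inj₂ b) z = refl
    place-conn : ∀ u z → place u (flip2 (proj₁ z) , flip2 (proj₂ z)) ≡ S.connX (place u z)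
    place-conn (inj₁ a) z = refl
    place-conn (inj₂ b) z = refl

  BaseX : Kind → Rel (S.X ⊎ Fin (length old)) 0ℓ
  BaseX cyc = GapRel S.gapX
  BaseX vtx = Equal (labels old S.vlX proj₁)
  BaseX bdy = Equal (labels old S.blX proj₂)

  data Seam : Rel S.X 0ℓ where
    cross : ∀ {x} → S.rem x ≡ true → Seam x (S.μ x)

  twoSum-classes : ∀ κ (T : Rel (End (n ℕ.+ k)) 0ℓ) → classes κ (twoSum P H e φ) T ≃ ⟨ Gens (BaseX κ) (Seam ∪ Image S.emb T) ⟩
  twoSum-classes κ T = subst (λ P′ → classes κ P′ T ≃ ⟨ Gens (BaseX κ) (Seam ∪ Image S.emb T) ⟩) (sym twoSum-result) (go κ)
    where
    seam₂ : ∀ {B x y} → Seam x y → EqClosure (Gens B (Seam ∪ Image S.emb T)) (inj₁ x) (inj₁ y)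
    seam₂ s = Closure.return (link (inj₁ s))
    ker : ∀ (l : S.X → ℕ) (π : ℕ × ℕ → ℕ) z₁ → ∀ i j →
      let r = merge₂ l (inj₁ (zero , z₀₀)) (inj₂ (e , φT z₀₀)) (inj₁ (zero , z₁)) (inj₂ (e , φT z₁)) in
      r (labels old l π i) ≡ r (labels old l π j) → EqClosure (Gens (Equal (labels old l π)) (Seam ∪ Image S.emb T)) i j
    -- The inner and the outer merger are each accounted for by one crossing of the seam.
    ker l π z₁ = merge-ker _ (Closure.isEquivalence _) (labels old l π) (merge id (l (inj₁ (zero , z₀₀))) (l (inj₂ (e , φT z₀₀))))
      (merge-ker _ (Closure.isEquivalence _) (labels old l π) id (λ i j eq → Closure.return (base eq)) refl refl (seam₂ (cross {inj₁ (zero , z₀₀)} refl)))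
      refl refl (seam₂ (cross {inj₁ (zero , z₁)} refl))
    go : ∀ κ → classes κ sum₂ T ≃ ⟨ Gens (BaseX κ) (Seam ∪ Image S.emb T) ⟩
    go cyc = gap-transfer Seam T (λ { (cross r) → Closure.return (μ-step r) }) (λ r → Closure.return (cross r))
    go vtx = label-transfer Seam T (labels old S.vlX proj₁) (vlabel sum₂) S.rv vlabel-up v-geo₂ (λ { (cross {x} r) → v-geo₂ (μ-step {x} r) })
      (λ i j eq → ker S.vlX proj₁ z₁₀ i j (trans (sym (rv-rv₀ _)) (trans eq (rv-rv₀ _))))
    go bdy = label-transfer Seam T (labels old S.blX proj₂) (blabel sum₂) S.rb blabel-up b-geo₂ (λ { (cross {x} r) → b-geo₂ (μ-step {x} r) })
      (λ i j eq → ker S.blX proj₂ z₀₁ i j (trans (sym (rb-rb₀ _)) (trans eq (rb-rb₀ _))))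

module Sum2Count {n k} (P : Pres (suc n)) (H : Pres (suc k)) (e : Fin (suc k)) (φ : Coupling) (wfP : WF P) (wfH : WF H)
                 (s : Vec Op n) (t : Vec Op k) where
  open Sum2 P H e φ wfP wfH
  open CouplingFacts φ hiding (φt; φinv)
  open Outside H wfH e t

  private
    PtX : Set
    PtX = S.X ⊎ Fin (length old)

    reassoc : {A B C D : Set} → (A ⊎ B) ⊎ (C ⊎ D) → (A ⊎ C) ⊎ (B ⊎ D)
    reassoc (inj₁ (inj₁ a)) = inj₁ (inj₁ a)
    reassoc (inj₁ (inj₂ b)) = inj₂ (inj₁ b)
    reassoc (inj₂ (inj₁ c)) = inj₁ (inj₂ c)
    reassoc (inj₂ (inj₂ d)) = inj₂ (inj₂ d)

    reassoc-reassoc : {A B C D : Set} (i : (A ⊎ B) ⊎ (C ⊎ D)) → reassoc (reassoc i) ≡ i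
    reassoc-reassoc (inj₁ (inj₁ a)) = refl
    reassoc-reassoc (inj₁ (inj₂ b)) = refl
    reassoc-reassoc (inj₂ (inj₁ c)) = refl
    reassoc-reassoc (inj₂ (inj₂ d)) = refl

    oldP oldH : List (ℕ × ℕ)
    oldP = map tagEmptyP (empties P)
    oldH = map tagEmptyH (empties H)

    unold : Fin (length old) → Fin (length (empties P)) ⊎ Fin (length (empties H))
    unold i = Sum.map (unmapI tagEmptyP (empties P)) (unmapI tagEmptyH (empties H)) (splitI oldP oldH i)

    reold : Fin (length (empties P)) ⊎ Fin (length (empties H)) → Fin (length old)
    reold i = joinI oldP oldH (Sum.map (mapI tagEmptyP (empties P)) (mapI tagEmptyH (empties H)) i)

    unold-reold : ∀ i → unold (reold i) ≡ i
    unold-reold i = trans (cong (Sum.map _ _) (splitI-joinI oldP oldH _)) (cancel i)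
      where
      cancel : ∀ i → Sum.map (unmapI tagEmptyP (empties P)) (unmapI tagEmptyH (empties H))
                       (Sum.map (mapI tagEmptyP (empties P)) (mapI tagEmptyH (empties H)) i) ≡ i
      cancel (inj₁ a) = cong inj₁ (unmapI-mapI tagEmptyP (empties P) a)
      cancel (inj₂ b) = cong inj₂ (unmapI-mapI tagEmptyH (empties H) b)

    reold-unold : ∀ i → reold (unold i) ≡ i
    reold-unold i = trans (cong (joinI oldP oldH) (cancel (splitI oldP oldH i))) (joinI-splitI oldP oldH i)
      where
      cancel : ∀ i → Sum.map (mapI tagEmptyP (empties P)) (mapI tagEmptyH (empties H))
                       (Sum.map (unmapI tagEmptyP (empties P)) (unmapI tagEmptyH (empties H)) i) ≡ i
      cancel (inj₁ a) = cong inj₁ (mapI-unmapI tagEmptyP (empties P) a)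
      cancel (inj₂ b) = cong inj₂ (mapI-unmapI tagEmptyH (empties H) b)

    lookup-old : ∀ i → lookup old i ≡ Sum.[ tagEmptyP ∘ lookup (empties P) , tagEmptyH ∘ lookup (empties H) ]′ (unold i)
    lookup-old i = trans (lookup-splitI oldP oldH i) (inner (splitI oldP oldH i))
      where
      inner : ∀ i → Sum.[ lookup oldP , lookup oldH ]′ i ≡ Sum.[ tagEmptyP ∘ lookup (empties P) , tagEmptyH ∘ lookup (empties H) ]′
                      (Sum.map (unmapI tagEmptyP (empties P)) (unmapI tagEmptyH (empties H)) i)
      inner (inj₁ a) = lookup-unmapI tagEmptyP (empties P) a
      inner (inj₂ b) = lookup-unmapI tagEmptyH (empties H) b

    to : PtX → Pt P ⊎ Pt H
    to i = reassoc (Sum.map₂ unold i)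

    from : Pt P ⊎ Pt H → PtX
    from i = Sum.map₂ reold (reassoc i)

    map₂-map₂ : {A B C : Set} {f : B → C} {g : C → B} → (∀ c → f (g c) ≡ c) → (i : A ⊎ C) → Sum.map₂ f (Sum.map₂ g i) ≡ i
    map₂-map₂ h (inj₁ a) = refl
    map₂-map₂ h (inj₂ c) = cong inj₂ (h c)

    to-from : ∀ i → to (from i) ≡ i
    to-from i = trans (cong reassoc (map₂-map₂ unold-reold (reassoc i))) (reassoc-reassoc i)

    from-to : ∀ i → from (to i) ≡ i
    from-to i = trans (cong (Sum.map₂ reold) (reassoc-reassoc (Sum.map₂ unold i))) (map₂-map₂ reold-unold i)

    tagged : (Pt P → ℕ) → (Pt H → ℕ) → Pt P ⊎ Pt H → ℕ
    tagged l l′ = Sum.[ S.tagP ∘ l , S.tagH ∘ l′ ]′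

    vlabel-to : ∀ i → labels old S.vlX proj₁ i ≡ tagged (vlabel P) (vlabel H) (to i)
    vlabel-to (inj₁ (inj₁ x)) = refl
    vlabel-to (inj₁ (inj₂ y)) = refl
    vlabel-to (inj₂ a) with unold a | lookup-old a
    ... | inj₁ _ | eq = cong proj₁ eq
    ... | inj₂ _ | eq = cong proj₁ eq

    blabel-to : ∀ i → labels old S.blX proj₂ i ≡ tagged (blabel P) (blabel H) (to i)
    blabel-to (inj₁ (inj₁ x)) = refl
    blabel-to (inj₁ (inj₂ y)) = refl
    blabel-to (inj₂ a) with unold a | lookup-old a
    ... | inj₁ _ | eq = cong proj₂ eq
    ... | inj₂ _ | eq = cong proj₂ eq

  seamP : Term → Pt P
  seamP z = inj₁ (zero , φT⁻¹ z)

  RestP : Kind → Rel (Pt P) 0ℓ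
  RestP κ = Gens (Base κ P) (Image (punch zero) (Link κ s))

  Glued : Kind → Rel (Pt P ⊎ Pt H) 0ℓ
  Glued κ = GlueRel (RestP κ) (Rest κ) seamP terminal

  Joint : Kind → Rel PtX 0ℓ
  Joint κ = Gens (BaseX κ) (Seam ∪ Image S.emb (Link κ (s Vec.++ t)))

  -- Sorting the points by origin brings the 2-sum into the form of `glue-≃`. Tags of opposite
  -- parity prevent a label of `P` from meeting one of `H`, so nothing but the seam connects the two
  -- sides.
  joint-glued : ∀ κ → ⟨ Joint κ ⟩ ≃ ⟨ Glued κ ⟩
  joint-glued κ = closure-≃ to from to-ok from-ok (λ i → subst (λ j → EqClosure (Glued κ) j i) (sym (to-from i)) ε)
      (λ i → subst (λ j → EqClosure (Joint κ) j i) (sym (from-to i)) ε)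
    where
    equal-to : ∀ (l : Pt P → ℕ) (l′ : Pt H → ℕ) {R : Rel (Pt P) 0ℓ} {R′ : Rel (Pt H) 0ℓ} →
      (∀ {i j} → l i ≡ l j → R i j) → (∀ {i j} → l′ i ≡ l′ j → R′ i j) →
      ∀ i j → tagged l l′ i ≡ tagged l l′ j → EqClosure (GlueRel R R′ seamP terminal) i j
    equal-to l l′ r r′ (inj₁ i) (inj₁ j) eq = Closure.return (left (r (ℕ.*-cancelˡ-≡ (l i) (l j) 2 eq)))
    equal-to l l′ r r′ (inj₂ i) (inj₂ j) eq = Closure.return (right (r′ (ℕ.*-cancelˡ-≡ (l′ i) (l′ j) 2 (ℕ.suc-injective eq))))
    equal-to l l′ r r′ (inj₁ i) (inj₂ j) eq = ⊥-elim (ℕ.even≢odd (l i) (l′ j) eq)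
    equal-to l l′ r r′ (inj₂ i) (inj₁ j) eq = ⊥-elim (ℕ.even≢odd (l j) (l′ i) (sym eq))

    base-to : ∀ κ {i j} → BaseX κ i j → EqClosure (Glued κ) (to i) (to j)
    base-to cyc (gap-rel (inj₁ x)) = Closure.return (left (base (gap-rel x)))
    base-to cyc (gap-rel (inj₂ y)) = Closure.return (right (base (gap-rel y)))
    base-to vtx {i} {j} eq = equal-to (vlabel P) (vlabel H) base base (to i) (to j) (trans (sym (vlabel-to i)) (trans eq (vlabel-to j)))
    base-to bdy {i} {j} eq = equal-to (blabel P) (blabel H) base base (to i) (to j) (trans (sym (blabel-to i)) (trans eq (blabel-to j)))

    seam-to : ∀ {x y} → Seam x y → EqClosure (Glued κ) (to (inj₁ x)) (to (inj₁ y))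
    seam-to (cross {inj₁ (f , i , u)} r) with refl ← removedP⁻ {f} r =
      subst (λ j → EqClosure (Glued κ) (inj₁ (inj₁ (zero , j , u))) (inj₂ (terminal (φT (i , u))))) (φinv-φt i) (Closure.return (seam (φT (i , u))))
    seam-to (cross {inj₂ (f , z)} r) with refl ← removedH⁻ {f} r = Closure.symmetric (Glued κ) (Closure.return (seam z))

    link-to : ∀ {x y} → Image S.emb (Link κ (s Vec.++ t)) x y → EqClosure (Glued κ) (to (inj₁ x)) (to (inj₁ y))
    link-to (image (same {g} {z} {w} eq)) = subst₂ (λ x y → EqClosure (Glued κ) (to (inj₁ x)) (to (inj₁ y))) (sym (emb-place g z)) (sym (emb-place g w))
        (inner (splitAt n g) (subst (λ o → key (part κ o) z ≡ key (part κ o) w) (Vec.lookup-splitAt n s t g) eq))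
      where
      inner : ∀ u → key (part κ (Sum.[ Vec.lookup s , Vec.lookup t ]′ u)) z ≡ key (part κ (Sum.[ Vec.lookup s , Vec.lookup t ]′ u)) w →
        EqClosure (Glued κ) (to (inj₁ (place u z))) (to (inj₁ (place u w)))
      inner (inj₁ a) eq = Closure.return (left (link (image (same eq))))
      inner (inj₂ b) eq = Closure.return (right (link (image (same eq))))

    to-ok : ∀ {i j} → Joint κ i j → EqClosure (Glued κ) (to i) (to j)
    to-ok (base b) = base-to κ b
    to-ok (link (inj₁ c)) = seam-to c
    to-ok (link (inj₂ l)) = link-to l

    linked : ∀ {f z w x y} → S.emb (f , z) ≡ x → S.emb (f , w) ≡ y → key (part κ (Vec.lookup (s Vec.++ t) f)) z ≡ key (part κ (Vec.lookup (s Vec.++ t) f)) w →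
      EqClosure (Joint κ) (inj₁ x) (inj₁ y)
    linked refl refl eq = Closure.return (link (inj₂ (image (same eq))))

    base-fromP : ∀ κ {i j} → Base κ P i j → EqClosure (Joint κ) (from (inj₁ i)) (from (inj₁ j))
    base-fromP cyc (gap-rel x) = Closure.return (base (gap-rel (inj₁ x)))
    base-fromP vtx {i} {j} eq = Closure.return (base (trans (vlabel-to (from (inj₁ i))) (trans (cong (tagged (vlabel P) (vlabel H)) (to-from (inj₁ i)))
      (trans (cong S.tagP eq) (sym (trans (vlabel-to (from (inj₁ j))) (cong (tagged (vlabel P) (vlabel H)) (to-from (inj₁ j)))))))))
    base-fromP bdy {i} {j} eq = Closure.return (base (trans (blabel-to (from (inj₁ i))) (trans (cong (tagged (blabel P) (blabel H)) (to-from (inj₁ i)))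
      (trans (cong S.tagP eq) (sym (trans (blabel-to (from (inj₁ j))) (cong (tagged (blabel P) (blabel H)) (to-from (inj₁ j)))))))))

    base-fromH : ∀ κ {i j} → Base κ H i j → EqClosure (Joint κ) (from (inj₂ i)) (from (inj₂ j))
    base-fromH cyc (gap-rel x) = Closure.return (base (gap-rel (inj₂ x)))
    base-fromH vtx {i} {j} eq = Closure.return (base (trans (vlabel-to (from (inj₂ i))) (trans (cong (tagged (vlabel P) (vlabel H)) (to-from (inj₂ i)))
      (trans (cong S.tagH eq) (sym (trans (vlabel-to (from (inj₂ j))) (cong (tagged (vlabel P) (vlabel H)) (to-from (inj₂ j)))))))))
    base-fromH bdy {i} {j} eq = Closure.return (base (trans (blabel-to (from (inj₂ i))) (trans (cong (tagged (blabel P) (blabel H)) (to-from (inj₂ i)))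
      (trans (cong S.tagH eq) (sym (trans (blabel-to (from (inj₂ j))) (cong (tagged (blabel P) (blabel H)) (to-from (inj₂ j)))))))))

    at : ∀ {z w} u {o} → o ≡ u → key (part κ u) z ≡ key (part κ u) w → key (part κ o) z ≡ key (part κ o) w
    at u refl eq = eq

    from-ok : ∀ {i j} → Glued κ i j → EqClosure (Joint κ) (from i) (from j)
    from-ok (left (base b)) = base-fromP κ b
    from-ok (left (link (image (same {a} {z} {w} eq)))) = linked {a ↑ˡ k} (emb-left a z) (emb-left a w)
      (at (Vec.lookup s a) (Vec.lookup-++ˡ s t a) eq)
    from-ok (right (base b)) = base-fromH κ b
    from-ok (right (link (image (same {b} {z} {w} eq)))) = linked {n ↑ʳ b} (emb-right b z) (emb-right b w)
      (at (Vec.lookup t b) (Vec.lookup-++ʳ s t b) eq)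
    from-ok (seam z) = Closure.symmetric (Joint κ) (Closure.return (link (inj₁ (cross {inj₂ (e , z)} removedH⁺))))

  -- What `H` leaves behind on the seam is exactly the set of links of an operation at edge `zero`;
  -- the coupling drops out because it respects every partition.
  contract : ∀ κ o → ⟨ RestP κ ∪ KeyRel seamP (key (part κ o)) ⟩ ≃ classes κ P (Link κ (o ∷ s))
  contract κ o = closure-≃ id id to-ok from-ok (λ _ → ε) (λ _ → ε)
    where
    Whole : Rel (Pt P) 0ℓ
    Whole = Gens (Base κ P) (Link κ (o ∷ s))
    to-ok : ∀ {i j} → (RestP κ ∪ KeyRel seamP (key (part κ o))) i j → EqClosure Whole i j
    to-ok (inj₁ (base b)) = Closure.return (base b)
    to-ok (inj₁ (link (image (same eq)))) = Closure.return (link (same eq))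
    to-ok (inj₂ (key-rel {z} {w} eq)) = Closure.return (link (same (key-φT⁻¹ (part κ o) z w eq)))
    at-seam : ∀ z → inj₁ (zero , z) ≡ seamP (φT z)
    at-seam z = cong (λ i → inj₁ (zero , i , proj₂ z)) (sym (φinv-φt (proj₁ z)))
    from-ok : ∀ {i j} → Whole i j → EqClosure (RestP κ ∪ KeyRel seamP (key (part κ o))) i j
    from-ok (base b) = Closure.return (inj₁ (base b))
    from-ok (link (same {suc f} eq)) = Closure.return (inj₁ (link (image (same eq))))
    from-ok (link (same {zero} {z} {w} eq)) = subst₂ (EqClosure (RestP κ ∪ KeyRel seamP (key (part κ o)))) (sym (at-seam z)) (sym (at-seam w))
      (Closure.return (inj₂ (key-rel (key-φT (part κ o) z w eq))))

  -- The same gluing as in `apply-count`, with all of `P` in place of the four bare endpoints; hence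
  -- the same `type` and the same `far` occur.
  twoSum-count : ∀ κ → N κ (twoSum P H e φ) (s Vec.++ t) ≡ N κ P (type ∷ s) ℕ.+ far κ
  twoSum-count κ = same-count (classes-count (twoSum P H e φ) twoSum-WF κ (s Vec.++ t))
    (≃-trans (twoSum-classes κ (Link κ (s Vec.++ t))) (≃-trans (joint-glued κ)
      (≃-trans (glue-≃ (RestP κ) (Rest κ) seamP terminal (key (part κ type)) (proj₁ (type-describes κ)) (proj₂ (type-describes κ)) (near κ))
        (⊎-count (≃-trans (contract κ type) (classes-count P wfP κ (type ∷ s))) (far-classes κ)))))

-- State sums

WF-subst : ∀ {m n} (eq : m ≡ n) {P : Pres m} → WF P → WF (subst Pres eq P)
WF-subst refl wf = wf

module StateSum {c ℓ : Level} (R : CommutativeRing c ℓ) (α β γ : CommutativeRing.Carrier R) where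
  open CommutativeRing R hiding (zero) renaming (refl to ≈-refl; sym to ≈-sym; trans to ≈-trans; setoid to ≈-setoid)
  open Poly R
  open SetoidReasoning ≈-setoid

  opaque
    ΣO : (Op → Carrier) → Carrier
    ΣO g = g del + g con + g penrose + g mdel + g mcon

    ΣO-cong : ∀ {g h : Op → Carrier} → (∀ o → g o ≈ h o) → ΣO g ≈ ΣO h
    ΣO-cong e = +-cong (+-cong (+-cong (+-cong (e del) (e con)) (e penrose)) (e mdel)) (e mcon)

    ΣO-distribˡ : ∀ x g → x * ΣO g ≈ ΣO (λ o → x * g o)
    ΣO-distribˡ x g = solve 6 (λ x a b c d e → x :* (a :+ b :+ c :+ d :+ e) := x :* a :+ x :* b :+ x :* c :+ x :* d :+ x :* e) ≈-refl
        x (g del) (g con) (g penrose) (g mdel) (g mcon)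
      where open Solver commutativeSemiring using (solve; _:+_; _:*_; _:=_)

    ΣO-+ : ∀ g h → ΣO (λ o → g o + h o) ≈ ΣO g + ΣO h
    ΣO-+ g h = solve 10 (λ a b c d e a′ b′ c′ d′ e′ → (a :+ a′) :+ (b :+ b′) :+ (c :+ c′) :+ (d :+ d′) :+ (e :+ e′) :=
          (a :+ b :+ c :+ d :+ e) :+ (a′ :+ b′ :+ c′ :+ d′ :+ e′)) ≈-refl
        (g del) (g con) (g penrose) (g mdel) (g mcon) (h del) (h con) (h penrose) (h mdel) (h mcon)
      where open Solver commutativeSemiring using (solve; _:+_; _:*_; _:=_)

    ΣO-swap : ∀ (g : Op → Op → Carrier) → ΣO (λ o → ΣO (g o)) ≈ ΣO (λ o′ → ΣO (λ o → g o o′))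
    ΣO-swap g = ≈-sym (≈-trans (ΣO-+ (λ o → g del o + g con o + g penrose o + g mdel o) (g mcon))
      (+-congʳ (≈-trans (ΣO-+ (λ o → g del o + g con o + g penrose o) (g mdel))
        (+-congʳ (≈-trans (ΣO-+ (λ o → g del o + g con o) (g penrose)) (+-congʳ (ΣO-+ (g del) (g con))))))))

  ΣS : ∀ m → (Vec Op m → Carrier) → Carrier
  ΣS zero g = g []
  ΣS (suc m) g = ΣO (λ o → ΣS m (λ s → g (o ∷ s)))

  ΣS-cong : ∀ m {g h : Vec Op m → Carrier} → (∀ s → g s ≈ h s) → ΣS m g ≈ ΣS m h
  ΣS-cong zero e = e []
  ΣS-cong (suc m) e = ΣO-cong (λ o → ΣS-cong m (λ s → e (o ∷ s)))

  ΣS-distribˡ : ∀ m x g → x * ΣS m g ≈ ΣS m (λ s → x * g s)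
  ΣS-distribˡ zero x g = ≈-refl
  ΣS-distribˡ (suc m) x g = ≈-trans (ΣO-distribˡ x _) (ΣO-cong (λ o → ΣS-distribˡ m x _))

  ΣS-ΣO : ∀ m (g : Op → Vec Op m → Carrier) → ΣS m (λ s → ΣO (λ o → g o s)) ≈ ΣO (λ o → ΣS m (g o))
  ΣS-ΣO zero g = ≈-refl
  ΣS-ΣO (suc m) g = ≈-trans (ΣO-cong (λ o′ → ΣS-ΣO m (λ o s → g o (o′ ∷ s)))) (ΣO-swap _)

  ΣS-++ : ∀ m n (g : Vec Op (m ℕ.+ n) → Carrier) → ΣS (m ℕ.+ n) g ≈ ΣS m (λ s → ΣS n (λ t → g (s Vec.++ t)))
  ΣS-++ zero n g = ≈-refl
  ΣS-++ (suc m) n g = ΣO-cong (λ o → ΣS-++ m n (λ s → g (o ∷ s)))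

  monomial : (Kind → ℕ) → Carrier
  monomial f = pow α (f cyc) * pow β (f vtx) * pow γ (f bdy)

  pow-+ : ∀ r m n → pow r (m ℕ.+ n) ≈ pow r m * pow r n
  pow-+ r zero n = ≈-sym (*-identityˡ _)
  pow-+ r (suc m) n = ≈-trans (*-congˡ (pow-+ r m n)) (≈-sym (*-assoc _ _ _))

  monomial-+ : ∀ f g → monomial (λ κ → f κ ℕ.+ g κ) ≈ monomial f * monomial g
  monomial-+ f g = ≈-trans (*-cong (*-cong (pow-+ α (f cyc) (g cyc)) (pow-+ β (f vtx) (g vtx))) (pow-+ γ (f bdy) (g bdy)))
      (solve 6 (λ a a′ b b′ c c′ → a :* a′ :* (b :* b′) :* (c :* c′) := (a :* b :* c) :* (a′ :* b′ :* c′)) ≈-refl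
        (pow α (f cyc)) (pow α (g cyc)) (pow β (f vtx)) (pow β (g vtx)) (pow γ (f bdy)) (pow γ (g bdy)))
    where open Solver commutativeSemiring using (solve; _:+_; _:*_; _:=_)

  monomial-cong : ∀ {f g : Kind → ℕ} → (∀ κ → f κ ≡ g κ) → monomial f ≈ monomial g
  monomial-cong e = *-cong (*-cong (reflexive (cong (pow α) (e cyc))) (reflexive (cong (pow β) (e vtx)))) (reflexive (cong (pow γ) (e bdy)))

  -- Polynomials whose weights depend on the edge

  Weights : Set c
  Weights = ℕ → Op → Carrier

  Qw : Weights → ∀ {m} → Pres m → Carrier
  Qw w {zero} P = monomial (λ κ → size κ P)
  Qw w {suc m} P = ΣO (λ o → w 0 o * Qw (w ∘ suc) (apply o P zero))

  weight : Weights → ∀ {m} → Vec Op m → Carrier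
  weight w [] = 1#
  weight w (o ∷ s) = w 0 o * weight (w ∘ suc) s

  Qw-states : ∀ w {m} (P : Pres m) → Qw w P ≈ ΣS m (λ s → weight w s * monomial (λ κ → N κ P s))
  Qw-states w {zero} P = ≈-sym (*-identityˡ _)
  Qw-states w {suc m} P = ΣO-cong (λ o → ≈-trans (*-congˡ (Qw-states (w ∘ suc) (apply o P zero)))
    (≈-trans (ΣS-distribˡ m _ _) (ΣS-cong m (λ s → ≈-sym (*-assoc _ _ _)))))

  Qw-subst : ∀ w {m n} (eq : m ≡ n) (P : Pres m) → Qw w (subst Pres eq P) ≡ Qw w P
  Qw-subst w refl P = refl

  ops : (a b c′ x y : Carrier) → Op → Carrier
  ops a b c′ x y del = a
  ops a b c′ x y con = b
  ops a b c′ x y penrose = c′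
  ops a b c′ x y mdel = x
  ops a b c′ x y mcon = y

  opaque
    unfolding ΣO

    Q-Qw : ∀ {m} (P : Pres m) a b c′ x y → Q P a b c′ x y α β γ ≈ Qw (λ _ → ops a b c′ x y) P
    Q-Qw {zero} P a b c′ x y = ≈-refl
    Q-Qw {suc m} P a b c′ x y = ΣO-cong {λ o → ops a b c′ x y o * Q (apply o P zero) a b c′ x y α β γ} (λ o → *-congˡ (Q-Qw (apply o P zero) a b c′ x y))

  -- The weights at an intermediate stage of the tensor product: in front the `n` edges of `P` still
  -- to be replaced, behind them the edges of the copies of `H` already inserted. A 2-sum consumes
  -- edge `zero` and appends its new edges at the end, so this shape persists.
  mixed : (A B : Op → Carrier) → ℕ → Weights
  mixed A B zero = λ _ → B
  mixed A B (suc n) = λ { zero → A ; (suc i) → mixed A B n i }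

  weight-const-++ : ∀ B {m n} (s : Vec Op m) (t : Vec Op n) → weight (λ _ → B) (s Vec.++ t) ≈ weight (λ _ → B) s * weight (λ _ → B) t
  weight-const-++ B [] t = ≈-sym (*-identityˡ _)
  weight-const-++ B (o ∷ s) t = ≈-trans (*-congˡ (weight-const-++ B s t)) (≈-sym (*-assoc _ _ _))

  weight-mixed-++ : ∀ A B n {j k} (s : Vec Op (n ℕ.+ j)) (t : Vec Op k) →
    weight (mixed A B n) (s Vec.++ t) ≈ weight (mixed A B n) s * weight (λ _ → B) t
  weight-mixed-++ A B zero s t = weight-const-++ B s t
  weight-mixed-++ A B (suc n) (o ∷ s) t = ≈-trans (*-congˡ (weight-mixed-++ A B n s t)) (≈-sym (*-assoc _ _ _))

  Qw-mixed-all : ∀ A B {n} (P : Pres n) → Qw (mixed A B n) P ≈ Qw (λ _ → A) P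
  Qw-mixed-all A B {zero} P = ≈-refl
  Qw-mixed-all A B {suc n} P = ΣO-cong (λ o → *-congˡ (Qw-mixed-all A B (apply o P zero)))

  δ : Op → Op → Carrier
  δ del del = 1#
  δ con con = 1#
  δ penrose penrose = 1#
  δ mdel mdel = 1#
  δ mcon mcon = 1#
  δ _ _ = 0#

  opaque
    unfolding ΣO

    -- Spreading one term over all five operations allows the sum over states to be exchanged with
    -- the sum over types.
    select : ∀ x (g : Op → Carrier) o′ → x * g o′ ≈ ΣO (λ o → (δ o o′ * x) * g o)
    select x g o′ = ≈-sym (≈-trans (ΣO-cong (λ o → *-assoc (δ o o′) x (g o))) (pick o′))
      where
      one : ∀ {y} → 1# * y ≈ y
      one = *-identityˡ _
      nil : ∀ {y} → 0# * y ≈ 0#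
      nil = zeroˡ _
      dropʳ : ∀ {p q} → q ≈ 0# → p + q ≈ p
      dropʳ e = ≈-trans (+-congˡ e) (+-identityʳ _)
      dropˡ : ∀ {p q} → p ≈ 0# → p + q ≈ q
      dropˡ e = ≈-trans (+-congʳ e) (+-identityˡ _)
      none : ∀ {p q} → p ≈ 0# → q ≈ 0# → p + q ≈ 0#
      none e e′ = ≈-trans (dropˡ e) e′
      pick : ∀ o′ → ΣO (λ o → δ o o′ * (x * g o)) ≈ x * g o′
      pick del = ≈-trans (dropʳ nil) (≈-trans (dropʳ nil) (≈-trans (dropʳ nil) (≈-trans (dropʳ nil) one)))
      pick con = ≈-trans (dropʳ nil) (≈-trans (dropʳ nil) (≈-trans (dropʳ nil) (≈-trans (dropˡ nil) one)))
      pick penrose = ≈-trans (dropʳ nil) (≈-trans (dropʳ nil) (≈-trans (dropˡ (none nil nil)) one))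
      pick mdel = ≈-trans (dropʳ nil) (≈-trans (dropˡ (none (none nil nil) nil)) one)
      pick mcon = ≈-trans (dropˡ (none (none (none nil nil) nil) nil)) one

  -- The linear system and the substitution of `H`

  module Host {k} (H : Pres (suc k)) (wfH : WF H) (e : Fin (suc k)) (a b c′ x y : Carrier) where
    open Outside H wfH e using (type; far)

    B : Op → Carrier
    B = ops a b c′ x y

    outer : Vec Op k → Carrier
    outer t = weight (λ _ → B) t * monomial (far t)

    -- the states of H ∖ e under which H behaves, seen from e, like the operation o
    C : Op → Carrier
    C o = ΣS k (λ t → δ o (type t) * outer t)

    collect : ∀ (g : Op → Carrier) → ΣS k (λ t → outer t * g (type t)) ≈ ΣO (λ o → C o * g o)
    collect g = begin
      ΣS k (λ t → outer t * g (type t))                            ≈⟨ ΣS-cong k (λ t → select (outer t) g (type t)) ⟩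
      ΣS k (λ t → ΣO (λ o → (δ o (type t) * outer t) * g o))       ≈⟨ ΣS-ΣO k (λ o t → (δ o (type t) * outer t) * g o) ⟩
      ΣO (λ o → ΣS k (λ t → (δ o (type t) * outer t) * g o))       ≈⟨ ΣO-cong (λ o → ≈-trans (ΣS-cong k (λ t → *-comm (δ o (type t) * outer t) (g o)))
              (≈-trans (≈-sym (ΣS-distribˡ k (g o) (λ t → δ o (type t) * outer t))) (*-comm (g o) (C o)))) ⟩
      ΣO (λ o → C o * g o)                                         ∎

    -- By `apply-count` the monomial of a state factors into a part from `far`, common to all five
    -- operations at `e`, and a part depending only on `o` and the type of the state. Grouping by
    -- type gives one row of the system.
    row : ∀ o → Q (apply o H e) a b c′ x y α β γ ≈ ΣO (λ o′ → C o′ * monomial (λ κ → rank (part κ o) (part κ o′)))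
    row o = begin
      Q (apply o H e) a b c′ x y α β γ                                            ≈⟨ Q-Qw (apply o H e) a b c′ x y ⟩
      Qw (λ _ → B) (apply o H e)                                                  ≈⟨ Qw-states _ (apply o H e) ⟩
      ΣS k (λ t → weight (λ _ → B) t * monomial (λ κ → N κ (apply o H e) t))       ≈⟨ ΣS-cong k per-state ⟩
      ΣS k (λ t → outer t * monomial (λ κ → rank (part κ o) (part κ (type t))))    ≈⟨ collect (λ o′ → monomial (λ κ → rank (part κ o) (part κ o′))) ⟩
      ΣO (λ o′ → C o′ * monomial (λ κ → rank (part κ o) (part κ o′)))              ∎
      where
      per-state : ∀ t → weight (λ _ → B) t * monomial (λ κ → N κ (apply o H e) t) ≈
        outer t * monomial (λ κ → rank (part κ o) (part κ (type t)))
      per-state t = ≈-trans (*-congˡ (≈-trans (monomial-cong (λ κ → ApplyCount.apply-count H wfH e t κ o))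
          (≈-trans (monomial-+ (λ κ → rank (part κ o) (part κ (type t))) (far t)) (*-comm _ _)))) (≈-sym (*-assoc _ _ _))

    opaque
      unfolding ΣO

      -- The exponents `i j k` in `m` are the ranks for circles, vertex blocks and boundary blocks.
      -- For instance, `m 2 2 1` belongs to deletion against deletion: the arrows stay apart for the
      -- first two kinds, while the boundary blocks are merged.
      C-solves : Solves H e a b c′ x y α β γ (C del) (C con) (C penrose) (C mdel) (C mcon)
      C-solves =
        ≈-trans (solve 8 (λ a b c p₁ p₂ p₃ p₄ p₅ → let m = mono a b c in
            a :* b :* c :* (a :* b :* p₁ :+ p₂ :+ p₃ :+ a :* p₄ :+ p₅) :=
            p₁ :* m 2 2 1 :+ p₂ :* m 1 1 1 :+ p₃ :* m 1 1 1 :+ p₄ :* m 2 1 1 :+ p₅ :* m 1 1 1) ≈-refl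
          α β γ (C del) (C con) (C penrose) (C mdel) (C mcon)) (≈-sym (row del)) ,
        ≈-trans (solve 8 (λ a b c p₁ p₂ p₃ p₄ p₅ → let m = mono a b c in
            a :* b :* c :* (p₁ :+ a :* c :* p₂ :+ p₃ :+ p₄ :+ a :* p₅) :=
            p₁ :* m 1 1 1 :+ p₂ :* m 2 1 2 :+ p₃ :* m 1 1 1 :+ p₄ :* m 1 1 1 :+ p₅ :* m 2 1 1) ≈-refl
          α β γ (C del) (C con) (C penrose) (C mdel) (C mcon)) (≈-sym (row con)) ,
        ≈-trans (solve 8 (λ a b c p₁ p₂ p₃ p₄ p₅ → let m = mono a b c in
            a :* b :* c :* (p₁ :+ p₂ :+ a :* p₃ :+ p₄ :+ p₅) :=
            p₁ :* m 1 1 1 :+ p₂ :* m 1 1 1 :+ p₃ :* m 2 1 1 :+ p₄ :* m 1 1 1 :+ p₅ :* m 1 1 1) ≈-refl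
          α β γ (C del) (C con) (C penrose) (C mdel) (C mcon)) (≈-sym (row penrose)) ,
        ≈-trans (solve 8 (λ a b c p₁ p₂ p₃ p₄ p₅ → let m = mono a b c in
            a :* b :* c :* (a :* p₁ :+ p₂ :+ p₃ :+ a :* p₄ :+ p₅) :=
            p₁ :* m 2 1 1 :+ p₂ :* m 1 1 1 :+ p₃ :* m 1 1 1 :+ p₄ :* m 2 1 1 :+ p₅ :* m 1 1 1) ≈-refl
          α β γ (C del) (C con) (C penrose) (C mdel) (C mcon)) (≈-sym (row mdel)) ,
        ≈-trans (solve 8 (λ a b c p₁ p₂ p₃ p₄ p₅ → let m = mono a b c in
            a :* b :* c :* (p₁ :+ a :* p₂ :+ p₃ :+ p₄ :+ a :* p₅) :=
            p₁ :* m 1 1 1 :+ p₂ :* m 2 1 1 :+ p₃ :* m 1 1 1 :+ p₄ :* m 1 1 1 :+ p₅ :* m 2 1 1) ≈-refl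
          α β γ (C del) (C con) (C penrose) (C mdel) (C mcon)) (≈-sym (row mcon))
        where
        open Solver commutativeSemiring using (Polynomial; solve; _:+_; _:*_; _:=_) renaming (con to number)
        power : ∀ {n} → Polynomial n → ℕ → Polynomial n
        power v zero = number 1
        power v (suc i) = v :* power v i
        mono : ∀ {n} → (a b c : Polynomial n) → ℕ → ℕ → ℕ → Polynomial n
        mono a b c i j k = power a i :* power b j :* power c k

    module Solution (φs : Op → Carrier)
                    (unique : UniqueSolution H e a b c′ x y α β γ (φs del) (φs con) (φs penrose) (φs mdel) (φs mcon)) where
      C≈φ : ∀ o → C o ≈ φs o
      C≈φ o with e₁ , e₂ , e₃ , e₄ , e₅ ← proj₂ unique (C del) (C con) (C penrose) (C mdel) (C mcon) C-solves = pickout o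
        where
        pickout : ∀ o → C o ≈ φs o
        pickout del = e₁
        pickout con = e₂
        pickout penrose = e₃
        pickout mdel = e₄
        pickout mcon = e₅

      substitute : ∀ (g : Op → Carrier) → ΣS k (λ t → outer t * g (type t)) ≈ ΣO (λ o → φs o * g o)
      substitute g = ≈-trans (collect g) (ΣO-cong (λ o → *-congʳ (C≈φ o)))

      -- A state of the 2-sum splits as `s ++ t`, and its monomial into that of `type t ∷ s` on `P`
      -- and that of the far classes. Summing over `t` by type leaves the φ's as the weights of the
      -- five operations at edge `zero` of `P`.
      Qw-twoSum : ∀ n {j} (P : Pres (suc n ℕ.+ j)) → WF P → ∀ φ →
        Qw (mixed φs B n) (twoSum P H e φ) ≈ Qw (mixed φs B (suc n)) P
      Qw-twoSum n {j} P wfP φ = begin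
        Qw w (twoSum P H e φ)
          ≈⟨ Qw-states w (twoSum P H e φ) ⟩
        ΣS (n ℕ.+ j ℕ.+ k) (λ u → weight w u * monomial (λ κ → N κ (twoSum P H e φ) u))
          ≈⟨ ΣS-++ (n ℕ.+ j) k (λ u → weight w u * monomial (λ κ → N κ (twoSum P H e φ) u)) ⟩
        ΣS (n ℕ.+ j) (λ s → ΣS k (λ t → weight w (s Vec.++ t) * monomial (λ κ → N κ (twoSum P H e φ) (s Vec.++ t))))
          ≈⟨ ΣS-cong (n ℕ.+ j) per-state ⟩
        ΣS (n ℕ.+ j) (λ s → ΣO (λ o → φs o * (weight w s * F s o)))
          ≈⟨ ΣS-ΣO (n ℕ.+ j) (λ o s → φs o * (weight w s * F s o)) ⟩
        ΣO (λ o → ΣS (n ℕ.+ j) (λ s → φs o * (weight w s * F s o)))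
          ≈⟨ ΣO-cong (λ o → ≈-trans (≈-sym (ΣS-distribˡ (n ℕ.+ j) (φs o) (λ s → weight w s * F s o))) (*-congˡ (≈-sym (Qw-states w (apply o P zero))))) ⟩
        ΣO (λ o → φs o * Qw w (apply o P zero)) ∎
        where
        w : Weights
        w = mixed φs B n
        F : Vec Op (n ℕ.+ j) → Op → Carrier
        F s o = monomial (λ κ → N κ P (o ∷ s))
        per-pair : ∀ s t → weight w (s Vec.++ t) * monomial (λ κ → N κ (twoSum P H e φ) (s Vec.++ t)) ≈ weight w s * (outer t * F s (type t))
        per-pair s t = begin
          weight w (s Vec.++ t) * monomial (λ κ → N κ (twoSum P H e φ) (s Vec.++ t))
            ≈⟨ *-cong (weight-mixed-++ φs B n s t) (≈-trans (monomial-cong (Sum2Count.twoSum-count P H e φ wfP wfH s t)) (monomial-+ (λ κ → N κ P (type t ∷ s)) (far t))) ⟩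
          (weight w s * weight (λ _ → B) t) * (F s (type t) * monomial (far t))
            ≈⟨ *-assoc _ _ _ ⟩
          weight w s * (weight (λ _ → B) t * (F s (type t) * monomial (far t)))
            ≈⟨ *-congˡ (≈-trans (*-congˡ (*-comm _ _)) (≈-sym (*-assoc _ _ _))) ⟩
          weight w s * (outer t * F s (type t)) ∎
        per-state : ∀ s → ΣS k (λ t → weight w (s Vec.++ t) * monomial (λ κ → N κ (twoSum P H e φ) (s Vec.++ t))) ≈ ΣO (λ o → φs o * (weight w s * F s o))
        per-state s = begin
          ΣS k (λ t → weight w (s Vec.++ t) * monomial (λ κ → N κ (twoSum P H e φ) (s Vec.++ t)))
            ≈⟨ ΣS-cong k (per-pair s) ⟩
          ΣS k (λ t → weight w s * (outer t * F s (type t)))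
            ≈⟨ ≈-sym (ΣS-distribˡ k (weight w s) (λ t → outer t * F s (type t))) ⟩
          weight w s * ΣS k (λ t → outer t * F s (type t))
            ≈⟨ *-congˡ (substitute (F s)) ⟩
          weight w s * ΣO (λ o → φs o * F s o)
            ≈⟨ ΣO-distribˡ (weight w s) (λ o → φs o * F s o) ⟩
          ΣO (λ o → weight w s * (φs o * F s o))
            ≈⟨ ΣO-cong (λ o → ≈-trans (≈-sym (*-assoc _ _ _)) (≈-trans (*-congʳ (*-comm _ _)) (*-assoc _ _ _))) ⟩
          ΣO (λ o → φs o * (weight w s * F s o)) ∎

      -- The 2-sums are undone from the last to the first; each step restores one edge of `P`, now
      -- with the φ's as weights.
      Qw-tens : ∀ n j (P : Pres (n ℕ.+ j)) → WF P → ∀ φ → Qw (λ _ → B) (tens H e n j P φ) ≈ Qw (mixed φs B n) P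
      Qw-tens zero j P wfP φ = ≈-refl
      Qw-tens (suc n) j P wfP φ = begin
        Qw (λ _ → B) (tens H e n (j ℕ.+ k) (subst Pres (ℕ.+-assoc n j k) (twoSum P H e (φ zero))) (φ ∘ suc))
          ≈⟨ Qw-tens n (j ℕ.+ k) (subst Pres (ℕ.+-assoc n j k) (twoSum P H e (φ zero))) (WF-subst (ℕ.+-assoc n j k) (Sum2.twoSum-WF P H e (φ zero) wfP wfH)) (φ ∘ suc) ⟩
        Qw (mixed φs B n) (subst Pres (ℕ.+-assoc n j k) (twoSum P H e (φ zero)))
          ≈⟨ reflexive (Qw-subst (mixed φs B n) (ℕ.+-assoc n j k) (twoSum P H e (φ zero))) ⟩
        Qw (mixed φs B n) (twoSum P H e (φ zero))
          ≈⟨ Qw-twoSum n P wfP (φ zero) ⟩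
        Qw (mixed φs B (suc n)) P ∎

      Qw-tensor : ∀ {n} (P : Pres n) → WF P → ∀ φ → Qw (λ _ → B) (tensor P H e φ) ≈ Qw (λ _ → φs) P
      Qw-tensor {n} P wfP φ = begin
        Qw (λ _ → B) (tensor P H e φ)                                    ≈⟨ Qw-tens n 0 (subst Pres (sym (ℕ.+-identityʳ n)) P) (WF-subst (sym (ℕ.+-identityʳ n)) wfP) φ ⟩
        Qw (mixed φs B n) (subst Pres (sym (ℕ.+-identityʳ n)) P)       ≈⟨ reflexive (Qw-subst (mixed φs B n) (sym (ℕ.+-identityʳ n)) P) ⟩
        Qw (mixed φs B n) P                                              ≈⟨ Qw-mixed-all φs B P ⟩
        Qw (λ _ → φs) P                                                  ∎

theorem3p3 : ∀ {c ℓ : Level} (R : CommutativeRing c ℓ) {n k : ℕ}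
    (P : Pres n) (H : Pres (suc k)) (e : Fin (suc k)) → WF P → WF H →
    (φ : Fin n → Coupling) →
    (a b c' x y α β γ : CommutativeRing.Carrier R) →
    (φ₁ φ₂ φ₃ φ₄ φ₅ : CommutativeRing.Carrier R) →
    Poly.UniqueSolution R H e a b c' x y α β γ φ₁ φ₂ φ₃ φ₄ φ₅ →
    CommutativeRing._≈_ R
    (Poly.Q R (tensor P H e φ) a b c' x y α β γ)
    (Poly.Q R P φ₁ φ₂ φ₃ φ₄ φ₅ α β γ)
theorem3p3 R P H e wfP wfH φ a b c' x y α β γ φ₁ φ₂ φ₃ φ₄ φ₅ unique = begin
    Poly.Q R (tensor P H e φ) a b c' x y α β γ         ≈⟨ Q-Qw (tensor P H e φ) a b c' x y ⟩
    Qw (λ _ → ops a b c' x y) (tensor P H e φ)         ≈⟨ Host.Solution.Qw-tensor H wfH e a b c' x y (ops φ₁ φ₂ φ₃ φ₄ φ₅) unique P wfP φ ⟩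
    Qw (λ _ → ops φ₁ φ₂ φ₃ φ₄ φ₅) P                    ≈⟨ CommutativeRing.sym R (Q-Qw P φ₁ φ₂ φ₃ φ₄ φ₅) ⟩
    Poly.Q R P φ₁ φ₂ φ₃ φ₄ φ₅ α β γ                    ∎
  where
  open StateSum R α β γ
  open SetoidReasoning (CommutativeRing.setoid R)
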